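{- (Free Construction.) Let $\mathcal{L}$ be a closed signature, $\mathsf{S}$ a symmetric closed multicategory, and $i$ a map of closed signatures from $\mathcal{L}$ to the underlying signature of $\mathsf{S}$. Then there exists a unique symmetric closed functor $i^\ast:\mathcal{F}_{sc}(\mathcal{L})\to\mathsf{S}$ such that $i^\ast(a)=i(a)$ for every type $a$ and $i^\ast([f(x_1,\dots,x_n)])=i(f)$ for every multiarrow $f$ of $\mathcal{L}$.
   Context: Notation: $S_n$ symmetric group; for a list $\gamma=c_1,\dots,c_n$ and $\sigma\in S_n$, $\gamma\cdot\sigma=c_{\sigma(1)},\dots,c_{\sigma(n)}$; an $(n_1,\dots,n_k)$-shuffle is a bijection $\sum_i[n_i]\cong[\sum n_i]$ monotone on each $[n_i]$; $\mathsf{shu}(\gamma_0,\dots,\gamma_k)$ is the set of $(|\gamma_0|,\dots,|\gamma_k|)$-shuffles acting on the concatenation. A closed signature consists of a set $\mathcal{A}$ of atoms and a multigraph $\mathcal{L}$ whose nodes (types) are generated by $a ::= o\in\mathcal{A} \mid (a_1\otimes\cdots\otimes a_k)\multimap a$, with sets $\mathcal{L}(a_1,\dots,a_n;b)$ of multiarrows. A symmetric multicategory has actions $-\cdot\sigma:\mathsf{S}(\gamma,a_1,\dots,a_k;a)\cong\mathsf{S}(\gamma,a_{\sigma(1)},\dots,a_{\sigma(k)};a)$ satisfying the usual axioms; a closed structure consists of chosen objects $(a_1\otimes\cdots\otimes a_k)\multimap a$ and evaluation morphisms $ev$ such that composing with $ev$ (and identities on $a_1,\dots,a_k$) gives bijections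 $\mathsf{S}(\gamma;(a_1\otimes\cdots\otimes a_k)\multimap a)\cong\mathsf{S}(\gamma,a_1,\dots,a_k;a)$, multinatural in $\gamma$ and natural in $a$. A symmetric closed functor preserves composition, identities, symmetric actions, the chosen objects $(\dots)\multimap a$ and $ev$ on the nose. A map of closed signatures $i$ assigns objects $i(a)$ with $i((a_1\otimes\cdots\otimes a_k)\multimap a)=(i(a_1)\otimes\cdots\otimes i(a_k))\multimap i(a)$ and morphisms $i(f)\in\mathsf{S}(i(a_1),\dots,i(a_n);i(b))$. Symmetric closed terms: $s ::= x \mid \lambda\langle x_1^{a_1},\dots,x_k^{a_k}\rangle s \mid s\langle s_1,\dots,s_k\rangle \mid f(s_1,\dots,s_n)$, up to renaming of bound variables. Typing (contexts: disjoint lists of distinct variables): $x:a\vdash x:a$; if $\gamma,x_1:a_1,\dots,x_k:a_k\vdash s:b$ then $\gamma\vdash\lambda\langle\vec{x}\rangle s:(a_1\otimes\cdots\otimes a_k)\multimap b$; if $\gamma_0\vdash s:(a_1\otimes\cdots\otimes a_k)\multimap b$, $\gamma_i\vdash t_i:a_i$, $\sigma\in\mathsf{shu}(\gamma_0,\dots,\gamma_k)$ then $(\gamma_0,\dots,\gamma_k)\cdot\sigma\vdash s\langle t_1,\dots,t_k\rangle:b$; if $f\in\mathcal{L}(a_1,\dots,a_n;b)$, $\gamma_i\vdash s_i:a_i$, $\sigma\in\mathsf{shu}(\gamma_1,\dots,\gamma_n)$ then $(\gamma_1,\dots,\gamma_n)\cdot\sigma\vdash f(s_1,\dots,s_n):b$.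 Contexts with hole: $\mathtt{C} ::= [\cdot] \mid s\langle s_1,\dots,\mathtt{C},\dots,s_k\rangle \mid \mathtt{C}\langle s_1,\dots,s_k\rangle \mid \lambda\langle\vec{x}\rangle\mathtt{C} \mid f(s_1,\dots,\mathtt{C},\dots,s_n)$; $\mathtt{E}$ same except $\mathtt{E}\langle s_1,\dots,s_k\rangle$ requires $\mathtt{E}\neq[\cdot]$. $\beta$: $(\lambda\langle x_1,\dots,x_k\rangle s)\langle t_1,\dots,t_k\rangle\to_\beta s\{t_1/x_1,\dots,t_k/x_k\}$ in $\mathtt{C}$-contexts; $\eta$: $s\to_\eta\lambda\langle x_1^{a_1},\dots,x_k^{a_k}\rangle(s\langle x_1,\dots,x_k\rangle)$ when $s$ has type $(a_1\otimes\cdots\otimes a_k)\multimap a$, $x_i$ fresh, $s$ not a $\lambda$-abstraction, in $\mathtt{E}$-contexts; $=_{\mathsf{sc}}$ is the equivalence generated by $\to_\beta\cup\to_\eta$. $\mathcal{F}_{sc}(\mathcal{L})$: objects are types, morphisms $a_1,\dots,a_n\to a$ are terms $s$ with $x_1:a_1,\dots,x_n:a_n\vdash s:a$ modulo $=_{\mathsf{sc}}$, composition by substitution, identities $[x]$; symmetric action reindexes the context; closed structure with $ev=[y\langle x_1,\dots,x_k\rangle]$. -}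

module Defs where

open import Level using (Level; _⊔_) renaming (suc to lsuc)
open import Data.List using (List; []; _∷_; _++_; map)
open import Data.List.Properties using (++-assoc; ++-identityʳ; map-++)
open import Data.Product using (Σ; _,_; proj₁; proj₂)
open import Data.Sum using (_⊎_; inj₁; inj₂; [_,_]′)
open import Data.Bool using (Bool; true; false)
open import Data.Empty using (⊥)
open import Data.Unit using (⊤; tt)
open import Relation.Binary.PropositionalEquality
open import Relation.Binary.Structures using (IsEquivalence)
open import Relation.Binary.Construct.Closure.Equivalence using (EqClosure)
open import Data.List.Relation.Unary.All using (All; []; _∷_)

module _ {a : Level} {A : Set a} where

  infix 4 _∋_
  data _∋_ : List A → A → Set a where
    here  : ∀ {x xs} → (x ∷ xs) ∋ x
    there : ∀ {x y xs} → xs ∋ x → (y ∷ xs) ∋ x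

  wkˡ : ∀ {xs ys x} → xs ∋ x → (xs ++ ys) ∋ x
  wkˡ here      = here
  wkˡ (there p) = there (wkˡ p)

  wkʳ : ∀ xs {ys x} → ys ∋ x → (xs ++ ys) ∋ x
  wkʳ []       p = p
  wkʳ (_ ∷ xs) p = there (wkʳ xs p)

  split : ∀ xs {ys x} → (xs ++ ys) ∋ x → xs ∋ x ⊎ ys ∋ x
  split []       p         = inj₂ p
  split (_ ∷ xs) here      = inj₁ here
  split (_ ∷ xs) (there p) with split xs p
  ... | inj₁ q = inj₁ (there q)
  ... | inj₂ q = inj₂ q

  split-wkˡ : ∀ {xs ys x} (p : xs ∋ x) → split xs {ys} (wkˡ p) ≡ inj₁ p
  split-wkˡ here = refl
  split-wkˡ {_ ∷ xs} {ys} (there p) rewrite split-wkˡ {xs} {ys} p = refl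

  split-wkʳ : ∀ xs {ys x} (p : ys ∋ x) → split xs (wkʳ xs p) ≡ inj₂ p
  split-wkʳ []       p = refl
  split-wkʳ (_ ∷ xs) p rewrite split-wkʳ xs p = refl

  unsplit : ∀ xs {ys x} → xs ∋ x ⊎ ys ∋ x → (xs ++ ys) ∋ x
  unsplit xs = [ wkˡ , wkʳ xs ]′

  unsplit-split : ∀ xs {ys x} (p : (xs ++ ys) ∋ x) → unsplit xs (split xs p) ≡ p
  unsplit-split []       p = refl
  unsplit-split (_ ∷ xs) here = refl
  unsplit-split (_ ∷ xs) (there p) with split xs p | unsplit-split xs p
  ... | inj₁ q | e = cong there e
  ... | inj₂ q | e = cong there e

  -- A "reindexing"  Reindex Γ Δ  is a type-preserving bijection between the
  -- positions of Γ and of Δ.  It encodes exactly a permutation σ with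
  -- Δ = Γ·σ : the entry at position j of Δ is the entry at position to(j) of Γ.
  record Reindex (Γ Δ : List A) : Set a where
    field
      to      : ∀ {x} → Δ ∋ x → Γ ∋ x
      from    : ∀ {x} → Γ ∋ x → Δ ∋ x
      to-from : ∀ {x} (p : Γ ∋ x) → to (from p) ≡ p
      from-to : ∀ {x} (p : Δ ∋ x) → from (to p) ≡ p
  open Reindex public

  idR : ∀ {Γ} → Reindex Γ Γ
  idR = record { to = λ p → p ; from = λ p → p ; to-from = λ _ → refl ; from-to = λ _ → refl }

  _⨾R_ : ∀ {Γ Δ Θ} → Reindex Γ Δ → Reindex Δ Θ → Reindex Γ Θ
  ρ ⨾R ρ' = record
    { to      = λ p → to ρ (to ρ' p)
    ; from    = λ p → from ρ' (from ρ p)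
    ; to-from = λ p → trans (cong (to ρ) (to-from ρ' (from ρ p))) (to-from ρ p)
    ; from-to = λ p → trans (cong (from ρ') (from-to ρ (to ρ' p))) (from-to ρ' p)
    }

-- Concatenation of a family of lists indexed by the positions of a list
-- (the input context of a multicomposite  f(g_1,...,g_n) )

module _ {b x : Level} {B : Set b} {X : Set x} where

  Fam : List B → Set (b ⊔ x)
  Fam bs = ∀ {c} → bs ∋ c → List X

  concatF : (bs : List B) → Fam bs → List X
  concatF []       Γs = []
  concatF (c ∷ bs) Γs = Γs here ++ concatF bs (λ p → Γs (there p))

  inj : ∀ {bs : List B} {Γs : Fam bs} {c y} (p : bs ∋ c) → Γs p ∋ y → concatF bs Γs ∋ y
  inj {c ∷ bs} {Γs} here      q = wkˡ q
  inj {c ∷ bs} {Γs} (there p) q = wkʳ (Γs here) (inj {bs} {λ r → Γs (there r)} p q)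

  record Block (bs : List B) (Γs : Fam bs) (y : X) : Set (b ⊔ x) where
    constructor block
    field
      {blk}   : B
      pos     : bs ∋ blk
      inner   : Γs pos ∋ y
  open Block public

  unblock : ∀ {bs : List B} {Γs : Fam bs} {y} → Block bs Γs y → concatF bs Γs ∋ y
  unblock (block p q) = inj p q

  prj : ∀ {bs : List B} {Γs : Fam bs} {y} → concatF bs Γs ∋ y → Block bs Γs y
  prj {c ∷ bs} {Γs} r with split (Γs here) r
  ... | inj₁ q = block here q
  ... | inj₂ r' with prj {bs} {λ p → Γs (there p)} r'
  ...   | block p q = block (there p) q

  prj-inj : ∀ {bs : List B} {Γs : Fam bs} {c y} (p : bs ∋ c) (q : Γs p ∋ y) →
            prj {bs} {Γs} (inj p q) ≡ block p q
  prj-inj {c ∷ bs} {Γs} here q rewrite split-wkˡ {ys = concatF bs (λ p → Γs (there p))} q = refl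
  prj-inj {c ∷ bs} {Γs} (there p) q
    rewrite split-wkʳ (Γs here) (inj {bs} {λ r → Γs (there r)} p q)
          | prj-inj {bs} {λ r → Γs (there r)} p q = refl

  inj-prj : ∀ {bs : List B} {Γs : Fam bs} {y} (r : concatF bs Γs ∋ y) → unblock (prj {bs} {Γs} r) ≡ r
  inj-prj {c ∷ bs} {Γs} r with split (Γs here) r | unsplit-split (Γs here) r
  ... | inj₁ q | e = e
  ... | inj₂ r' | e with prj {bs} {λ p → Γs (there p)} r' | inj-prj {bs} {λ p → Γs (there p)} r'
  ...   | block p q | e' = trans (cong (wkʳ (Γs here)) e') e

  ⊕R : ∀ {bs : List B} {Γs Δs : Fam bs} → (∀ {c} (p : bs ∋ c) → Reindex (Γs p) (Δs p)) →
       Reindex (concatF bs Γs) (concatF bs Δs)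
  ⊕R {bs} {Γs} {Δs} ρs = record
    { to      = λ r → fwd (prj r)
    ; from    = λ r → bwd (prj r)
    ; to-from = λ r → tf (prj r) (inj-prj {bs} {Γs} r)
    ; from-to = λ r → ft (prj r) (inj-prj {bs} {Δs} r)
    }
    where
    fwd : ∀ {y} → Block bs Δs y → concatF bs Γs ∋ y
    fwd (block p q) = inj p (to (ρs p) q)
    bwd : ∀ {y} → Block bs Γs y → concatF bs Δs ∋ y
    bwd (block p q) = inj p (from (ρs p) q)
    tf : ∀ {y} {r : concatF bs Γs ∋ y} (β : Block bs Γs y) → unblock β ≡ r → fwd (prj (bwd β)) ≡ r
    tf (block p q) e = trans (cong fwd (prj-inj p (from (ρs p) q))) (trans (cong (inj p) (to-from (ρs p) q)) e)
    ft : ∀ {y} {r : concatF bs Δs ∋ y} (β : Block bs Δs y) → unblock β ≡ r → bwd (prj (fwd β)) ≡ r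
    ft (block p q) e = trans (cong bwd (prj-inj p (to (ρs p) q))) (trans (cong (inj p) (from-to (ρs p) q)) e)

module _ {a : Level} {A : Set a} where

  concatF-single : ∀ (bs : List A) → concatF bs (λ {c} _ → c ∷ []) ≡ bs
  concatF-single []       = refl
  concatF-single (c ∷ bs) = cong (c ∷_) (concatF-single bs)

  concatF-++ : ∀ (bs cs : List A) (Γs : Fam {X = A} (bs ++ cs)) →
    concatF (bs ++ cs) Γs ≡ concatF bs (λ p → Γs (wkˡ p)) ++ concatF cs (λ p → Γs (wkʳ bs p))
  concatF-++ []       cs Γs = refl
  concatF-++ (c ∷ bs) cs Γs =
    trans (cong (Γs here ++_) (concatF-++ bs cs (λ p → Γs (there p))))
          (sym (++-assoc (Γs here) _ _))

  concatF-assoc : ∀ (bs : List A) (Γs : Fam {X = A} bs) (Δs : Fam {X = A} (concatF bs Γs)) →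
    concatF (concatF bs Γs) Δs ≡ concatF bs (λ p → concatF (Γs p) (λ q → Δs (inj p q)))
  concatF-assoc []       Γs Δs = refl
  concatF-assoc (c ∷ bs) Γs Δs =
    trans (concatF-++ (Γs here) _ Δs)
          (cong (concatF (Γs here) (λ q → Δs (wkˡ q)) ++_)
                (concatF-assoc bs (λ p → Γs (there p)) (λ q → Δs (wkʳ (Γs here) q))))

module _ {a b : Level} {A : Set a} {B : Set b} (f : A → B) where

  map⁺ : ∀ {Γ x} → Γ ∋ x → map f Γ ∋ f x
  map⁺ here      = here
  map⁺ (there p) = there (map⁺ p)

  record MapPos (Γ : List A) (y : B) : Set (a ⊔ b) where
    constructor mpos
    field
      {pt} : A
      mp   : Γ ∋ pt
      meq  : f pt ≡ y
  open MapPos public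

  map⁻ : ∀ {Γ y} → map f Γ ∋ y → MapPos Γ y
  map⁻ {c ∷ Γ} here      = mpos here refl
  map⁻ {c ∷ Γ} (there q) with map⁻ {Γ} q
  ... | mpos p e = mpos (there p) e

  unmap : ∀ {Γ y} → MapPos Γ y → map f Γ ∋ y
  unmap {Γ} (mpos p e) = subst (map f Γ ∋_) e (map⁺ p)

  map⁻-map⁺ : ∀ {Γ x} (p : Γ ∋ x) → map⁻ (map⁺ p) ≡ mpos p refl
  map⁻-map⁺ here = refl
  map⁻-map⁺ (there p) rewrite map⁻-map⁺ p = refl

  map⁻-unmap : ∀ {Γ y} (m : MapPos Γ y) → map⁻ (unmap m) ≡ m
  map⁻-unmap (mpos p refl) = map⁻-map⁺ p

  unmap-map⁻ : ∀ {Γ y} (q : map f Γ ∋ y) → unmap (map⁻ q) ≡ q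
  unmap-map⁻ {c ∷ Γ} here = refl
  unmap-map⁻ {c ∷ Γ} (there q) with map⁻ {Γ} q | unmap-map⁻ {Γ} q
  ... | mpos p refl | e = cong there e

  mapR : ∀ {Γ Δ} → Reindex Γ Δ → Reindex (map f Γ) (map f Δ)
  mapR {Γ} {Δ} ρ = record
    { to      = λ q → fwd (map⁻ q)
    ; from    = λ q → bwd (map⁻ q)
    ; to-from = λ q → tf (map⁻ q) (unmap-map⁻ q)
    ; from-to = λ q → ft (map⁻ q) (unmap-map⁻ q)
    }
    where
    fwd : ∀ {y} → MapPos Δ y → map f Γ ∋ y
    fwd (mpos p e) = unmap (mpos (to ρ p) e)
    bwd : ∀ {y} → MapPos Γ y → map f Δ ∋ y
    bwd (mpos p e) = unmap (mpos (from ρ p) e)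
    tf : ∀ {y} {q : map f Γ ∋ y} (m : MapPos Γ y) → unmap m ≡ q → fwd (map⁻ (bwd m)) ≡ q
    tf (mpos p e) e' = trans (cong fwd (map⁻-unmap (mpos (from ρ p) e)))
                             (trans (cong (λ r → unmap (mpos r e)) (to-from ρ p)) e')
    ft : ∀ {y} {q : map f Δ ∋ y} (m : MapPos Δ y) → unmap m ≡ q → bwd (map⁻ (fwd m)) ≡ q
    ft (mpos p e) e' = trans (cong bwd (map⁻-unmap (mpos (to ρ p) e)))
                             (trans (cong (λ r → unmap (mpos r e)) (from-to ρ p)) e')

  mapFam : ∀ {c} {C : Set c} {Γ : List A} → (∀ {x} → Γ ∋ x → C) → ∀ {y} → map f Γ ∋ y → C
  mapFam Γs q = Γs (mp (map⁻ q))

  mapFamHom : ∀ {c h} {C : Set c} (H : List C → B → Set h) {Γ : List A} (Γs : ∀ {x} → Γ ∋ x → List C) →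
              (∀ {x} (p : Γ ∋ x) → H (Γs p) (f x)) →
              ∀ {y} (q : map f Γ ∋ y) → H (mapFam Γs q) y
  mapFamHom H Γs hs q = subst (H (Γs (mp (map⁻ q)))) (meq (map⁻ q)) (hs (mp (map⁻ q)))

  map-concatF : ∀ (Γ : List A) (Γs : ∀ {x} → Γ ∋ x → List A) →
                map f (concatF Γ Γs) ≡ concatF (map f Γ) (mapFam (λ p → map f (Γs p)))
  map-concatF []      Γs = refl
  map-concatF (c ∷ Γ) Γs = trans (map-++ f (Γs here) _) (cong (map f (Γs here) ++_) (map-concatF Γ (λ p → Γs (there p))))

module _ {a : Level} {A : Set a} where

  singleCtx : List A → ∀ {c b : A} → (c ∷ []) ∋ b → List A
  singleCtx Γ here      = Γ
  singleCtx Γ (there ())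

  evCtx : List A → ∀ {c : A} {bs : List A} {b : A} → (c ∷ bs) ∋ b → List A
  evCtx γ here              = γ
  evCtx γ {b = b} (there p) = b ∷ []

record RawSymClosedMulticat (o ℓ e : Level) : Set (lsuc (o ⊔ ℓ ⊔ e)) where
  infix 4 _≈_
  infixr 7 _⊸_
  field
    Obj     : Set o
    Hom     : List Obj → Obj → Set ℓ
    _≈_     : ∀ {Γ a} → Hom Γ a → Hom Γ a → Set e
    id      : ∀ {a} → Hom (a ∷ []) a
    comp    : ∀ {bs c} → Hom bs c → (Γs : Fam bs) → (∀ {b} (p : bs ∋ b) → Hom (Γs p) b) →
              Hom (concatF bs Γs) c
    -- symmetric action:  f ↦ f·σ  where  ρ : Reindex Γ Δ  encodes σ with Δ = Γ·σ
    act     : ∀ {Γ Δ a} → Hom Γ a → Reindex Γ Δ → Hom Δ a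
    -- closed structure: chosen objects (a_1 ⊗ ... ⊗ a_k) ⊸ a, evaluation, and
    -- the inverse of "composing with ev"
    _⊸_     : List Obj → Obj → Obj
    ev      : ∀ {as a} → Hom ((as ⊸ a) ∷ as) a
    curry   : ∀ {γ as a} → Hom (γ ++ as) a → Hom γ (as ⊸ a)

  singleHom : ∀ {Γ a} → Hom Γ a → ∀ {b} (p : (a ∷ []) ∋ b) → Hom (singleCtx Γ p) b
  singleHom f here = f
  singleHom f (there ())

  evHom : ∀ {γ c bs} → Hom γ c → ∀ {b} (p : (c ∷ bs) ∋ b) → Hom (evCtx γ p) b
  evHom f here      = f
  evHom f (there p) = id

  uncurry : ∀ {γ as a} → Hom γ (as ⊸ a) → Hom (γ ++ as) a
  uncurry {γ} {as} {a} f =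
    subst (λ Δ → Hom Δ a) (cong (γ ++_) (concatF-single as)) (comp ev (evCtx γ) (evHom f))

record IsSymClosedMulticat {o ℓ e : Level} (R : RawSymClosedMulticat o ℓ e) : Set (o ⊔ ℓ ⊔ e) where
  open RawSymClosedMulticat R
  field
    ≈-equiv    : ∀ {Γ a} → IsEquivalence (_≈_ {Γ} {a})
    comp-cong  : ∀ {bs c} {f f' : Hom bs c} {Γs : Fam bs} {gs gs' : ∀ {b} (p : bs ∋ b) → Hom (Γs p) b} →
                 f ≈ f' → (∀ {b} (p : bs ∋ b) → gs p ≈ gs' p) → comp f Γs gs ≈ comp f' Γs gs'
    comp-idˡ   : ∀ {Γ a} (f : Hom Γ a) →
                 subst (λ Δ → Hom Δ a) (++-identityʳ Γ) (comp id (singleCtx Γ) (singleHom f)) ≈ f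
    comp-idʳ   : ∀ {bs c} (f : Hom bs c) →
                 subst (λ Δ → Hom Δ c) (concatF-single bs) (comp f (λ {b} _ → b ∷ []) (λ _ → id)) ≈ f
    comp-assoc : ∀ {bs c} (f : Hom bs c) (Γs : Fam bs) (gs : ∀ {b} (p : bs ∋ b) → Hom (Γs p) b)
                 (Δs : Fam (concatF bs Γs)) (hs : ∀ {x} (r : concatF bs Γs ∋ x) → Hom (Δs r) x) →
                 subst (λ Θ → Hom Θ c) (concatF-assoc bs Γs Δs) (comp (comp f Γs gs) Δs hs)
                 ≈ comp f (λ p → concatF (Γs p) (λ q → Δs (inj p q)))
                          (λ p → comp (gs p) (λ q → Δs (inj p q)) (λ q → hs (inj p q)))
    act-cong   : ∀ {Γ Δ a} {f g : Hom Γ a} (ρ : Reindex Γ Δ) → f ≈ g → act f ρ ≈ act g ρ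
    act-resp   : ∀ {Γ Δ a} (f : Hom Γ a) (ρ ρ' : Reindex Γ Δ) →
                 (∀ {x} (p : Δ ∋ x) → to ρ p ≡ to ρ' p) → act f ρ ≈ act f ρ'
    act-id     : ∀ {Γ a} (f : Hom Γ a) → act f idR ≈ f
    act-⨾      : ∀ {Γ Δ Θ a} (f : Hom Γ a) (ρ : Reindex Γ Δ) (ρ' : Reindex Δ Θ) →
                 act (act f ρ) ρ' ≈ act f (ρ ⨾R ρ')
    comp-act-in  : ∀ {bs c} (f : Hom bs c) (Γs Δs : Fam bs) (gs : ∀ {b} (p : bs ∋ b) → Hom (Γs p) b)
                   (ρs : ∀ {b} (p : bs ∋ b) → Reindex (Γs p) (Δs p)) →
                   comp f Δs (λ p → act (gs p) (ρs p)) ≈ act (comp f Γs gs) (⊕R ρs)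
    -- equivariance:  (f·σ)(g_σ(1),...,g_σ(n)) = f(g_1,...,g_n)·σ⟨n_1,...,n_n⟩
    -- (R is the block permutation σ⟨n_1,...,n_n⟩, specified by its action on positions)
    comp-act-out : ∀ {bs bs' c} (f : Hom bs c) (ρ : Reindex bs bs') (Γs : Fam bs)
                   (gs : ∀ {b} (p : bs ∋ b) → Hom (Γs p) b)
                   (R : Reindex (concatF bs Γs) (concatF bs' (λ q → Γs (to ρ q)))) →
                   (∀ {b x} (q : bs' ∋ b) (r : Γs (to ρ q) ∋ x) → to R (inj q r) ≡ inj (to ρ q) r) →
                   comp (act f ρ) (λ q → Γs (to ρ q)) (λ q → gs (to ρ q)) ≈ act (comp f Γs gs) R
    curry-cong     : ∀ {γ as a} {g g' : Hom (γ ++ as) a} → g ≈ g' → curry {γ} g ≈ curry g'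
    uncurry-curry  : ∀ {γ as a} (g : Hom (γ ++ as) a) → uncurry (curry {γ} g) ≈ g
    curry-uncurry  : ∀ {γ as a} (f : Hom γ (as ⊸ a)) → curry (uncurry f) ≈ f

record SymClosedMulticat (o ℓ e : Level) : Set (lsuc (o ⊔ ℓ ⊔ e)) where
  field
    raw   : RawSymClosedMulticat o ℓ e
    isSCM : IsSymClosedMulticat raw
  open RawSymClosedMulticat raw public
  open IsSymClosedMulticat isSCM public

-- types  a ::= o | (a_1 ⊗ ... ⊗ a_k) ⊸ a   (k ≥ 0)
data Ty {ℓ : Level} (A : Set ℓ) : Set ℓ where
  atom : A → Ty A
  _⊸_  : List (Ty A) → Ty A → Ty A

record ClosedSignature (ℓ : Level) : Set (lsuc ℓ) where
  field
    Atom : Set ℓ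
    Arr  : List (Ty Atom) → Ty Atom → Set ℓ

module _ {a : Level} {A : Set a} where

  data Interleave : List A → List A → List A → Set a where
    []    : Interleave [] [] []
    left  : ∀ {x l r cs} → Interleave l r cs → Interleave (x ∷ l) r (x ∷ cs)
    right : ∀ {x l r cs} → Interleave l r cs → Interleave l (x ∷ r) (x ∷ cs)

  -- Shuffle (γ_0,...,γ_k) δ : δ = (γ_0,...,γ_k)·σ for an (|γ_0|,...,|γ_k|)-shuffle σ
  data Shuffle : List (List A) → List A → Set a where
    []  : Shuffle [] []
    _∷_ : ∀ {γ γs δ' δ} → Interleave γ δ' δ → Shuffle γs δ' → Shuffle (γ ∷ γs) δ

  allRight : ∀ (xs : List A) → Interleave [] xs xs
  allRight []       = []
  allRight (x ∷ xs) = right (allRight xs)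

  sgl : List A → List (List A)
  sgl []       = []
  sgl (x ∷ xs) = (x ∷ []) ∷ sgl xs

  sglShuffle : ∀ (xs : List A) → Shuffle (sgl xs) xs
  sglShuffle []       = []
  sglShuffle (x ∷ xs) = left (allRight xs) ∷ sglShuffle xs

module _ {a p : Level} {A : Set a} {P : A → Set p} where

  lookupAll : ∀ {xs x} → All P xs → xs ∋ x → P x
  lookupAll (px ∷ pxs) here      = px
  lookupAll (px ∷ pxs) (there q) = lookupAll pxs q

  tabAll : ∀ {xs} → (∀ {x} → xs ∋ x → P x) → All P xs
  tabAll {[]}     f = []
  tabAll {x ∷ xs} f = f here ∷ tabAll (λ q → f (there q))

-- Symmetric closed terms over a closed signature (nameless, scoped,
-- simply typed raw syntax; linearity is imposed by the typing relation ⊢)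

module Syntax {ℓ : Level} (L : ClosedSignature ℓ) where
  open ClosedSignature L

  Type : Set ℓ
  Type = Ty Atom

  data Tm (Γ : List Type) : Type → Set ℓ where
    var : ∀ {a} → Γ ∋ a → Tm Γ a
    lam : ∀ (as : List Type) {b} → Tm (Γ ++ as) b → Tm Γ (as ⊸ b)
    app : ∀ {as b} → Tm Γ (as ⊸ b) → All (Tm Γ) as → Tm Γ b
    fun : ∀ {as b} → Arr as b → All (Tm Γ) as → Tm Γ b

  Ren : List Type → List Type → Set ℓ
  Ren Γ Δ = ∀ {a} → Γ ∋ a → Δ ∋ a

  liftR : ∀ {Γ Δ} as → Ren Γ Δ → Ren (Γ ++ as) (Δ ++ as)
  liftR {Γ} {Δ} as ρ p = [ (λ q → wkˡ (ρ q)) , wkʳ Δ ]′ (split Γ p)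

  rename  : ∀ {Γ Δ a} → Ren Γ Δ → Tm Γ a → Tm Δ a
  renames : ∀ {Γ Δ as} → Ren Γ Δ → All (Tm Γ) as → All (Tm Δ) as
  rename ρ (var p)    = var (ρ p)
  rename ρ (lam as s) = lam as (rename (liftR as ρ) s)
  rename ρ (app s ts) = app (rename ρ s) (renames ρ ts)
  rename ρ (fun f ts) = fun f (renames ρ ts)
  renames ρ []       = []
  renames ρ (t ∷ ts) = rename ρ t ∷ renames ρ ts

  Sub : List Type → List Type → Set ℓ
  Sub Γ Δ = ∀ {a} → Γ ∋ a → Tm Δ a

  liftS : ∀ {Γ Δ} as → Sub Γ Δ → Sub (Γ ++ as) (Δ ++ as)
  liftS {Γ} {Δ} as σ p = [ (λ q → rename wkˡ (σ q)) , (λ q → var (wkʳ Δ q)) ]′ (split Γ p)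

  sub  : ∀ {Γ Δ a} → Sub Γ Δ → Tm Γ a → Tm Δ a
  subs : ∀ {Γ Δ as} → Sub Γ Δ → All (Tm Γ) as → All (Tm Δ) as
  sub σ (var p)    = σ p
  sub σ (lam as s) = lam as (sub (liftS as σ) s)
  sub σ (app s ts) = app (sub σ s) (subs σ ts)
  sub σ (fun f ts) = fun f (subs σ ts)
  subs σ []       = []
  subs σ (t ∷ ts) = sub σ t ∷ subs σ ts

  βsub : ∀ {Γ as} → All (Tm Γ) as → Sub (Γ ++ as) Γ
  βsub {Γ} ts p = [ var , lookupAll ts ]′ (split Γ p)

  NotLam : ∀ {Γ a} → Tm Γ a → Set
  NotLam (lam _ _) = ⊥
  NotLam _         = ⊤

  ηexp : ∀ {Γ as b} → Tm Γ (as ⊸ b) → Tm Γ (as ⊸ b)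
  ηexp {Γ} {as} s = lam as (app (rename wkˡ s) (tabAll (λ q → var (wkʳ Γ q))))

  -- one-step β/η reduction.  The flag says whether the position is an
  -- E-context (true: η allowed at the root) or the hole of C⟨s_1,...,s_k⟩
  -- with C = [·] (false: only β allowed at the root).  β is allowed in all
  -- C-contexts.
  data Step  : ∀ {Γ a} → Bool → Tm Γ a → Tm Γ a → Set ℓ
  data Steps : ∀ {Γ as} → All (Tm Γ) as → All (Tm Γ) as → Set ℓ
  data Step where
    β     : ∀ {Γ as b e} (s : Tm (Γ ++ as) b) (ts : All (Tm Γ) as) →
            Step e (app (lam as s) ts) (sub (βsub ts) s)
    η     : ∀ {Γ as b} (s : Tm Γ (as ⊸ b)) → NotLam s → Step true s (ηexp s)
    ξlam  : ∀ {Γ as b e} {s s' : Tm (Γ ++ as) b} → Step true s s' → Step e (lam as s) (lam as s')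
    ξhead : ∀ {Γ as b e} {s s' : Tm Γ (as ⊸ b)} {ts : All (Tm Γ) as} →
            Step false s s' → Step e (app s ts) (app s' ts)
    ξarg  : ∀ {Γ as b e} {s : Tm Γ (as ⊸ b)} {ts ts' : All (Tm Γ) as} →
            Steps ts ts' → Step e (app s ts) (app s ts')
    ξfun  : ∀ {Γ as b e} {f : Arr as b} {ts ts' : All (Tm Γ) as} →
            Steps ts ts' → Step e (fun f ts) (fun f ts')
  data Steps where
    here  : ∀ {Γ a as} {t t' : Tm Γ a} {ts : All (Tm Γ) as} → Step true t t' → Steps (t ∷ ts) (t' ∷ ts)
    there : ∀ {Γ a as} {t : Tm Γ a} {ts ts' : All (Tm Γ) as} → Steps ts ts' → Steps (t ∷ ts) (t ∷ ts')

  Var : List Type → Set ℓ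
  Var Γ = Σ Type (Γ ∋_)

  ρVars : ∀ {Γ} (as : List Type) → (∀ {a} → as ∋ a → Γ ∋ a) → List (Var Γ)
  ρVars []       ρ = []
  ρVars (a ∷ as) ρ = (a , ρ here) ∷ ρVars as (λ q → ρ (there q))

  allVars : ∀ Γ → List (Var Γ)
  allVars Γ = ρVars Γ (λ q → q)

  wkVar : ∀ {Γ} as → Var Γ → Var (Γ ++ as)
  wkVar as (a , p) = a , wkˡ p

  infix 4 _⊢_ _⊢*_
  data _⊢_  : ∀ {Γ a} → List (Var Γ) → Tm Γ a → Set ℓ
  data _⊢*_ : ∀ {Γ as} → List (List (Var Γ)) → All (Tm Γ) as → Set ℓ
  data _⊢_ where
    ⊢var : ∀ {Γ a} (p : Γ ∋ a) → ((a , p) ∷ []) ⊢ var p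
    ⊢lam : ∀ {Γ as b} {γ : List (Var Γ)} {s : Tm (Γ ++ as) b} →
           (map (wkVar as) γ ++ ρVars as (wkʳ Γ)) ⊢ s → γ ⊢ lam as s
    ⊢app : ∀ {Γ as b} {s : Tm Γ (as ⊸ b)} {ts : All (Tm Γ) as} {γ₀ γs δ} →
           γ₀ ⊢ s → γs ⊢* ts → Shuffle (γ₀ ∷ γs) δ → δ ⊢ app s ts
    ⊢fun : ∀ {Γ as b} {f : Arr as b} {ts : All (Tm Γ) as} {γs δ} →
           γs ⊢* ts → Shuffle γs δ → δ ⊢ fun f ts
  data _⊢*_ where
    []  : ∀ {Γ} → [] ⊢* ([] {P = Tm Γ})
    _∷_ : ∀ {Γ a as γ γs} {t : Tm Γ a} {ts : All (Tm Γ) as} → γ ⊢ t → γs ⊢* ts → (γ ∷ γs) ⊢* (t ∷ ts)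

  record Lin (Γ : List Type) (a : Type) : Set ℓ where
    constructor lin
    field
      term   : Tm Γ a
      .typed : allVars Γ ⊢ term
  open Lin public

  infix 4 _≈sc_
  _≈sc_ : ∀ {Γ a} → Lin Γ a → Lin Γ a → Set ℓ
  _≈sc_ = EqClosure (λ s t → Step true (term s) (term t))

  idLin : ∀ {a} → Lin (a ∷ []) a
  idLin = lin (var here) (⊢var here)

  compTm : ∀ {bs c} → Tm bs c → (Γs : Fam bs) → (∀ {b} (p : bs ∋ b) → Tm (Γs p) b) →
           Tm (concatF bs Γs) c
  compTm s Γs ts = sub (λ p → rename (inj {Γs = Γs} p) (ts p)) s

  actTm : ∀ {Γ Δ a} → Tm Γ a → Reindex Γ Δ → Tm Δ a
  actTm s ρ = rename (from ρ) s

  private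
    sglD : ∀ {Γ} (as : List Type) (ρ : ∀ {a} → as ∋ a → Γ ∋ a) →
           sgl (ρVars as ρ) ⊢* tabAll (λ q → var (ρ q))
    sglD []       ρ = []
    sglD (a ∷ as) ρ = ⊢var (ρ here) ∷ sglD as (λ q → ρ (there q))

  evLin : ∀ as a → Lin ((as ⊸ a) ∷ as) a
  evLin as a = lin (app (var here) (tabAll (λ q → var (there q))))
                   (⊢app (⊢var here) (sglD as there)
                         (left (allRight (ρVars as there)) ∷ sglShuffle (ρVars as there)))

  funLin : ∀ {as b} → Arr as b → Lin as b
  funLin {as} f = lin (fun f (tabAll var)) (⊢fun (sglD as (λ q → q)) (sglShuffle (allVars as)))

module _ {ℓ o m e : Level} (L : ClosedSignature ℓ) (S : SymClosedMulticat o m e) where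
  open ClosedSignature L
  open SymClosedMulticat S using (Obj; Hom) renaming (_⊸_ to _⊸ₛ_)

  record SigMap : Set (ℓ ⊔ o ⊔ m) where
    field
      obj   : Ty Atom → Obj
      obj-⊸ : ∀ (as : List (Ty Atom)) (a : Ty Atom) → obj (as ⊸ a) ≡ (map obj as ⊸ₛ obj a)
      arr   : ∀ {as b} → Arr as b → Hom (map obj as) (obj b)

module _ {ℓ o m e : Level} (L : ClosedSignature ℓ) (S : SymClosedMulticat o m e) (i : SigMap L S) where
  open ClosedSignature L using (Arr)
  open Syntax L
  open SigMap i
  open SymClosedMulticat S using (Obj; Hom; _≈_; id; comp; act; ev)

  -- a symmetric closed functor  F : F_sc(L) → S  whose object part is  a ↦ i(a)
  -- (so it preserves the chosen objects (..)⊸a on the nose because i does)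
  record SCFunctor : Set (lsuc ℓ ⊔ o ⊔ m ⊔ e) where
    field
      F₁     : ∀ {Γ a} → Lin Γ a → Hom (map obj Γ) (obj a)
      F-cong : ∀ {Γ a} {s t : Lin Γ a} → s ≈sc t → F₁ s ≈ F₁ t
      F-id   : ∀ {a} → F₁ (idLin {a}) ≈ id
      F-comp : ∀ {bs c} (s : Lin bs c) (Γs : Fam bs) (ts : ∀ {b} (p : bs ∋ b) → Lin (Γs p) b)
               .(d : allVars (concatF bs Γs) ⊢ compTm (term s) Γs (λ p → term (ts p))) →
               subst (λ Δ → Hom Δ (obj c)) (map-concatF obj bs Γs)
                     (F₁ (lin (compTm (term s) Γs (λ p → term (ts p))) d))
               ≈ comp (F₁ s) (mapFam obj (λ p → map obj (Γs p)))
                             (mapFamHom obj Hom (λ p → map obj (Γs p)) (λ p → F₁ (ts p)))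
      F-act  : ∀ {Γ Δ a} (s : Lin Γ a) (ρ : Reindex Γ Δ) .(d : allVars Δ ⊢ actTm (term s) ρ) →
               F₁ (lin (actTm (term s) ρ) d) ≈ act (F₁ s) (mapR obj ρ)
      F-ev   : ∀ (as : List Type) (a : Type) →
               subst (λ X → Hom (X ∷ map obj as) (obj a)) (obj-⊸ as a) (F₁ (evLin as a)) ≈ ev
  open SCFunctor public

  ExtendsArr : SCFunctor → Set (ℓ ⊔ e)
  ExtendsArr F = ∀ {as b} (f : Arr as b) → F₁ F (funLin f) ≈ arr f

  -- equality of two such functors (they agree on objects by construction)
  SameFunctor : SCFunctor → SCFunctor → Set (ℓ ⊔ e)
  SameFunctor F G = ∀ {Γ a} (s : Lin Γ a) → F₁ F s ≈ F₁ G s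

{-# OPTIONS --safe #-}

-- Pulling S back along the object map of i gives a closed multicategory M whose objects are the types, so only a
-- functor that is the identity on objects has to be found. Terms are interpreted by a relation Den θ s h ("h : Hom Θ a
-- denotes the linear term s, whose variables are picked out by θ : Θ → Γ"), which is functional up to a reindexing of Θ,
-- stable under substitution, and preserved by β and η: uncurrying is composition with ev, so β is associativity of
-- composition, and η is the defining clause of an abstraction. Since any two denotations of a term agree, every
-- preservation law of the functor follows by exhibiting a denotation of the term on one side. Conversely each linear
-- term arises from variables by abstraction and by substituting linear terms into ev or f(x₁,…,xₙ) and permuting, all of
-- which a closed functor preserves, so it is determined by its values on the f(x₁,…,xₙ).

module Submission where

open import Defs
open import Level using (Level; _⊔_) renaming (suc to lsuc)
open import Data.Bool using (true)
open import Data.List using (List; []; _∷_; _++_; map)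
open import Data.List.Properties using (++-assoc; ++-identityʳ; map-++; map-∘; map-cong)
open import Data.List.Relation.Unary.All using (All; []; _∷_)
open import Data.Product using (Σ; _,_; proj₁; proj₂; _×_)
open import Data.Sum using (_⊎_; inj₁; inj₂; [_,_]′)
open import Relation.Binary.Construct.Closure.Equivalence using (gfold)
open import Relation.Binary.Construct.Closure.ReflexiveTransitive using (ε; _◅_)
open import Relation.Binary.Construct.Closure.Symmetric using () renaming (fwd to forward)
open import Relation.Binary.PropositionalEquality
open import Relation.Binary.Structures using (IsEquivalence)
open import Relation.Nullary using (Dec; yes; no)
open import Relation.Nullary.Decidable using (map′; _×-dec_; recompute)

-- Reindexings

-- The typing rules split contexts by shuffles, and substitution and β rearrange these shuffles. An
-- interpretation by recursion on derivations would need a coherence argument for every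
-- rearrangement. A relation can carry an arbitrary permutation at each variable and node. This
-- freedom disappears only at the end: when both embeddings into `Γ` are the identity, the
-- permutation that compares two denotations is forced to be trivial. The price is bookkeeping.
-- Contexts such as `concatF (concatF bs Γs) Δs` and its regrouping are equal only propositionally,
-- and transports along such equations do not compute. Each of them is therefore replaced by a
-- reindexing, and two reindexings are compared by following a position `inj p q` through both.
-- Currying enters only through its inverse. An abstraction is characterised by its uncurrying, and
-- uncurrying is injective; this also explains why a functor that preserves `ev` must preserve
-- abstraction.

module _ {a : Level} {A : Set a} where

  infix 4 _≐_
  -- Compared on `from`, the direction in which an input of the source is followed into the target;
  -- all coherence conditions below run in this direction.
  _≐_ : ∀ {Γ Δ : List A} → Reindex Γ Δ → Reindex Γ Δ → Set a
  _≐_ {Γ} ρ ρ' = ∀ {x} (p : Γ ∋ x) → from ρ p ≡ from ρ' p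

  ≐⇒to : ∀ {Γ Δ : List A} {ρ ρ' : Reindex Γ Δ} → ρ ≐ ρ' → ∀ {x} (q : Δ ∋ x) → to ρ q ≡ to ρ' q
  ≐⇒to {ρ = ρ} {ρ'} e q = trans (sym (to-from ρ' (to ρ q)))
    (cong (to ρ') (trans (sym (e (to ρ q))) (from-to ρ q)))

  symR : ∀ {Γ Δ : List A} → Reindex Γ Δ → Reindex Δ Γ
  symR ρ = record { to = from ρ ; from = to ρ ; to-from = from-to ρ ; from-to = to-from ρ }

  castR : ∀ {Γ Δ : List A} → Γ ≡ Δ → Reindex Γ Δ
  castR refl = idR

  -- The images `q` and `r` are arbitrary, so the effect of a compound equation can be computed one
  -- factor at a time while the equations themselves stay opaque.
  castR-trans : ∀ {Γ Δ Θ : List A} (e : Γ ≡ Δ) (e' : Δ ≡ Θ) {x} {p : Γ ∋ x} {q : Δ ∋ x} {r : Θ ∋ x} →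
                from (castR e) p ≡ q → from (castR e') q ≡ r → from (castR (trans e e')) p ≡ r
  castR-trans refl refl refl refl = refl

  castR-++ˡ : ∀ (Ξ : List A) {Γ Δ : List A} (e : Γ ≡ Δ) {x} (p : Ξ ∋ x) →
              from (castR (cong (Ξ ++_) e)) (wkˡ p) ≡ wkˡ p
  castR-++ˡ Ξ refl p = refl

  castR-++ʳ : ∀ (Ξ : List A) {Γ Δ : List A} (e : Γ ≡ Δ) {x} (p : Γ ∋ x) →
              from (castR (cong (Ξ ++_) e)) (wkʳ Ξ p) ≡ wkʳ Ξ (from (castR e) p)
  castR-++ʳ Ξ refl p = refl

  castR-assoc-ll : ∀ (Γ Δ Θ : List A) {x} (p : Γ ∋ x) →
                   from (castR (++-assoc Γ Δ Θ)) (wkˡ (wkˡ p)) ≡ wkˡ p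
  castR-assoc-ll (c ∷ Γ) Δ Θ here = castR-++ˡ (c ∷ []) (++-assoc Γ Δ Θ) here
  castR-assoc-ll (c ∷ Γ) Δ Θ (there p) =
    trans (castR-++ʳ (c ∷ []) (++-assoc Γ Δ Θ) (wkˡ (wkˡ p))) (cong there (castR-assoc-ll Γ Δ Θ p))

  castR-assoc-lr : ∀ (Γ Δ Θ : List A) {x} (p : Δ ∋ x) →
                   from (castR (++-assoc Γ Δ Θ)) (wkˡ (wkʳ Γ p)) ≡ wkʳ Γ (wkˡ p)
  castR-assoc-lr [] Δ Θ p = refl
  castR-assoc-lr (c ∷ Γ) Δ Θ p =
    trans (castR-++ʳ (c ∷ []) (++-assoc Γ Δ Θ) (wkˡ (wkʳ Γ p))) (cong there (castR-assoc-lr Γ Δ Θ p))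

  castR-assoc-r : ∀ (Γ Δ Θ : List A) {x} (p : Θ ∋ x) →
                  from (castR (++-assoc Γ Δ Θ)) (wkʳ (Γ ++ Δ) p) ≡ wkʳ Γ (wkʳ Δ p)
  castR-assoc-r [] Δ Θ p = refl
  castR-assoc-r (c ∷ Γ) Δ Θ p =
    trans (castR-++ʳ (c ∷ []) (++-assoc Γ Δ Θ) (wkʳ (Γ ++ Δ) p)) (cong there (castR-assoc-r Γ Δ Θ p))

  castR-flip : ∀ {Γ Δ : List A} (e : Γ ≡ Δ) {x} {p : Γ ∋ x} {q : Δ ∋ x} →
               from (castR e) p ≡ q → from (castR (sym e)) q ≡ p
  castR-flip refl e = sym e

  split-elim : ∀ (Γ : List A) {Δ : List A} {c x} (C : (Γ ++ Δ) ∋ x → Set c) →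
               (∀ p → C (wkˡ p)) → (∀ p → C (wkʳ Γ p)) → ∀ p → C p
  split-elim Γ C l r p = subst C (unsplit-split Γ p) (go (split Γ p))
    where
    go : ∀ s → C (unsplit Γ s)
    go (inj₁ q) = l q
    go (inj₂ q) = r q

  split-unsplit : ∀ (Γ : List A) {Δ x} (s : Γ ∋ x ⊎ Δ ∋ x) → split Γ {Δ} (unsplit Γ s) ≡ s
  split-unsplit Γ (inj₁ q) = split-wkˡ q
  split-unsplit Γ (inj₂ q) = split-wkʳ Γ q

  liftP : ∀ {Γ Δ : List A} Θ → (∀ {x} → Γ ∋ x → Δ ∋ x) → ∀ {x} → (Γ ++ Θ) ∋ x → (Δ ++ Θ) ∋ x
  liftP {Γ} {Δ} Θ f p = [ (λ q → wkˡ (f q)) , wkʳ Δ ]′ (split Γ p)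

  liftP-wkˡ : ∀ {Γ Δ : List A} Θ (f : ∀ {x} → Γ ∋ x → Δ ∋ x) {x} (p : Γ ∋ x) →
              liftP Θ f (wkˡ p) ≡ wkˡ (f p)
  liftP-wkˡ {Γ} {Δ} Θ f p = cong [ (λ q → wkˡ (f q)) , wkʳ Δ ]′ (split-wkˡ {xs = Γ} {Θ} p)

  liftP-wkʳ : ∀ {Γ Δ : List A} Θ (f : ∀ {x} → Γ ∋ x → Δ ∋ x) {x} (p : Θ ∋ x) →
              liftP Θ f (wkʳ Γ p) ≡ wkʳ Δ p
  liftP-wkʳ {Γ} {Δ} Θ f p = cong [ (λ q → wkˡ (f q)) , wkʳ Δ ]′ (split-wkʳ Γ {Θ} p)

  liftP-inverse : ∀ {Γ Δ : List A} Θ (f : ∀ {x} → Γ ∋ x → Δ ∋ x) (g : ∀ {x} → Δ ∋ x → Γ ∋ x) →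
                  (∀ {x} (p : Γ ∋ x) → g (f p) ≡ p) →
                  ∀ {x} (p : (Γ ++ Θ) ∋ x) → liftP Θ g (liftP Θ f p) ≡ p
  liftP-inverse {Γ} {Δ} Θ f g gf = split-elim Γ _
    (λ p → trans (cong (liftP Θ g) (liftP-wkˡ Θ f p)) (trans (liftP-wkˡ Θ g (f p)) (cong wkˡ (gf p))))
    (λ p → trans (cong (liftP Θ g) (liftP-wkʳ Θ f p)) (liftP-wkʳ Θ g p))

  liftReindex : ∀ {Γ Δ : List A} Θ → Reindex Γ Δ → Reindex (Γ ++ Θ) (Δ ++ Θ)
  liftReindex Θ ρ = record
    { to = liftP Θ (to ρ) ; from = liftP Θ (from ρ)
    ; to-from = liftP-inverse Θ (from ρ) (to ρ) (to-from ρ)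
    ; from-to = liftP-inverse Θ (to ρ) (from ρ) (from-to ρ) }

-- Reindexings of concatenated families

module _ {b x : Level} {B : Set b} {X : Set x} where

  block-elim : ∀ {bs : List B} {Γs : Fam {X = X} bs} {c y} (C : concatF bs Γs ∋ y → Set c) →
               (∀ {d} (p : bs ∋ d) (q : Γs p ∋ y) → C (inj {Γs = Γs} p q)) → ∀ r → C r
  block-elim {bs} {Γs} C f r = subst C (inj-prj {bs = bs} {Γs} r) (go (prj r))
    where
    go : ∀ β → C (unblock β)
    go (block p q) = f p q

  ⊕R-inj : ∀ {bs : List B} {Γs Δs : Fam {X = X} bs} (ρs : ∀ {c} (p : bs ∋ c) → Reindex (Γs p) (Δs p))
           {c y} (p : bs ∋ c) (q : Γs p ∋ y) →
           from (⊕R {bs = bs} {Γs} {Δs} ρs) (inj {Γs = Γs} p q) ≡ inj {Γs = Δs} p (from (ρs p) q)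
  ⊕R-inj {bs} {Γs} {Δs} ρs p q rewrite prj-inj {bs = bs} {Γs} p q = refl

  -- A reindexing out of a concatenation whose blocks are named by the elements of P rather than by
  -- the positions of bs.
  module _ {p : Level} {P : B → Set p} {bs : List B} {Ω : List X}
           (name : ∀ {c} → bs ∋ c → P c) (at : ∀ {c} → P c → bs ∋ c)
           (name-at : ∀ {c} (i : P c) → name (at i) ≡ i) (at-name : ∀ {c} (q : bs ∋ c) → at (name q) ≡ q)
           (Γs : ∀ {c} → P c → List X)
           (ι : ∀ {c} (i : P c) {y} → Γs i ∋ y → Ω ∋ y)
           (locate : ∀ {y} → Ω ∋ y → Σ B (λ c → Σ (P c) (λ i → Γs i ∋ y)))
           (ι-locate : ∀ {y} (r : Ω ∋ y) → ι (proj₁ (proj₂ (locate r))) (proj₂ (proj₂ (locate r))) ≡ r)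
           (locate-ι : ∀ {c} (i : P c) {y} (q : Γs i ∋ y) → locate (ι i q) ≡ (c , i , q)) where

    private
      fam : Fam bs
      fam q = Γs (name q)

      toBlock : ∀ {y} → Σ B (λ c → Σ (P c) (λ i → Γs i ∋ y)) → Block bs fam y
      toBlock {y} (c , i , q) = block (at i) (subst (λ j → Γs j ∋ y) (sym (name-at i)) q)

      fwd : ∀ {y} → Block bs fam y → Ω ∋ y
      fwd (block i q) = ι (name i) q

      fwd-toBlock : ∀ {y} (t : Σ B (λ c → Σ (P c) (λ i → Γs i ∋ y))) →
                    fwd (toBlock t) ≡ ι (proj₁ (proj₂ t)) (proj₂ (proj₂ t))
      fwd-toBlock {y} (c , i , q) = go (name-at i)
        where
        go : ∀ {j} (e : j ≡ i) → ι j (subst (λ j → Γs j ∋ y) (sym e) q) ≡ ι i q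
        go refl = refl

      toBlock-name : ∀ {c y} (q : bs ∋ c) (r : fam q ∋ y) → toBlock (c , name q , r) ≡ block q r
      toBlock-name {y = y} q r = go (at-name q) (name-at (name q))
        where
        go : ∀ {q'} → q' ≡ q → (e : name q' ≡ name q) →
             _≡_ {A = Block bs fam y} (block q' (subst (λ j → Γs j ∋ y) (sym e) r)) (block q r)
        -- Once the positions are identified, the second equation is a loop at `name q`; matching it
        -- is uniqueness of identity proofs, so it is immaterial which proof `name-at` supplies.
        go refl refl = refl

      unblock-toBlock : ∀ {y} (β : Block bs fam y) → toBlock (locate (fwd β)) ≡ β
      unblock-toBlock (block q r) = trans (cong toBlock (locate-ι (name q) r)) (toBlock-name q r)

    namedR : Reindex (concatF bs fam) Ω
    namedR = record
      { to      = λ r → unblock (toBlock (locate r))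
      ; from    = λ r → fwd (prj r)
      ; to-from = λ r → trans (cong unblock (unblock-toBlock (prj r))) (inj-prj {bs = bs} {fam} r)
      ; from-to = λ r → trans (cong fwd (prj-unblock (toBlock (locate r))))
                              (trans (fwd-toBlock (locate r)) (ι-locate r))
      }
      where
      prj-unblock : ∀ {y} (β : Block bs fam y) → prj (unblock β) ≡ β
      prj-unblock (block q r) = prj-inj {bs = bs} {fam} q r

    namedR-inj : ∀ {c y} (q : bs ∋ c) (r : fam q ∋ y) → from namedR (inj {Γs = fam} q r) ≡ ι (name q) r
    namedR-inj q r = cong fwd (prj-inj {bs = bs} {fam} q r)

module _ {a x : Level} {A : Set a} {X : Set x} where

  -- The block permutation σ⟨n_1,...,n_n⟩ of the equivariance axiom. It is the inverse of a `namedR`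
  -- in which the blocks over `bs'` are named by positions of `bs`.
  blockR : ∀ {bs bs' : List A} (ρ : Reindex bs bs') (Γs : Fam {X = X} bs) →
           Reindex (concatF bs Γs) (concatF bs' (λ q → Γs (to ρ q)))
  blockR {bs} {bs'} ρ Γs = symR (namedR {bs = bs'} (to ρ) (from ρ) (to-from ρ) (from-to ρ) Γs (λ i q → inj {Γs = Γs} i q)
      (λ r → loc (prj r)) (λ r → trans (loc-inj (prj r)) (inj-prj {bs = bs} {Γs} r))
      (λ i q → cong loc (prj-inj {bs = bs} {Γs} i q)))
    where
    loc : ∀ {y} → Block bs Γs y → Σ A (λ c → Σ (bs ∋ c) (λ i → Γs i ∋ y))
    loc (block p q) = _ , p , q
    loc-inj : ∀ {y} (β : Block bs Γs y) → inj {Γs = Γs} (proj₁ (proj₂ (loc β))) (proj₂ (proj₂ (loc β))) ≡ unblock β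
    loc-inj (block p q) = refl

  blockR-inj : ∀ {bs bs' : List A} (ρ : Reindex bs bs') (Γs : Fam {X = X} bs) {c y}
               (q : bs' ∋ c) (r : Γs (to ρ q) ∋ y) →
               to (blockR ρ Γs) (inj {Γs = λ q → Γs (to ρ q)} q r) ≡ inj {Γs = Γs} (to ρ q) r
  blockR-inj {bs} {bs'} ρ Γs q r = cong (fwd) (prj-inj {bs = bs'} {λ q → Γs (to ρ q)} q r)
    where
    fwd : ∀ {y} → Block bs' (λ q → Γs (to ρ q)) y → concatF bs Γs ∋ y
    fwd (block i q) = inj {Γs = Γs} (to ρ i) q

module _ {a : Level} {A : Set a} where

  single-inj : ∀ (bs : List A) {c} (p : bs ∋ c) →
               from (castR (concatF-single bs)) (inj {Γs = λ {c} _ → c ∷ []} p here) ≡ p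
  single-inj (c ∷ bs) here = castR-++ˡ (c ∷ []) (concatF-single bs) here
  single-inj (c ∷ bs) (there p) =
    trans (castR-++ʳ (c ∷ []) (concatF-single bs) (inj {Γs = λ {c} _ → c ∷ []} p here))
          (cong there (single-inj bs p))

  ++-injˡ : ∀ (bs cs : List A) (Γs : Fam {X = A} (bs ++ cs)) {c y} (p : bs ∋ c) (q : Γs (wkˡ p) ∋ y) →
            from (castR (concatF-++ bs cs Γs)) (inj {Γs = Γs} (wkˡ p) q)
            ≡ wkˡ (inj {Γs = λ p → Γs (wkˡ p)} p q)
  ++-injˡ (c ∷ bs) cs Γs here q =
    castR-trans (cong (Γs here ++_) (concatF-++ bs cs (λ p → Γs (there p)))) (sym (++-assoc (Γs here) _ _))
      (castR-++ˡ (Γs here) (concatF-++ bs cs (λ p → Γs (there p))) q)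
      (castR-flip (++-assoc (Γs here) _ _) (castR-assoc-ll (Γs here) _ _ q))
  ++-injˡ (c ∷ bs) cs Γs (there p) q =
    castR-trans (cong (Γs here ++_) (concatF-++ bs cs (λ p → Γs (there p)))) (sym (++-assoc (Γs here) _ _))
      (trans (castR-++ʳ (Γs here) (concatF-++ bs cs (λ p → Γs (there p))) _)
             (cong (wkʳ (Γs here)) (++-injˡ bs cs (λ p → Γs (there p)) p q)))
      (castR-flip (++-assoc (Γs here) _ _) (castR-assoc-lr (Γs here) _ _ _))

  ++-injʳ : ∀ (bs cs : List A) (Γs : Fam {X = A} (bs ++ cs)) {c y} (p : cs ∋ c) (q : Γs (wkʳ bs p) ∋ y) →
            from (castR (concatF-++ bs cs Γs)) (inj {Γs = Γs} (wkʳ bs p) q)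
            ≡ wkʳ (concatF bs (λ p → Γs (wkˡ p))) (inj {Γs = λ p → Γs (wkʳ bs p)} p q)
  ++-injʳ [] cs Γs p q = refl
  ++-injʳ (c ∷ bs) cs Γs p q =
    castR-trans (cong (Γs here ++_) (concatF-++ bs cs (λ p → Γs (there p)))) (sym (++-assoc (Γs here) _ _))
      (trans (castR-++ʳ (Γs here) (concatF-++ bs cs (λ p → Γs (there p))) _)
             (cong (wkʳ (Γs here)) (++-injʳ bs cs (λ p → Γs (there p)) p q)))
      (castR-flip (++-assoc (Γs here) _ _) (castR-assoc-r (Γs here) _ _ _))

  assoc-inj : ∀ (bs : List A) (Γs : Fam {X = A} bs) (Δs : Fam {X = A} (concatF bs Γs)) {b c y}
              (p : bs ∋ b) (q : Γs p ∋ c) (r : Δs (inj {Γs = Γs} p q) ∋ y) →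
              from (castR (concatF-assoc bs Γs Δs)) (inj {Γs = Δs} (inj {Γs = Γs} p q) r)
              ≡ inj {Γs = λ p → concatF (Γs p) (λ q → Δs (inj {Γs = Γs} p q))} p
                  (inj {Γs = λ q → Δs (inj {Γs = Γs} p q)} q r)
  assoc-inj (c ∷ bs) Γs Δs here q r =
    castR-trans (concatF-++ (Γs here) _ Δs) (cong (concatF (Γs here) (λ q → Δs (wkˡ q)) ++_) (concatF-assoc bs _ _))
      (++-injˡ (Γs here) _ Δs q r)
      (castR-++ˡ _ (concatF-assoc bs (λ p → Γs (there p)) (λ q → Δs (wkʳ (Γs here) q))) _)
  assoc-inj (c ∷ bs) Γs Δs (there p) q r =
    castR-trans (concatF-++ (Γs here) _ Δs) (cong (concatF (Γs here) (λ q → Δs (wkˡ q)) ++_) (concatF-assoc bs _ _))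
      (++-injʳ (Γs here) _ Δs (inj {Γs = λ p → Γs (there p)} p q) r)
      (trans (castR-++ʳ _ (concatF-assoc bs (λ p → Γs (there p)) (λ q → Δs (wkʳ (Γs here) q))) _)
             (cong (wkʳ _) (assoc-inj bs (λ p → Γs (there p)) (λ q → Δs (wkʳ (Γs here) q)) p q r)))

  -- Associativity with a permutation `R₀` inserted between the two compositions: the regrouping is
  -- followed by the block permutation that `R₀` induces on the outer arguments.
  assocR : ∀ {bs Θ Ω : List A} {Γs : Fam {X = A} bs} {Δs : Fam {X = A} Θ} (R₀ : Reindex (concatF bs Γs) Θ) →
           Reindex (concatF Θ Δs) Ω →
           Reindex (concatF bs (λ p → concatF (Γs p) (λ q → Δs (from R₀ (inj {Γs = Γs} p q))))) Ω
  assocR {bs} {Γs = Γs} {Δs} R₀ R =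
    castR (sym (concatF-assoc bs Γs (λ r → Δs (from R₀ r)))) ⨾R (symR (blockR (symR R₀) Δs) ⨾R R)

  assocR-inj : ∀ {bs Θ Ω : List A} {Γs : Fam {X = A} bs} {Δs : Fam {X = A} Θ} (R₀ : Reindex (concatF bs Γs) Θ)
               (R : Reindex (concatF Θ Δs) Ω) {b c y} (p : bs ∋ b) (q : Γs p ∋ c)
               (r : Δs (from R₀ (inj {Γs = Γs} p q)) ∋ y) →
               from (assocR {Γs = Γs} {Δs} R₀ R)
                 (inj {Γs = λ p → concatF (Γs p) (λ q → Δs (from R₀ (inj {Γs = Γs} p q)))} p
                   (inj {Γs = λ q → Δs (from R₀ (inj {Γs = Γs} p q))} q r))
               ≡ from R (inj {Γs = Δs} (from R₀ (inj {Γs = Γs} p q)) r)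
  assocR-inj {bs} {Γs = Γs} {Δs} R₀ R p q r = cong (from R)
    (trans (cong (to (blockR (symR R₀) Δs))
              (castR-flip (concatF-assoc bs Γs (λ r → Δs (from R₀ r)))
                 (assoc-inj bs Γs (λ r → Δs (from R₀ r)) p q r)))
           (blockR-inj (symR R₀) Δs (inj {Γs = Γs} p q) r))

++-identityʳ-wkˡ : ∀ {a : Level} {A : Set a} (Γ : List A) {x} (p : Γ ∋ x) → from (castR (++-identityʳ Γ)) (wkˡ p) ≡ p
++-identityʳ-wkˡ (c ∷ Γ) here = castR-++ˡ (c ∷ []) (++-identityʳ Γ) here
++-identityʳ-wkˡ (c ∷ Γ) (there p) =
  trans (castR-++ʳ (c ∷ []) (++-identityʳ Γ) (wkˡ p)) (cong there (++-identityʳ-wkˡ Γ p))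

module _ {a x : Level} {A : Set a} {X : Set x} where

  headR : ∀ {c : A} {Θ : List A} (R₀ : Reindex (c ∷ []) Θ) (Δs : Fam {X = X} Θ) →
          Reindex (Δs (from R₀ here)) (concatF Θ Δs)
  headR R₀ Δs = castR (sym (++-identityʳ _)) ⨾R symR (blockR (symR R₀) Δs)

  headR-from : ∀ {c : A} {Θ : List A} (R₀ : Reindex (c ∷ []) Θ) (Δs : Fam {X = X} Θ) {y} (r : Δs (from R₀ here) ∋ y) →
               from (headR R₀ Δs) r ≡ inj {Γs = Δs} (from R₀ here) r
  headR-from R₀ Δs r = trans (cong (to (blockR (symR R₀) Δs)) (castR-flip (++-identityʳ _) (++-identityʳ-wkˡ _ r)))
                             (blockR-inj (symR R₀) Δs here r)

-- Symmetric multicategories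

-- Symmetric multicategories with every law stated up to explicit reindexings that are constrained only by their
-- effect on positions, so that no transport along an equation of lists ever occurs.
record ReindexedMulticat {x : Level} (X : Set x) (m e : Level) : Set (lsuc (x ⊔ m ⊔ e)) where
  infix 4 _≈_
  field
    Hom  : List X → X → Set m
    _≈_  : ∀ {Γ a} → Hom Γ a → Hom Γ a → Set e
    id   : ∀ {a} → Hom (a ∷ []) a
    comp : ∀ {bs c} → Hom bs c → (Γs : Fam bs) → (∀ {b} (p : bs ∋ b) → Hom (Γs p) b) → Hom (concatF bs Γs) c
    act  : ∀ {Γ Δ a} → Hom Γ a → Reindex Γ Δ → Hom Δ a
    ≈-equiv  : ∀ {Γ a} → IsEquivalence (_≈_ {Γ} {a})
    act-cong : ∀ {Γ Δ a} {f g : Hom Γ a} (ρ : Reindex Γ Δ) → f ≈ g → act f ρ ≈ act g ρ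
    act-≐    : ∀ {Γ Δ a} (f : Hom Γ a) {ρ ρ' : Reindex Γ Δ} → ρ ≐ ρ' → act f ρ ≈ act f ρ'
    act-id   : ∀ {Γ a} (f : Hom Γ a) → act f idR ≈ f
    act-⨾    : ∀ {Γ Δ Θ a} (f : Hom Γ a) (ρ : Reindex Γ Δ) (ρ' : Reindex Δ Θ) → act (act f ρ) ρ' ≈ act f (ρ ⨾R ρ')
    comp-act : ∀ {bs c} {f f' : Hom bs c} {Γs Δs : Fam bs}
               {gs : ∀ {b} (p : bs ∋ b) → Hom (Γs p) b} {gs' : ∀ {b} (p : bs ∋ b) → Hom (Δs p) b}
               (κ : ∀ {b} (p : bs ∋ b) → Reindex (Γs p) (Δs p)) →
               f' ≈ f → (∀ {b} (p : bs ∋ b) → gs' p ≈ act (gs p) (κ p)) →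
               comp f' Δs gs' ≈ act (comp f Γs gs) (⊕R κ)
    -- The identity is permuted because a variable denotes `act id R₀`, where `Θ` is known to be a
    -- singleton only through `R₀`.
    unitˡ    : ∀ {Θ Ω a} (R₀ : Reindex (a ∷ []) Θ) {Δs : Fam Θ} (hs : ∀ {b} (p : Θ ∋ b) → Hom (Δs p) b)
               (R : Reindex (concatF Θ Δs) Ω) (κ : Reindex (Δs (from R₀ here)) Ω) →
               (∀ {x} (r : Δs (from R₀ here) ∋ x) → from κ r ≡ from R (inj {Γs = Δs} (from R₀ here) r)) →
               act (comp (act id R₀) Δs hs) R ≈ act (hs (from R₀ here)) κ
    unitʳ    : ∀ {bs c Ω} (f : Hom bs c) {Γs : Fam bs} {gs : ∀ {b} (p : bs ∋ b) → Hom (Γs p) b}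
               (κ : ∀ {b} (p : bs ∋ b) → Reindex (b ∷ []) (Γs p)) → (∀ {b} (p : bs ∋ b) → gs p ≈ act id (κ p)) →
               (R : Reindex (concatF bs Γs) Ω) (R' : Reindex bs Ω) →
               (∀ {b} (p : bs ∋ b) → from R' p ≡ from R (inj {Γs = Γs} p (from (κ p) here))) →
               act (comp f Γs gs) R ≈ act f R'
    -- Permutations are allowed at every stage: `R₀` after the first composition, `κ` on the inner
    -- arguments, `Rs` on the regrouped composites, `R` and `R'` at the ends. The one coherence
    -- condition follows an innermost position along both routes.
    assoc    : ∀ {bs c Θ Ω} (f : Hom bs c) {Γs : Fam bs} (gs : ∀ {b} (p : bs ∋ b) → Hom (Γs p) b)
               (R₀ : Reindex (concatF bs Γs) Θ) {Δs : Fam Θ} (hs : ∀ {b} (p : Θ ∋ b) → Hom (Δs p) b)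
               (R : Reindex (concatF Θ Δs) Ω)
               {Δs' : ∀ {b} (p : bs ∋ b) → Fam (Γs p)} (hs' : ∀ {b} (p : bs ∋ b) {x} (q : Γs p ∋ x) → Hom (Δs' p q) x)
               (κ : ∀ {b} (p : bs ∋ b) {x} (q : Γs p ∋ x) → Reindex (Δs (from R₀ (inj {Γs = Γs} p q))) (Δs' p q)) →
               (∀ {b} (p : bs ∋ b) {x} (q : Γs p ∋ x) → hs' p q ≈ act (hs (from R₀ (inj {Γs = Γs} p q))) (κ p q)) →
               {Λs : Fam bs} (ks : ∀ {b} (p : bs ∋ b) → Hom (Λs p) b)
               (Rs : ∀ {b} (p : bs ∋ b) → Reindex (concatF (Γs p) (Δs' p)) (Λs p)) →
               (∀ {b} (p : bs ∋ b) → ks p ≈ act (comp (gs p) (Δs' p) (hs' p)) (Rs p)) →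
               (R' : Reindex (concatF bs Λs) Ω) →
               (∀ {b} (p : bs ∋ b) {x} (q : Γs p ∋ x) {y} (r : Δs (from R₀ (inj {Γs = Γs} p q)) ∋ y) →
                 from R' (inj {Γs = Λs} p (from (Rs p) (inj {Γs = Δs' p} q (from (κ p q) r))))
                 ≡ from R (inj {Γs = Δs} (from R₀ (inj {Γs = Γs} p q)) r)) →
               act (comp (act (comp f Γs gs) R₀) Δs hs) R ≈ act (comp f Λs ks) R'

  module _ {Γ : List X} {a : X} where
    open IsEquivalence (≈-equiv {Γ} {a}) public
      using () renaming (refl to ≈-refl; sym to ≈-sym; trans to ≈-trans)

  comp-cong : ∀ {bs c} {f f' : Hom bs c} {Γs : Fam bs} {gs gs' : ∀ {b} (p : bs ∋ b) → Hom (Γs p) b} →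
              f ≈ f' → (∀ {b} (p : bs ∋ b) → gs p ≈ gs' p) → comp f Γs gs ≈ comp f' Γs gs'
  comp-cong {bs} {Γs = Γs} {gs} {gs'} e es = 
    ≈-trans (comp-act {Γs = Γs} {gs = gs'} (λ _ → idR) e (λ p → ≈-trans (es p) (≈-sym (act-id (gs' p)))))
    (≈-trans (act-≐ _ (block-elim {bs = bs} {Γs} _ (λ p q → ⊕R-inj {bs = bs} {Γs} {Γs} (λ _ → idR) p q))) (act-id _))

  subst-act : ∀ {Γ Δ a} (e : Γ ≡ Δ) (f : Hom Γ a) → subst (λ Θ → Hom Θ a) e f ≈ act f (castR e)
  subst-act refl f = ≈-sym (act-id f)

  subst-flip : ∀ {Γ Δ a} (e : Γ ≡ Δ) {f : Hom Γ a} {g : Hom Δ a} →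
               subst (λ Θ → Hom Θ a) e f ≈ g → f ≈ act g (castR (sym e))
  subst-flip refl e = ≈-trans e (≈-sym (act-id _))

  subst-unflip : ∀ {Γ Δ a} (e : Γ ≡ Δ) {f : Hom Γ a} {g : Hom Δ a} →
                 f ≈ act g (castR (sym e)) → subst (λ Θ → Hom Θ a) e f ≈ g
  subst-unflip refl e = ≈-trans e (act-id _)

-- The reindexed laws, derived from the axioms of a symmetric multicategory

module Reindexed {o m e : Level} (S : SymClosedMulticat o m e) where
  open SymClosedMulticat S renaming (comp-cong to comp-cong₀)

  private
    module _ {Γ : List Obj} {a : Obj} where
      open IsEquivalence (≈-equiv {Γ} {a}) public
        using () renaming (refl to ≈-refl; sym to ≈-sym; trans to ≈-trans)

    act-≐ : ∀ {Γ Δ a} (f : Hom Γ a) {ρ ρ' : Reindex Γ Δ} → ρ ≐ ρ' → act f ρ ≈ act f ρ'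
    act-≐ f {ρ} {ρ'} e = act-resp f ρ ρ' (≐⇒to {ρ = ρ} {ρ'} e)

    act-sym : ∀ {Γ Δ a} (f : Hom Γ a) (ρ : Reindex Γ Δ) → act (act f ρ) (symR ρ) ≈ f
    act-sym f ρ = ≈-trans (act-⨾ f ρ (symR ρ)) (≈-trans (act-≐ f (to-from ρ)) (act-id f))

    act-flip : ∀ {Γ Δ a} {f : Hom Γ a} {g : Hom Δ a} (ρ : Reindex Γ Δ) → act f ρ ≈ g → f ≈ act g (symR ρ)
    act-flip ρ e = ≈-trans (≈-sym (act-sym _ ρ)) (act-cong (symR ρ) e)

    subst-flip : ∀ {Γ Δ a} (e : Γ ≡ Δ) {f : Hom Γ a} {g : Hom Δ a} →
                 subst (λ Θ → Hom Θ a) e f ≈ g → f ≈ act g (castR (sym e))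
    subst-flip refl e = ≈-trans e (≈-sym (act-id _))

    comp-act : ∀ {bs c} {f f' : Hom bs c} {Γs Δs : Fam bs}
               {gs : ∀ {b} (p : bs ∋ b) → Hom (Γs p) b} {gs' : ∀ {b} (p : bs ∋ b) → Hom (Δs p) b}
               (κ : ∀ {b} (p : bs ∋ b) → Reindex (Γs p) (Δs p)) →
               f' ≈ f → (∀ {b} (p : bs ∋ b) → gs' p ≈ act (gs p) (κ p)) →
               comp f' Δs gs' ≈ act (comp f Γs gs) (⊕R κ)
    comp-act {f = f} {Γs = Γs} {Δs} {gs} κ e es = ≈-trans (comp-cong₀ e es) (comp-act-in f Γs Δs gs κ)

    -- The axiom `comp-act-out` covers only families of the form `Γs (to ρ q)`. Applied to `act f ρ`
    -- and the inverse permutation it leaves `Δs` arbitrary; the block permutation is then moved to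
    -- the other side.
    comp-act-head : ∀ {bs bs' c} (f : Hom bs c) (ρ : Reindex bs bs') (Δs : Fam bs')
                    (hs : ∀ {b} (p : bs' ∋ b) → Hom (Δs p) b) →
                    comp (act f ρ) Δs hs
                    ≈ act (comp f (λ q → Δs (from ρ q)) (λ q → hs (from ρ q))) (symR (blockR (symR ρ) Δs))
    comp-act-head f ρ Δs hs = act-flip (blockR (symR ρ) Δs)
      (≈-trans (≈-sym (comp-act-out (act f ρ) (symR ρ) Δs hs (blockR (symR ρ) Δs) (blockR-inj (symR ρ) Δs)))
               (comp-cong₀ (act-sym f ρ) (λ _ → ≈-refl)))

    -- A family on a one-element list agrees with `singleCtx (Γs here)` only pointwise, so the unit
    -- axiom is reached through equivariance along pointwise identity reindexings.
    comp-idˡ' : ∀ {a} {Γs : Fam (a ∷ [])} (gs : ∀ {b} (p : (a ∷ []) ∋ b) → Hom (Γs p) b) →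
                comp id Γs gs ≈ act (gs here) (castR (sym (++-identityʳ (Γs here))))
    comp-idˡ' {a} {Γs} gs = ≈-trans (comp-act {f = id} {Γs = singleCtx (Γs here)} {gs = singleHom (gs here)} κ ≈-refl κ-eq)
      (≈-trans (act-≐ _ (block-elim {bs = a ∷ []} {singleCtx (Γs here)} _ ⊕κ))
        (≈-trans (act-id _) (subst-flip (++-identityʳ (Γs here)) (comp-idˡ (gs here)))))
      where
      κ : ∀ {b} (p : (a ∷ []) ∋ b) → Reindex (singleCtx (Γs here) p) (Γs p)
      κ here = idR
      κ (there ())
      κ-eq : ∀ {b} (p : (a ∷ []) ∋ b) → gs p ≈ act (singleHom (gs here) p) (κ p)
      κ-eq here = ≈-sym (act-id _)
      κ-eq (there ())
      ⊕κ : ∀ {c y} (p : (a ∷ []) ∋ c) (q : singleCtx (Γs here) p ∋ y) →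
           from (⊕R {bs = a ∷ []} {singleCtx (Γs here)} {Γs} κ) (inj {Γs = singleCtx (Γs here)} p q)
           ≡ inj {Γs = singleCtx (Γs here)} p q
      ⊕κ here q = ⊕R-inj {bs = a ∷ []} {singleCtx (Γs here)} {Γs} κ here q
      ⊕κ (there ()) q

    comp-unitˡ : ∀ {Θ Ω a} (R₀ : Reindex (a ∷ []) Θ) {Δs : Fam Θ} (hs : ∀ {b} (p : Θ ∋ b) → Hom (Δs p) b)
                 (R : Reindex (concatF Θ Δs) Ω) (κ : Reindex (Δs (from R₀ here)) Ω) →
                 (∀ {x} (r : Δs (from R₀ here) ∋ x) → from κ r ≡ from R (inj {Γs = Δs} (from R₀ here) r)) →
                 act (comp (act id R₀) Δs hs) R ≈ act (hs (from R₀ here)) κ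
    comp-unitˡ R₀ {Δs} hs R κ coh =
      ≈-trans (act-cong R (≈-trans (comp-act-head id R₀ Δs hs)
                (≈-trans (act-cong _ (comp-idˡ' {Γs = λ q → Δs (from R₀ q)} (λ q → hs (from R₀ q)))) (act-⨾ _ _ _))))
        (≈-trans (act-⨾ _ _ R) (act-≐ _ (λ r → trans (cong (from R) (headR-from R₀ Δs r)) (sym (coh r)))))

    comp-unitʳ : ∀ {bs c Ω} (f : Hom bs c) {Γs : Fam bs} {gs : ∀ {b} (p : bs ∋ b) → Hom (Γs p) b}
                 (κ : ∀ {b} (p : bs ∋ b) → Reindex (b ∷ []) (Γs p)) → (∀ {b} (p : bs ∋ b) → gs p ≈ act id (κ p)) →
                 (R : Reindex (concatF bs Γs) Ω) (R' : Reindex bs Ω) →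
                 (∀ {b} (p : bs ∋ b) → from R' p ≡ from R (inj {Γs = Γs} p (from (κ p) here))) →
                 act (comp f Γs gs) R ≈ act f R'
    comp-unitʳ {bs} f {Γs} {gs} κ es R R' coh =
      ≈-trans (act-cong R (comp-act {f = f} {Γs = λ {b} _ → b ∷ []} {gs = λ _ → id} κ ≈-refl es))
        (≈-trans (act-⨾ _ _ R)
          (≈-trans (act-cong _ (subst-flip (concatF-single bs) (comp-idʳ f)))
            (≈-trans (act-⨾ _ _ _) (act-≐ f (λ p →
              trans (cong (λ t → from R (from (⊕R κ) t)) (castR-flip (concatF-single bs) (single-inj bs p)))
                (trans (cong (from R) (⊕R-inj {bs = bs} {λ {b} _ → b ∷ []} {Γs} κ p here)) (sym (coh p))))))))

    -- Both sides are brought to `f` composed with the unpermuted inner composites. What remains is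
    -- an equation of permutations, checked on doubly injected positions.
    comp-assoc' : ∀ {bs c Θ Ω} (f : Hom bs c) {Γs : Fam bs} (gs : ∀ {b} (p : bs ∋ b) → Hom (Γs p) b)
               (R₀ : Reindex (concatF bs Γs) Θ) {Δs : Fam Θ} (hs : ∀ {b} (p : Θ ∋ b) → Hom (Δs p) b)
               (R : Reindex (concatF Θ Δs) Ω)
               {Δs' : ∀ {b} (p : bs ∋ b) → Fam (Γs p)} (hs' : ∀ {b} (p : bs ∋ b) {x} (q : Γs p ∋ x) → Hom (Δs' p q) x)
               (κ : ∀ {b} (p : bs ∋ b) {x} (q : Γs p ∋ x) → Reindex (Δs (from R₀ (inj {Γs = Γs} p q))) (Δs' p q)) →
               (∀ {b} (p : bs ∋ b) {x} (q : Γs p ∋ x) → hs' p q ≈ act (hs (from R₀ (inj {Γs = Γs} p q))) (κ p q)) →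
               {Λs : Fam bs} (ks : ∀ {b} (p : bs ∋ b) → Hom (Λs p) b)
               (Rs : ∀ {b} (p : bs ∋ b) → Reindex (concatF (Γs p) (Δs' p)) (Λs p)) →
               (∀ {b} (p : bs ∋ b) → ks p ≈ act (comp (gs p) (Δs' p) (hs' p)) (Rs p)) →
               (R' : Reindex (concatF bs Λs) Ω) →
               (∀ {b} (p : bs ∋ b) {x} (q : Γs p ∋ x) {y} (r : Δs (from R₀ (inj {Γs = Γs} p q)) ∋ y) →
                 from R' (inj {Γs = Λs} p (from (Rs p) (inj {Γs = Δs' p} q (from (κ p q) r))))
                 ≡ from R (inj {Γs = Δs} (from R₀ (inj {Γs = Γs} p q)) r)) →
               act (comp (act (comp f Γs gs) R₀) Δs hs) R ≈ act (comp f Λs ks) R'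
    comp-assoc' {bs} f {Γs} gs R₀ {Δs} hs R {Δs'} hs' κ κ-eq {Λs} ks Rs ks-eq R' coh =
      ≈-trans (≈-trans (act-cong R lhs) (act-⨾ _ _ R))
        (≈-trans (act-≐ _ (block-elim {bs = bs} {Ξs} _ (λ p → block-elim {bs = Γs p} {Δᵢ p} _ (λ q r →
            trans (assocR-inj {Γs = Γs} {Δs} R₀ R p q r) (sym (rhs-inj p q r))))))
          (≈-sym (≈-trans (act-cong R' rhs) (act-⨾ _ _ R'))))
      where
      Δᵢ : ∀ {b} (p : bs ∋ b) → Fam (Γs p)
      Δᵢ p q = Δs (from R₀ (inj {Γs = Γs} p q))
      Ξs : Fam bs
      Ξs p = concatF (Γs p) (Δᵢ p)
      composites : ∀ {b} (p : bs ∋ b) → Hom (Ξs p) b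
      composites p = comp (gs p) (Δᵢ p) (λ q → hs (from R₀ (inj {Γs = Γs} p q)))
      lhs : comp (act (comp f Γs gs) R₀) Δs hs ≈ act (comp f Ξs composites) _
      lhs = ≈-trans (comp-act-head (comp f Γs gs) R₀ Δs hs)
              (≈-trans (act-cong _ (subst-flip (concatF-assoc bs Γs (λ r → Δs (from R₀ r)))
                         (comp-assoc f Γs gs (λ r → Δs (from R₀ r)) (λ r → hs (from R₀ r)))))
                (act-⨾ _ _ _))
      κs : ∀ {b} (p : bs ∋ b) → Reindex (Ξs p) (Λs p)
      κs p = ⊕R {bs = Γs p} {Δᵢ p} {Δs' p} (κ p) ⨾R Rs p
      rhs : comp f Λs ks ≈ act (comp f Ξs composites) (⊕R κs)
      rhs = comp-act κs ≈-refl (λ p → ≈-trans (ks-eq p)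
              (≈-trans (act-cong (Rs p) (comp-act {f = gs p} {Γs = Δᵢ p} (κ p) ≈-refl (κ-eq p))) (act-⨾ _ _ (Rs p))))
      rhs-inj : ∀ {b} (p : bs ∋ b) {x} (q : Γs p ∋ x) {y} (r : Δᵢ p q ∋ y) →
                from R' (from (⊕R {bs = bs} {Ξs} {Λs} κs) (inj {Γs = Ξs} p (inj {Γs = Δᵢ p} q r)))
                ≡ from R (inj {Γs = Δs} (from R₀ (inj {Γs = Γs} p q)) r)
      rhs-inj p q r = trans (cong (from R') (trans (⊕R-inj {bs = bs} {Ξs} {Λs} κs p (inj {Γs = Δᵢ p} q r))
          (cong (λ t → inj {Γs = Λs} p (from (Rs p) t)) (⊕R-inj {bs = Γs p} {Δᵢ p} {Δs' p} (κ p) q r))))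
        (coh p q r)

  reindexed : ReindexedMulticat Obj m e
  reindexed = record
    { Hom = Hom ; _≈_ = _≈_ ; id = id ; comp = comp ; act = act
    ; ≈-equiv = ≈-equiv ; act-cong = act-cong ; act-≐ = act-≐ ; act-id = act-id ; act-⨾ = act-⨾
    ; comp-act = comp-act ; unitˡ = comp-unitˡ ; unitʳ = comp-unitʳ ; assoc = comp-assoc' }

-- Pullback along a map of objects

module _ {x y : Level} {X : Set x} {Y : Set y} (f : Y → X) where

  map-++-wkˡ : ∀ (Γ Δ : List Y) {z} (n : MapPos f Γ z) →
               from (castR (map-++ f Γ Δ)) (unmap f (mpos (wkˡ (mp n)) (meq n))) ≡ wkˡ (unmap f n)
  map-++-wkˡ (c ∷ Γ) Δ (mpos here refl) = castR-++ˡ (f c ∷ []) (map-++ f Γ Δ) here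
  map-++-wkˡ (c ∷ Γ) Δ (mpos (there p) refl) =
    trans (castR-++ʳ (f c ∷ []) (map-++ f Γ Δ) _) (cong there (map-++-wkˡ Γ Δ (mpos p refl)))

  map-++-wkʳ : ∀ (Γ Δ : List Y) {z} (n : MapPos f Δ z) →
               from (castR (map-++ f Γ Δ)) (unmap f (mpos (wkʳ Γ (mp n)) (meq n))) ≡ wkʳ (map f Γ) (unmap f n)
  map-++-wkʳ [] Δ n = refl
  map-++-wkʳ (c ∷ Γ) Δ (mpos p refl) =
    trans (castR-++ʳ (f c ∷ []) (map-++ f Γ Δ) _) (cong there (map-++-wkʳ Γ Δ (mpos p refl)))

  mapR-unmap : ∀ {Γ Δ : List Y} (ρ : Reindex Γ Δ) {z} (n : MapPos f Γ z) →
               from (mapR f ρ) (unmap f n) ≡ unmap f (mpos (from ρ (mp n)) (meq n))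
  mapR-unmap ρ n = cong (λ m → unmap f (mpos (from ρ (mp m)) (meq m))) (map⁻-unmap f n)

  mapCtx : ∀ {bs : List Y} → Fam {X = Y} bs → Fam {X = X} (map f bs)
  mapCtx Γs = mapFam f (λ p → map f (Γs p))

  map-concatF-inj : ∀ (bs : List Y) (Γs : Fam {X = Y} bs) {b z} (p : map f bs ∋ b) (q : mapCtx Γs p ∋ z) →
    from (castR (map-concatF f bs Γs))
      (unmap f (mpos (inj {Γs = Γs} (mp (map⁻ f p)) (mp (map⁻ f q))) (meq (map⁻ f q))))
    ≡ inj {Γs = mapCtx Γs} p q
  map-concatF-inj (c ∷ bs) Γs here q =
    castR-trans (map-++ f (Γs here) _) (cong (map f (Γs here) ++_) (map-concatF f bs (λ p → Γs (there p))))
      (map-++-wkˡ (Γs here) _ (map⁻ f q))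
      (trans (castR-++ˡ (map f (Γs here)) (map-concatF f bs (λ p → Γs (there p))) _) (cong wkˡ (unmap-map⁻ f q)))
  map-concatF-inj (c ∷ bs) Γs (there p) q =
    castR-trans (map-++ f (Γs here) _) (cong (map f (Γs here) ++_) (map-concatF f bs (λ p → Γs (there p))))
      (map-++-wkʳ (Γs here) _ (mpos (inj {Γs = λ p → Γs (there p)} (mp (map⁻ f p)) (mp (map⁻ f q))) (meq (map⁻ f q))))
      (trans (castR-++ʳ (map f (Γs here)) (map-concatF f bs (λ p → Γs (there p))) _)
             (cong (wkʳ (map f (Γs here))) (map-concatF-inj bs (λ p → Γs (there p)) p q)))

  unmapR : ∀ (bs : List Y) (Γs : Fam {X = Y} bs) → Reindex (concatF (map f bs) (mapCtx Γs)) (map f (concatF bs Γs))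
  unmapR bs Γs = castR (sym (map-concatF f bs Γs))

  unmapR-inj : ∀ {bs : List Y} {Γs : Fam {X = Y} bs} {b z} (p : map f bs ∋ b) (q : mapCtx Γs p ∋ z) →
    from (unmapR bs Γs) (inj {Γs = mapCtx Γs} p q)
    ≡ unmap f (mpos (inj {Γs = Γs} (mp (map⁻ f p)) (mp (map⁻ f q))) (meq (map⁻ f q)))
  unmapR-inj {bs} {Γs} p q = castR-flip (map-concatF f bs Γs) (map-concatF-inj bs Γs p q)

  unmap⨾ : ∀ {bs Θ : List Y} (Γs : Fam {X = Y} bs) → Reindex (concatF bs Γs) Θ →
           Reindex (concatF (map f bs) (mapCtx Γs)) (map f Θ)
  unmap⨾ {bs} Γs R = unmapR bs Γs ⨾R mapR f R

  unmap⨾-inj : ∀ {bs Θ : List Y} (Γs : Fam {X = Y} bs) (R : Reindex (concatF bs Γs) Θ)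
               {b z} (p : map f bs ∋ b) (q : mapCtx Γs p ∋ z) →
    from (unmap⨾ Γs R) (inj {Γs = mapCtx Γs} p q)
    ≡ unmap f (mpos (from R (inj {Γs = Γs} (mp (map⁻ f p)) (mp (map⁻ f q)))) (meq (map⁻ f q)))
  unmap⨾-inj Γs R p q = trans (cong (from (mapR f R)) (unmapR-inj {Γs = Γs} p q)) (mapR-unmap R _)

  unmap⨾-unmap : ∀ {bs Θ : List Y} (Γs : Fam {X = Y} bs) (R : Reindex (concatF bs Γs) Θ)
               {b z} (p : map f bs ∋ b) (n : MapPos f (Γs (mp (map⁻ f p))) z) →
    from (unmap⨾ Γs R) (inj {Γs = mapCtx Γs} p (unmap f n))
    ≡ unmap f (mpos (from R (inj {Γs = Γs} (mp (map⁻ f p)) (mp n))) (meq n))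
  unmap⨾-unmap Γs R p n = trans (unmap⨾-inj Γs R p (unmap f n))
    (cong (λ m → unmap f (mpos (from R (inj {Γs = Γs} (mp (map⁻ f p)) (mp m))) (meq m))) (map⁻-unmap f n))

module Pullback {x y m e : Level} {X : Set x} {Y : Set y} (f : Y → X) (M : ReindexedMulticat X m e) where
  open ReindexedMulticat M

  mapHom : ∀ {bs : List Y} {Γs : Fam {X = Y} bs} → (∀ {b} (p : bs ∋ b) → Hom (map f (Γs p)) (f b)) →
           ∀ {b} (p : map f bs ∋ b) → Hom (mapCtx f Γs p) b
  mapHom {Γs = Γs} gs = mapFamHom f Hom (λ p → map f (Γs p)) gs

  -- Composition over `X` produces a concatenation indexed by `map f bs`; `unmapR` turns it into the
  -- image of a concatenation over `Y`.
  comp′ : ∀ {bs c} → Hom (map f bs) (f c) → (Γs : Fam {X = Y} bs) →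
          (∀ {b} (p : bs ∋ b) → Hom (map f (Γs p)) (f b)) → Hom (map f (concatF bs Γs)) (f c)
  comp′ {bs} g Γs gs = act (comp g (mapCtx f Γs) (mapHom {Γs = Γs} gs)) (unmapR f bs Γs)

  act-comp′ : ∀ {bs c Θ} (g : Hom (map f bs) (f c)) (Γs : Fam {X = Y} bs)
              (gs : ∀ {b} (p : bs ∋ b) → Hom (map f (Γs p)) (f b)) (R : Reindex (concatF bs Γs) Θ) →
              act (comp′ g Γs gs) (mapR f R) ≈ act (comp g (mapCtx f Γs) (mapHom {Γs = Γs} gs)) (unmap⨾ f Γs R)
  act-comp′ g Γs gs R = act-⨾ _ _ _

  private
    -- This is `mapHom` with the preimage of the position made a variable. Since `map⁻ f p` is stuck
    -- for a variable `p`, facts are proved for an arbitrary `n`, whose equation `meq n` can be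
    -- matched with `refl`.
    homAt : ∀ {bs : List Y} {Γs : Fam {X = Y} bs} → (∀ {b} (p : bs ∋ b) → Hom (map f (Γs p)) (f b)) →
            ∀ {b} (n : MapPos f bs b) → Hom (map f (Γs (mp n))) b
    homAt {Γs = Γs} gs n = subst (Hom (map f (Γs (mp n)))) (meq n) (gs (mp n))

    castAt : ∀ {bs : List Y} (Γs : Fam {X = Y} bs) {b} {n n' : MapPos f bs b} → n ≡ n' →
             Reindex (map f (Γs (mp n))) (map f (Γs (mp n')))
    castAt Γs e = castR (cong (λ n → map f (Γs (mp n))) e)

    comp-act′ : ∀ {bs c} {g g' : Hom (map f bs) (f c)} {Γs Δs : Fam {X = Y} bs}
               {gs : ∀ {b} (p : bs ∋ b) → Hom (map f (Γs p)) (f b)} {gs' : ∀ {b} (p : bs ∋ b) → Hom (map f (Δs p)) (f b)}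
               (κ : ∀ {b} (p : bs ∋ b) → Reindex (Γs p) (Δs p)) →
               g' ≈ g → (∀ {b} (p : bs ∋ b) → gs' p ≈ act (gs p) (mapR f (κ p))) →
               comp′ g' Δs gs' ≈ act (comp′ g Γs gs) (mapR f (⊕R {bs = bs} {Γs} {Δs} κ))
    comp-act′ {bs} {g = g} {g'} {Γs} {Δs} {gs} {gs'} κ e es =
      ≈-trans (act-cong (unmapR f bs Δs) (comp-act {f = g} {g'} {mapCtx f Γs} {mapCtx f Δs}
                          {mapHom {Γs = Γs} gs} {mapHom {Γs = Δs} gs'} κ̂ e (λ p → κ̂-eq (map⁻ f p))))
        (≈-trans (act-⨾ _ _ _) (≈-trans (act-≐ _ (block-elim {bs = map f bs} {mapCtx f Γs} _ coh))
          (≈-sym (act-comp′ g Γs gs (⊕R {bs = bs} {Γs} {Δs} κ)))))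
      where
      κ̂ : ∀ {b} (p : map f bs ∋ b) → Reindex (mapCtx f Γs p) (mapCtx f Δs p)
      κ̂ p = mapR f (κ (mp (map⁻ f p)))
      κ̂-eq : ∀ {b} (n : MapPos f bs b) → homAt {Γs = Δs} gs' n ≈ act (homAt {Γs = Γs} gs n) (mapR f (κ (mp n)))
      κ̂-eq (mpos p refl) = es p
      coh : ∀ {b z} (p : map f bs ∋ b) (q : mapCtx f Γs p ∋ z) → _ ≡ _
      coh p q = trans (cong (from (unmapR f bs Δs)) (⊕R-inj {bs = map f bs} {mapCtx f Γs} {mapCtx f Δs} κ̂ p q))
        (trans (unmapR-inj f {Γs = Δs} p (from (κ̂ p) q))
          (trans (cong (λ n → unmap f (mpos (inj {Γs = Δs} (mp (map⁻ f p)) (mp n)) (meq n))) (map⁻-unmap f _))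
            (sym (trans (unmap⨾-inj f Γs (⊕R {bs = bs} {Γs} {Δs} κ) p q)
              (cong (λ t → unmap f (mpos t (meq (map⁻ f q)))) (⊕R-inj {bs = bs} {Γs} {Δs} κ (mp (map⁻ f p)) (mp (map⁻ f q))))))))

    unitˡ′ : ∀ {Θ Ω a} (R₀ : Reindex (a ∷ []) Θ) {Δs : Fam {X = Y} Θ} (hs : ∀ {b} (p : Θ ∋ b) → Hom (map f (Δs p)) (f b))
             (R : Reindex (concatF Θ Δs) Ω) (κ : Reindex (Δs (from R₀ here)) Ω) →
             (∀ {x} (r : Δs (from R₀ here) ∋ x) → from κ r ≡ from R (inj {Γs = Δs} (from R₀ here) r)) →
             act (comp′ (act id (mapR f R₀)) Δs hs) (mapR f R) ≈ act (hs (from R₀ here)) (mapR f κ)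
    unitˡ′ {Θ} {Ω} R₀ {Δs} hs R κ coh = ≈-trans (act-comp′ _ Δs hs R)
      (≈-trans (unitˡ (mapR f R₀) (mapHom {Γs = Δs} hs) (unmap⨾ f Δs R) (κ̂ at₀) (λ r →
          trans (κ̂-from at₀ r) (sym (unmap⨾-inj f Δs R (from (mapR f R₀) here) r))))
        (κ̂-act at₀))
      where
      n₀ : MapPos f Θ _
      n₀ = mpos (from R₀ here) refl
      at₀ : map⁻ f (from (mapR f R₀) here) ≡ n₀
      at₀ = map⁻-unmap f n₀
      κ̂ : ∀ {n} → n ≡ n₀ → Reindex (map f (Δs (mp n))) (map f Ω)
      κ̂ eq = castAt Δs eq ⨾R mapR f κ
      κ̂-from : ∀ {n} (eq : n ≡ n₀) {z} (r : map f (Δs (mp n)) ∋ z) →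
               from (κ̂ eq) r ≡ unmap f (mpos (from R (inj {Γs = Δs} (mp n) (mp (map⁻ f r)))) (meq (map⁻ f r)))
      κ̂-from refl r = cong (λ t → unmap f (mpos t (meq (map⁻ f r)))) (coh (mp (map⁻ f r)))
      κ̂-act : ∀ {n} (eq : n ≡ n₀) → act (homAt {Γs = Δs} hs n) (κ̂ eq) ≈ act (hs (from R₀ here)) (mapR f κ)
      κ̂-act refl = act-≐ _ (λ _ → refl)

    unitʳ′ : ∀ {bs c Ω} (g : Hom (map f bs) (f c)) {Γs : Fam {X = Y} bs} {gs : ∀ {b} (p : bs ∋ b) → Hom (map f (Γs p)) (f b)}
             (κ : ∀ {b} (p : bs ∋ b) → Reindex (b ∷ []) (Γs p)) → (∀ {b} (p : bs ∋ b) → gs p ≈ act id (mapR f (κ p))) →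
             (R : Reindex (concatF bs Γs) Ω) (R' : Reindex bs Ω) →
             (∀ {b} (p : bs ∋ b) → from R' p ≡ from R (inj {Γs = Γs} p (from (κ p) here))) →
             act (comp′ g Γs gs) (mapR f R) ≈ act g (mapR f R')
    unitʳ′ {bs} g {Γs} {gs} κ es R R' coh = ≈-trans (act-comp′ g Γs gs R)
      (unitʳ g {mapCtx f Γs} {mapHom {Γs = Γs} gs} (λ p → κ̂ (map⁻ f p)) (λ p → κ̂-eq (map⁻ f p)) (unmap⨾ f Γs R) (mapR f R') (λ p →
        trans (coh′ (map⁻ f p))
          (trans (sym (unmap⨾-unmap f Γs R p (here-at (map⁻ f p))))
            (cong (λ t → from (unmap⨾ f Γs R) (inj {Γs = mapCtx f Γs} p t)) (sym (κ̂-here (map⁻ f p)))))))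
      where
      κ̂ : ∀ {b} (n : MapPos f bs b) → Reindex (b ∷ []) (map f (Γs (mp n)))
      κ̂ n = castR (cong (_∷ []) (sym (meq n))) ⨾R mapR f (κ (mp n))
      κ̂-eq : ∀ {b} (n : MapPos f bs b) → homAt {Γs = Γs} gs n ≈ act id (κ̂ n)
      κ̂-eq (mpos p refl) = ≈-trans (es p) (act-≐ _ (λ _ → refl))
      here-at : ∀ {b} (n : MapPos f bs b) → MapPos f (Γs (mp n)) b
      here-at n = mpos (from (κ (mp n)) here) (meq n)
      κ̂-here : ∀ {b} (n : MapPos f bs b) → from (κ̂ n) here ≡ unmap f (here-at n)
      κ̂-here (mpos p refl) = refl
      coh′ : ∀ {b} (n : MapPos f bs b) → unmap f (mpos (from R' (mp n)) (meq n))
             ≡ unmap f (mpos (from R (inj {Γs = Γs} (mp n) (mp (here-at n)))) (meq n))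
      coh′ n = cong (λ t → unmap f (mpos t (meq n))) (coh (mp n))

    assoc′ : ∀ {bs c Θ Ω} (g : Hom (map f bs) (f c)) {Γs : Fam {X = Y} bs} (gs : ∀ {b} (p : bs ∋ b) → Hom (map f (Γs p)) (f b))
             (R₀ : Reindex (concatF bs Γs) Θ) {Δs : Fam {X = Y} Θ} (hs : ∀ {b} (p : Θ ∋ b) → Hom (map f (Δs p)) (f b))
             (R : Reindex (concatF Θ Δs) Ω)
             {Δs' : ∀ {b} (p : bs ∋ b) → Fam {X = Y} (Γs p)}
             (hs' : ∀ {b} (p : bs ∋ b) {x} (q : Γs p ∋ x) → Hom (map f (Δs' p q)) (f x))
             (κ : ∀ {b} (p : bs ∋ b) {x} (q : Γs p ∋ x) → Reindex (Δs (from R₀ (inj {Γs = Γs} p q))) (Δs' p q)) →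
             (∀ {b} (p : bs ∋ b) {x} (q : Γs p ∋ x) → hs' p q ≈ act (hs (from R₀ (inj {Γs = Γs} p q))) (mapR f (κ p q))) →
             {Λs : Fam {X = Y} bs} (ks : ∀ {b} (p : bs ∋ b) → Hom (map f (Λs p)) (f b))
             (Rs : ∀ {b} (p : bs ∋ b) → Reindex (concatF (Γs p) (Δs' p)) (Λs p)) →
             (∀ {b} (p : bs ∋ b) → ks p ≈ act (comp′ (gs p) (Δs' p) (hs' p)) (mapR f (Rs p))) →
             (R' : Reindex (concatF bs Λs) Ω) →
             (∀ {b} (p : bs ∋ b) {x} (q : Γs p ∋ x) {y} (r : Δs (from R₀ (inj {Γs = Γs} p q)) ∋ y) →
               from R' (inj {Γs = Λs} p (from (Rs p) (inj {Γs = Δs' p} q (from (κ p q) r))))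
               ≡ from R (inj {Γs = Δs} (from R₀ (inj {Γs = Γs} p q)) r)) →
             act (comp′ (act (comp′ g Γs gs) (mapR f R₀)) Δs hs) (mapR f R) ≈ act (comp′ g Λs ks) (mapR f R')
    assoc′ {bs} {Θ = Θ} g {Γs} gs R₀ {Δs} hs R {Δs'} hs' κ κ-eq {Λs} ks Rs ks-eq R' coh =
      ≈-trans (≈-trans (act-comp′ _ Δs hs R) (act-cong (unmap⨾ f Δs R) (comp-cong (act-comp′ g Γs gs R₀) (λ _ → ≈-refl))))
        (≈-trans (assoc g {mapCtx f Γs} (mapHom {Γs = Γs} gs) R̂₀ {mapCtx f Δs} (mapHom {Γs = Δs} hs) (unmap⨾ f Δs R)
          {λ p → mapCtx f (Δs' (mp (map⁻ f p)))} (λ p → mapHom {Γs = Δs' (mp (map⁻ f p))} (hs' (mp (map⁻ f p))))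
          (λ p q → κ̂ p q (at₀ p q))
          (λ p q → κ̂-act (mp (map⁻ f p)) (map⁻ f q) (at₀ p q))
          {mapCtx f Λs} (mapHom {Γs = Λs} ks)
          (λ p → unmap⨾ f (Δs' (mp (map⁻ f p))) (Rs (mp (map⁻ f p))))
          (λ p → ks-at (map⁻ f p))
          (unmap⨾ f Λs R')
          (λ p q r → coh′ p q (at₀ p q) r))
        (≈-sym (act-comp′ g Λs ks R')))
      where
      R̂₀ : Reindex (concatF (map f bs) (mapCtx f Γs)) (map f Θ)
      R̂₀ = unmap⨾ f Γs R₀
      at : ∀ {b} (p : bs ∋ b) {z} → MapPos f (Γs p) z → MapPos f Θ z
      at p n = mpos (from R₀ (inj {Γs = Γs} p (mp n))) (meq n)
      -- The preimage of the position reached through `R̂₀` is the expected one only up to this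
      -- equation, so `κ̂` casts along it; the facts about `κ̂` are proved for any such equation and
      -- hence by `refl`.
      at₀ : ∀ {b} (p : map f bs ∋ b) {z} (q : mapCtx f Γs p ∋ z) →
            map⁻ f (from R̂₀ (inj {Γs = mapCtx f Γs} p q)) ≡ at (mp (map⁻ f p)) (map⁻ f q)
      at₀ p q = trans (cong (map⁻ f) (unmap⨾-inj f Γs R₀ p q)) (map⁻-unmap f _)
      κ̂ : ∀ {b} (p : map f bs ∋ b) {z} (q : mapCtx f Γs p ∋ z) {n} → n ≡ at (mp (map⁻ f p)) (map⁻ f q) →
          Reindex (map f (Δs (mp n))) (mapCtx f (Δs' (mp (map⁻ f p))) q)
      κ̂ p q eq = castAt Δs eq ⨾R mapR f (κ (mp (map⁻ f p)) (mp (map⁻ f q)))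
      κ̂-act : ∀ {b} (p : bs ∋ b) {z} (k : MapPos f (Γs p) z) {n} (eq : n ≡ at p k) →
              homAt {Γs = Δs' p} (hs' p) k ≈ act (homAt {Γs = Δs} hs n) (castAt Δs eq ⨾R mapR f (κ p (mp k)))
      κ̂-act p (mpos q refl) refl = ≈-trans (κ-eq p q) (act-≐ _ (λ _ → refl))
      ks-at : ∀ {b} (n : MapPos f bs b) → homAt {Γs = Λs} ks n
              ≈ act (comp (homAt {Γs = Γs} gs n) (mapCtx f (Δs' (mp n))) (mapHom {Γs = Δs' (mp n)} (hs' (mp n))))
                    (unmap⨾ f (Δs' (mp n)) (Rs (mp n)))
      ks-at (mpos p refl) = ≈-trans (ks-eq p) (act-comp′ (gs p) (Δs' p) (hs' p) (Rs p))
      coh″ : ∀ {b} (p : bs ∋ b) {z} (k : MapPos f (Γs p) z) {n} (eq : n ≡ at p k) {w} (r : map f (Δs (mp n)) ∋ w) →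
             let r' = map⁻ f (from (castAt Δs eq ⨾R mapR f (κ p (mp k))) r) in
             unmap f (mpos (from R' (inj {Γs = Λs} p (from (Rs p) (inj {Γs = Δs' p} (mp k) (mp r'))))) (meq r'))
             ≡ unmap f (mpos (from R (inj {Γs = Δs} (mp n) (mp (map⁻ f r)))) (meq (map⁻ f r)))
      coh″ p k refl r = trans
        (cong (λ r' → unmap f (mpos (from R' (inj {Γs = Λs} p (from (Rs p) (inj {Γs = Δs' p} (mp k) (mp r'))))) (meq r')))
           (map⁻-unmap f (mpos (from (κ p (mp k)) (mp (map⁻ f r))) (meq (map⁻ f r)))))
        (cong (λ t → unmap f (mpos t (meq (map⁻ f r)))) (coh p (mp k) (mp (map⁻ f r))))
      coh′ : ∀ {b} (p : map f bs ∋ b) {z} (q : mapCtx f Γs p ∋ z)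
             (eq : map⁻ f (from R̂₀ (inj {Γs = mapCtx f Γs} p q)) ≡ at (mp (map⁻ f p)) (map⁻ f q))
             {w} (r : mapCtx f Δs (from R̂₀ (inj {Γs = mapCtx f Γs} p q)) ∋ w) →
             from (unmap⨾ f Λs R') (inj {Γs = mapCtx f Λs} p (from (unmap⨾ f (Δs' (mp (map⁻ f p))) (Rs (mp (map⁻ f p))))
               (inj {Γs = mapCtx f (Δs' (mp (map⁻ f p)))} q (from (κ̂ p q eq) r))))
             ≡ from (unmap⨾ f Δs R) (inj {Γs = mapCtx f Δs} (from R̂₀ (inj {Γs = mapCtx f Γs} p q)) r)
      coh′ p q eq r = trans
        (cong (λ t → from (unmap⨾ f Λs R') (inj {Γs = mapCtx f Λs} p t))
           (unmap⨾-inj f (Δs' (mp (map⁻ f p))) (Rs (mp (map⁻ f p))) q (from (κ̂ p q eq) r)))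
        (trans (unmap⨾-unmap f Λs R' p _)
          (trans (coh″ (mp (map⁻ f p)) (map⁻ f q) eq r)
            (sym (unmap⨾-inj f Δs R (from R̂₀ (inj {Γs = mapCtx f Γs} p q)) r))))

  pullback : ReindexedMulticat Y m e
  pullback = record
    { Hom = λ Γ a → Hom (map f Γ) (f a) ; _≈_ = _≈_ ; id = id ; comp = comp′ ; act = λ g ρ → act g (mapR f ρ)
    ; ≈-equiv = ≈-equiv ; act-cong = λ ρ → act-cong (mapR f ρ)
    ; act-≐ = λ g e → act-≐ g (λ p → cong (λ t → unmap f (mpos t (meq (map⁻ f p)))) (e (mp (map⁻ f p))))
    ; act-id = λ g → ≈-trans (act-≐ g (λ p → unmap-map⁻ f p)) (act-id g)
    ; act-⨾ = λ g ρ ρ' → ≈-trans (act-⨾ g (mapR f ρ) (mapR f ρ')) (act-≐ g (λ p → mapR-unmap f ρ' _))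
    ; comp-act = λ {bs} {c} {g} {g'} {Γs} {Δs} {gs} {gs'} → comp-act′ {bs} {c} {g} {g'} {Γs} {Δs} {gs} {gs'}
    ; unitˡ = unitˡ′ ; unitʳ = unitʳ′ ; assoc = assoc′ }

-- Closed structure

module _ {a : Level} {A : Set a} where

  evR : ∀ (Γ : List A) {c : A} (as : List A) → Reindex (concatF (c ∷ as) (evCtx Γ)) (Γ ++ as)
  evR Γ as = castR (cong (Γ ++_) (concatF-single as))

  evR-here : ∀ (Γ : List A) {c : A} (as : List A) {x} (q : Γ ∋ x) →
             from (evR Γ {c} as) (inj {Γs = evCtx Γ {c} {as}} here q) ≡ wkˡ q
  evR-here Γ as q = castR-++ˡ Γ (concatF-single as) q

  evR-there : ∀ (Γ : List A) {c : A} (as : List A) {x} (p : as ∋ x) →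
              from (evR Γ {c} as) (inj {Γs = evCtx Γ {c} {as}} (there p) here) ≡ wkʳ Γ p
  evR-there Γ as p = trans (castR-++ʳ Γ (concatF-single as) (inj {Γs = λ {c} _ → c ∷ []} p here))
                           (cong (wkʳ Γ) (single-inj as p))

module Uncurrying {x m e : Level} {X : Set x} (M : ReindexedMulticat X m e) where
  open ReindexedMulticat M

  evHom : ∀ {Γ c as} → Hom Γ c → ∀ {b} (p : (c ∷ as) ∋ b) → Hom (evCtx Γ p) b
  evHom h here      = h
  evHom h (there p) = id

  uncurryBy : ∀ {Γ c as b} → Hom (c ∷ as) b → Hom Γ c → Hom (Γ ++ as) b
  uncurryBy {Γ} {c} {as} ev h = act (comp ev (evCtx Γ) (evHom h)) (evR Γ {c} as)

-- Half of the bijection and the congruence of `curry` are condensed into injectivity of uncurrying,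
-- the form in which they are used: morphisms into `as ⊸ b` are compared after composing with `ev`.
record ClosedModel {ℓ : Level} (L : ClosedSignature ℓ) (m e : Level) : Set (lsuc (ℓ ⊔ m ⊔ e)) where
  open ClosedSignature L
  field
    multicat : ReindexedMulticat (Ty Atom) m e
  open ReindexedMulticat multicat public
  open Uncurrying multicat public
  field
    ev    : ∀ {as b} → Hom ((as ⊸ b) ∷ as) b
    arr   : ∀ {as b} → Arr as b → Hom as b
    curry : ∀ {Γ as b} → Hom (Γ ++ as) b → Hom Γ (as ⊸ b)
    uncurry-curry     : ∀ {Γ as b} (g : Hom (Γ ++ as) b) → uncurryBy ev (curry {Γ} g) ≈ g
    uncurry-injective : ∀ {Γ as b} {h h' : Hom Γ (as ⊸ b)} → uncurryBy ev h ≈ uncurryBy ev h' → h ≈ h'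

  uncurry : ∀ {Γ as b} → Hom Γ (as ⊸ b) → Hom (Γ ++ as) b
  uncurry = uncurryBy ev

module _ {ℓ o m e : Level} (L : ClosedSignature ℓ) (S : SymClosedMulticat o m e) (i : SigMap L S) where
  open ClosedSignature L
  open SigMap i
  private
    module S where
      open SymClosedMulticat S public
      open ReindexedMulticat (Reindexed.reindexed S) public
        using (≈-refl; ≈-sym; ≈-trans; act-≐; comp-act; subst-act)
    open S using (_≈_)

  private
    M : ReindexedMulticat (Ty Atom) m e
    M = Pullback.pullback obj (Reindexed.reindexed S)

    evᵢ : ∀ {as b} → S.Hom (map obj ((as ⊸ b) ∷ as)) (obj b)
    evᵢ {as} {b} = subst (λ X → S.Hom (X ∷ map obj as) (obj b)) (sym (obj-⊸ as b)) S.ev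

    evHomᵢ : ∀ {Γ c as} → S.Hom (map obj Γ) (obj c) → ∀ {b} (p : (c ∷ as) ∋ b) → S.Hom (map obj (evCtx Γ p)) (obj b)
    evHomᵢ {Γ} = Uncurrying.evHom M {Γ}

    uncurryᵢ : ∀ {Γ as b} → S.Hom (map obj Γ) (obj (as ⊸ b)) → S.Hom (map obj (Γ ++ as)) (obj b)
    uncurryᵢ {Γ} {as} {b} = Uncurrying.uncurryBy M {Γ} {as ⊸ b} {as} evᵢ

    unfold : ∀ {Γ as b} → S.Hom (map obj Γ) (obj (as ⊸ b)) → S.Hom (map obj Γ) (map obj as S.⊸ obj b)
    unfold {Γ} {as} {b} = subst (S.Hom (map obj Γ)) (obj-⊸ as b)

    fold : ∀ {Γ as b} → S.Hom (map obj Γ) (map obj as S.⊸ obj b) → S.Hom (map obj Γ) (obj (as ⊸ b))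
    fold {Γ} {as} {b} = subst (S.Hom (map obj Γ)) (sym (obj-⊸ as b))

    -- With `y` in place of `obj (as ⊸ b)` the equation can be matched. The transport moves from the
    -- domain of `ev` to the codomain of the morphism plugged into it.
    ev-cast : ∀ {Γ as b y} (eq : y ≡ (as S.⊸ b)) (h : S.Hom Γ y) →
              S.comp (subst (λ X → S.Hom (X ∷ as) b) (sym eq) S.ev) (evCtx Γ) (S.evHom h)
              ≈ S.comp S.ev (evCtx Γ) (S.evHom (subst (S.Hom Γ) eq h))
    ev-cast refl h = S.≈-refl

    -- Reduces the closed structure of the pullback to that of `S`. Both sides compose `ev` with `h`
    -- and identities, but over families that agree only pointwise; `κ` bridges them, and `total`
    -- chases positions.
    uncurryᵢ-≈ : ∀ {Γ as b} (h : S.Hom (map obj Γ) (obj (as ⊸ b))) →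
                 uncurryᵢ {Γ} {as} {b} h ≈ S.act (S.uncurry (unfold {Γ} {as} {b} h)) (castR (sym (map-++ obj Γ as)))
    uncurryᵢ-≈ {Γ} {as} {b} h =
      S.≈-trans (Pullback.act-comp′ obj (Reindexed.reindexed S) evᵢ Γs (evHomᵢ {Γ} h) (evR Γ {as ⊸ b} as))
        (S.≈-trans (S.act-cong (unmap⨾ obj Γs (evR Γ {as ⊸ b} as)) (S.comp-act {Γs = evCtx (map obj Γ)} κ S.≈-refl κ-eq))
          (S.≈-trans (S.act-⨾ _ _ _)
            (S.≈-trans (S.act-cong _ (ev-cast (obj-⊸ as b) h))
              (S.≈-trans (S.act-≐ _ (block-elim {bs = obj (as ⊸ b) ∷ map obj as} {evCtx (map obj Γ)} _ total))
                (S.≈-sym (S.≈-trans (S.act-cong _ (S.subst-act e₀ _)) (S.act-⨾ _ _ _)))))))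
      where
      Γs : Fam ((as ⊸ b) ∷ as)
      Γs = evCtx Γ
      e₀ : concatF (obj (as ⊸ b) ∷ map obj as) (evCtx (map obj Γ)) ≡ map obj Γ ++ map obj as
      e₀ = cong (map obj Γ ++_) (concatF-single (map obj as))
      κ : ∀ {c} (p : (obj (as ⊸ b) ∷ map obj as) ∋ c) → Reindex (evCtx (map obj Γ) p) (mapCtx obj Γs p)
      κ here = idR
      κ (there p) = castR (cong (_∷ []) (sym (meq (map⁻ obj p))))
      κ-eq : ∀ {c} (p : (obj (as ⊸ b) ∷ map obj as) ∋ c) →
             Pullback.mapHom obj (Reindexed.reindexed S) {Γs = Γs} (evHomᵢ {Γ} h) p ≈ S.act (S.evHom h p) (κ p)
      κ-eq here = S.≈-sym (S.act-id _)
      κ-eq (there p) = go (meq (map⁻ obj p))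
        where
        go : ∀ {x y} (eq : x ≡ y) → subst (S.Hom (x ∷ [])) eq S.id ≈ S.act S.id (castR (cong (_∷ []) (sym eq)))
        go refl = S.≈-sym (S.act-id _)
      ⊕κ : Reindex (concatF (obj (as ⊸ b) ∷ map obj as) (evCtx (map obj Γ))) (concatF (obj (as ⊸ b) ∷ map obj as) (mapCtx obj Γs))
      ⊕κ = ⊕R {bs = obj (as ⊸ b) ∷ map obj as} {evCtx (map obj Γ)} {mapCtx obj Γs} κ
      total : ∀ {c y} (p : (obj (as ⊸ b) ∷ map obj as) ∋ c) (q : evCtx (map obj Γ) p ∋ y) →
              from (unmap⨾ obj Γs (evR Γ {as ⊸ b} as)) (from ⊕κ (inj {Γs = evCtx (map obj Γ)} p q))
              ≡ from (castR (sym (map-++ obj Γ as))) (from (castR e₀) (inj {Γs = evCtx (map obj Γ)} p q))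
      total here q = trans (cong (from (unmap⨾ obj Γs (evR Γ {as ⊸ b} as))) (⊕R-inj {Γs = evCtx (map obj Γ)} {mapCtx obj Γs} κ here q))
        (trans (unmap⨾-inj obj Γs (evR Γ {as ⊸ b} as) here q)
          (trans (cong (λ t → unmap obj (mpos t (meq (map⁻ obj q)))) (evR-here Γ {as ⊸ b} as (mp (map⁻ obj q))))
            (sym (castR-flip (map-++ obj Γ as) (trans (map-++-wkˡ obj Γ as (map⁻ obj q))
              (trans (cong wkˡ (unmap-map⁻ obj q)) (sym (evR-here (map obj Γ) {obj (as ⊸ b)} (map obj as) q))))))))
      total (there {x = c} p) here = trans
        (cong (from (unmap⨾ obj Γs (evR Γ {as ⊸ b} as))) (⊕R-inj {Γs = evCtx (map obj Γ)} {mapCtx obj Γs} κ (there p) here))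
        (trans (cong (λ t → from (unmap⨾ obj Γs (evR Γ {as ⊸ b} as)) (inj {Γs = mapCtx obj Γs} (there p) t)) (κ-here (meq (map⁻ obj p))))
          (trans (unmap⨾-unmap obj Γs (evR Γ {as ⊸ b} as) (there p) (mpos here (meq (map⁻ obj p))))
            (trans (cong (λ t → unmap obj (mpos t (meq (map⁻ obj p)))) (evR-there Γ {as ⊸ b} as (mp (map⁻ obj p))))
              (sym (castR-flip (map-++ obj Γ as) (trans (map-++-wkʳ obj Γ as (map⁻ obj p))
                (trans (cong (wkʳ (map obj Γ)) (unmap-map⁻ obj p)) (sym (evR-there (map obj Γ) {obj (as ⊸ b)} (map obj as) p)))))))))
        where
        κ-here : ∀ {x : Ty Atom} {y} (eq : obj x ≡ y) → from (castR (cong (_∷ []) (sym eq))) here ≡ unmap obj {Γ = x ∷ []} (mpos here eq)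
        κ-here refl = refl
      total (there p) (there ())

    unfold-fold : ∀ {Γ as b} (h : S.Hom (map obj Γ) (map obj as S.⊸ obj b)) →
                  unfold {Γ} {as} {b} (fold {Γ} {as} {b} h) ≡ h
    unfold-fold {Γ} {as} {b} h = subst-subst-sym (obj-⊸ as b)

    unfold-injective : ∀ {Γ as b} {h h' : S.Hom (map obj Γ) (obj (as ⊸ b))} →
                       unfold {Γ} {as} {b} h ≈ unfold {Γ} {as} {b} h' → h ≈ h'
    unfold-injective {Γ} {as} {b} {h} {h'} = go (obj-⊸ as b) h h'
      where
      go : ∀ {x y} (eq : x ≡ y) (h h' : S.Hom (map obj Γ) x) →
           subst (S.Hom (map obj Γ)) eq h ≈ subst (S.Hom (map obj Γ)) eq h' → h ≈ h'
      go refl h h' r = r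

    uncurryS-injective : ∀ {Γ as b} {h h' : S.Hom Γ (as S.⊸ b)} → S.uncurry h ≈ S.uncurry h' → h ≈ h'
    uncurryS-injective {h = h} {h'} eq =
      S.≈-trans (S.≈-sym (S.curry-uncurry h)) (S.≈-trans (S.curry-cong eq) (S.curry-uncurry h'))

    ++R : ∀ Γ as → Reindex (map obj (Γ ++ as)) (map obj Γ ++ map obj as)
    ++R Γ as = castR (map-++ obj Γ as)

    act-sym : ∀ {Γ Δ a} (f : S.Hom Γ a) (eq : Γ ≡ Δ) → S.act (S.act f (castR eq)) (castR (sym eq)) ≈ f
    act-sym f refl = S.≈-trans (S.act-id _) (S.act-id f)

    act-sym-injective : ∀ {Γ Δ a} (eq : Γ ≡ Δ) {f g : S.Hom Δ a} →
                        S.act f (castR (sym eq)) ≈ S.act g (castR (sym eq)) → f ≈ g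
    act-sym-injective refl r = S.≈-trans (S.≈-sym (S.act-id _)) (S.≈-trans r (S.act-id _))

  closedModel : ClosedModel L m e
  closedModel = record
    { multicat = M ; ev = evᵢ ; arr = arr
    ; curry = λ {Γ} {as} {b} g → fold {Γ} {as} {b} (S.curry (S.act g (++R Γ as)))
    ; uncurry-curry = λ {Γ} {as} {b} g → S.≈-trans (uncurryᵢ-≈ {Γ} {as} {b} _)
        (S.≈-trans (S.act-cong _ (subst (λ k → S.uncurry k ≈ S.act g (++R Γ as))
                     (sym (unfold-fold {Γ} {as} {b} (S.curry (S.act g (++R Γ as))))) (S.uncurry-curry (S.act g (++R Γ as)))))
          (act-sym g (map-++ obj Γ as)))
    ; uncurry-injective = λ {Γ} {as} {b} {h} {h'} eq → unfold-injective {Γ} {as} {b} (uncurryS-injective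
        (act-sym-injective (map-++ obj Γ as)
          (S.≈-trans (S.≈-sym (uncurryᵢ-≈ {Γ} {as} {b} h)) (S.≈-trans eq (uncurryᵢ-≈ {Γ} {as} {b} h')))))
    }

-- Permutations under a binder

famCast : ∀ {x c} {X : Set x} {C : Set c} (Δs : C → List X) {i j : C} → i ≡ j → Reindex (Δs i) (Δs j)
famCast Δs e = castR (cong Δs e)

module _ {a : Level} {A : Set a} where

  wkˡ-injective : ∀ {Γ Δ : List A} {x} {p q : Γ ∋ x} → wkˡ {ys = Δ} p ≡ wkˡ q → p ≡ q
  wkˡ-injective {Γ} {Δ} {p = p} {q} e with trans (sym (split-wkˡ {ys = Δ} p)) (trans (cong (split Γ) e) (split-wkˡ q))
  ... | refl = refl

  wkˡ≢wkʳ : ∀ {Γ Δ : List A} {x} {p : Γ ∋ x} {q : Δ ∋ x} {b} {B : Set b} → wkˡ p ≡ wkʳ Γ q → B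
  wkˡ≢wkʳ {Γ} {Δ} {p = p} {q} e with trans (sym (split-wkˡ {ys = Δ} p)) (trans (cong (split Γ) e) (split-wkʳ Γ q))
  ... | ()

  wkʳ-injective : ∀ (Γ : List A) {Δ : List A} {x} {p q : Δ ∋ x} → wkʳ Γ p ≡ wkʳ Γ q → p ≡ q
  wkʳ-injective Γ {p = p} {q} e with trans (sym (split-wkʳ Γ p)) (trans (cong (split Γ) e) (split-wkʳ Γ q))
  ... | refl = refl

  module _ {Γ Θ : List A} (as : List A) (θ : ∀ {x} → Θ ∋ x → Γ ∋ x) where

    liftP≡wkˡ : ∀ {x} (r : (Θ ++ as) ∋ x) {p : Γ ∋ x} → liftP as θ r ≡ wkˡ p → Σ (Θ ∋ x) (λ q → wkˡ q ≡ r × θ q ≡ p)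
    liftP≡wkˡ = split-elim Θ _
      (λ q e → q , refl , wkˡ-injective (trans (sym (liftP-wkˡ as θ q)) e))
      (λ q e → wkˡ≢wkʳ (sym (trans (sym (liftP-wkʳ as θ q)) e)))

    liftP≡wkʳ : ∀ {x} (r : (Θ ++ as) ∋ x) {p : as ∋ x} → liftP as θ r ≡ wkʳ Γ p → r ≡ wkʳ Θ p
    liftP≡wkʳ = split-elim Θ _
      (λ q e → wkˡ≢wkʳ (trans (sym (liftP-wkˡ as θ q)) e))
      (λ q e → cong (wkʳ Θ) (wkʳ-injective Γ (trans (sym (liftP-wkʳ as θ q)) e)))

  -- Free and bound variables land in disjoint parts of `Γ ++ as`, so a permutation compatible with
  -- the lifted embeddings cannot mix them, and it fixes the bound ones because `wkʳ Γ` is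
  -- injective. This lets a comparison of two bodies descend to the abstraction.
  unliftR : ∀ {Γ Θ Θ' : List A} (as : List A) (θ : ∀ {x} → Θ ∋ x → Γ ∋ x) (θ' : ∀ {x} → Θ' ∋ x → Γ ∋ x)
            (ρ : Reindex (Θ ++ as) (Θ' ++ as)) → (∀ {x} (q : (Θ ++ as) ∋ x) → liftP as θ' (from ρ q) ≡ liftP as θ q) →
            Σ (Reindex Θ Θ') (λ ρ₀ → (∀ {x} (q : Θ ∋ x) → θ' (from ρ₀ q) ≡ θ q) × (ρ ≐ liftReindex as ρ₀))
  unliftR {Γ} {Θ} {Θ'} as θ θ' ρ over =
      record { to = λ q → proj₁ (bwd q) ; from = λ q → proj₁ (fwd q)
             ; to-from = λ q → wkˡ-injective (trans (proj₁ (proj₂ (bwd _))) (trans (cong (to ρ) (proj₁ (proj₂ (fwd q)))) (to-from ρ _)))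
             ; from-to = λ q → wkˡ-injective (trans (proj₁ (proj₂ (fwd _))) (trans (cong (from ρ) (proj₁ (proj₂ (bwd q)))) (from-to ρ _))) }
    , (λ q → proj₂ (proj₂ (fwd q)))
    , split-elim Θ _
        (λ q → trans (sym (proj₁ (proj₂ (fwd q)))) (sym (liftP-wkˡ as (λ q → proj₁ (fwd q)) q)))
        (λ q → trans (liftP≡wkʳ as θ' (from ρ (wkʳ Θ q)) (trans (over (wkʳ Θ q)) (liftP-wkʳ as θ q)))
                     (sym (liftP-wkʳ as (λ q → proj₁ (fwd q)) q)))
    where
    fwd : ∀ {x} (q : Θ ∋ x) → Σ (Θ' ∋ x) (λ q' → wkˡ q' ≡ from ρ (wkˡ q) × θ' q' ≡ θ q)
    fwd q = liftP≡wkˡ as θ' (from ρ (wkˡ q)) (trans (over (wkˡ q)) (liftP-wkˡ as θ q))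
    bwd : ∀ {x} (q : Θ' ∋ x) → Σ (Θ ∋ x) (λ q' → wkˡ q' ≡ to ρ (wkˡ q) × θ q' ≡ θ' q)
    bwd q = liftP≡wkˡ as θ (to ρ (wkˡ q)) (trans (sym (over (to ρ (wkˡ q))))
              (trans (cong (liftP as θ') (from-to ρ (wkˡ q))) (liftP-wkˡ as θ' q)))

  liftP-cong : ∀ {Γ Θ Θ' : List A} (as : List A) {θ : ∀ {x} → Θ ∋ x → Γ ∋ x} {θ' : ∀ {x} → Θ' ∋ x → Γ ∋ x}
               (φ : ∀ {x} → Θ ∋ x → Θ' ∋ x) → (∀ {x} (q : Θ ∋ x) → θ' (φ q) ≡ θ q) →
               ∀ {x} (q : (Θ ++ as) ∋ x) → liftP as θ' (liftP as φ q) ≡ liftP as θ q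
  liftP-cong {Θ = Θ} as {θ} {θ'} φ e = split-elim Θ _
    (λ q → trans (cong (liftP as θ') (liftP-wkˡ as φ q)) (trans (liftP-wkˡ as θ' (φ q)) (trans (cong wkˡ (e q)) (sym (liftP-wkˡ as θ q)))))
    (λ q → trans (cong (liftP as θ') (liftP-wkʳ as φ q)) (trans (liftP-wkʳ as θ' q) (sym (liftP-wkʳ as θ q))))

-- Uncurrying against permutation and composition

module ModelLaws {ℓ m e : Level} (L : ClosedSignature ℓ) (M : ClosedModel L m e) where
  open ClosedSignature L
  open ClosedModel M

  uncurry-act : ∀ {Γ Δ as b} {h : Hom Γ (as ⊸ b)} {h' : Hom Δ (as ⊸ b)} (ρ : Reindex Γ Δ) → h' ≈ act h ρ →
                uncurry h' ≈ act (uncurry h) (liftReindex as ρ)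
  uncurry-act {Γ} {Δ} {as} {b} {h} {h'} ρ eq =
    ≈-trans (act-cong _ (comp-act {Γs = evCtx Γ} {evCtx Δ} {evHom h} {evHom h'} κ ≈-refl κ-eq))
      (≈-trans (act-⨾ _ _ _) (≈-trans (act-≐ _ (block-elim {bs = (as ⊸ b) ∷ as} {evCtx Γ} _ coh)) (≈-sym (act-⨾ _ _ _))))
    where
    κ : ∀ {c} (p : ((as ⊸ b) ∷ as) ∋ c) → Reindex (evCtx Γ p) (evCtx Δ p)
    κ here      = ρ
    κ (there p) = idR
    κ-eq : ∀ {c} (p : ((as ⊸ b) ∷ as) ∋ c) → evHom h' p ≈ act (evHom h p) (κ p)
    κ-eq here      = eq
    κ-eq (there p) = ≈-sym (act-id id)
    coh : ∀ {c y} (p : ((as ⊸ b) ∷ as) ∋ c) (q : evCtx Γ p ∋ y) →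
          from (evR Δ {as ⊸ b} as) (from (⊕R {bs = (as ⊸ b) ∷ as} {evCtx Γ} {evCtx Δ} κ) (inj {Γs = evCtx Γ} p q))
          ≡ liftP as (from ρ) (from (evR Γ {as ⊸ b} as) (inj {Γs = evCtx Γ} p q))
    coh here q = trans (cong (from (evR Δ {as ⊸ b} as)) (⊕R-inj {bs = (as ⊸ b) ∷ as} {evCtx Γ} {evCtx Δ} κ here q))
      (trans (evR-here Δ {as ⊸ b} as (from ρ q))
        (sym (trans (cong (liftP as (from ρ)) (evR-here Γ {as ⊸ b} as q)) (liftP-wkˡ as (from ρ) q))))
    coh (there p) here = trans (cong (from (evR Δ {as ⊸ b} as)) (⊕R-inj {bs = (as ⊸ b) ∷ as} {evCtx Γ} {evCtx Δ} κ (there p) here))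
      (trans (evR-there Δ {as ⊸ b} as p)
        (sym (trans (cong (liftP as (from ρ)) (evR-there Γ {as ⊸ b} as p)) (liftP-wkʳ as (from ρ) p))))
    coh (there p) (there ())

  uncurry-cong : ∀ {Γ as b} {h h' : Hom Γ (as ⊸ b)} → h ≈ h' → uncurry h ≈ uncurry h'
  uncurry-cong {Γ} {as} {b} eq = act-cong _ (comp-cong {Γs = evCtx Γ} ≈-refl λ { here → eq ; (there p) → ≈-refl })

  unit-single : ∀ {a Ω} {Γs : Fam (a ∷ [])} (gs : ∀ {b} (p : (a ∷ []) ∋ b) → Hom (Γs p) b) (κ : Reindex (Γs here) Ω) →
                act (comp id Γs gs) (castR (++-identityʳ (Γs here)) ⨾R κ) ≈ act (gs here) κ
  unit-single {Γs = Γs} gs κ = ≈-trans (act-cong _ (comp-cong {Γs = Γs} (≈-sym (act-id id)) (λ _ → ≈-refl)))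
    (unitˡ idR {Γs} gs _ κ (λ r → cong (from κ) (sym (++-identityʳ-wkˡ (Γs here) r))))

  -- Associativity at `ev`, with the outer arguments indexed by whether a variable is free or bound
  -- and `ι` recording where their inputs end up. It serves substitution under an abstraction, where
  -- bound variables receive identities, as well as β, where they receive the arguments and the free
  -- variables receive identities.
  uncurry-comp : ∀ {Γ as b Ω} (h : Hom Γ (as ⊸ b))
    (Δs : ∀ {c} → Γ ∋ c ⊎ as ∋ c → List (Ty Atom)) (hs : ∀ {c} (i : Γ ∋ c ⊎ as ∋ c) → Hom (Δs i) c)
    (R : Reindex (concatF (Γ ++ as) (λ p → Δs (split Γ p))) Ω)
    (ι : ∀ {c} (i : Γ ∋ c ⊎ as ∋ c) {y} → Δs i ∋ y → Ω ∋ y) →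
    (∀ {c} (p : (Γ ++ as) ∋ c) {y} (r : Δs (split Γ p) ∋ y) → from R (inj {Γs = λ p → Δs (split Γ p)} p r) ≡ ι (split Γ p) r) →
    {Λs : Fam ((as ⊸ b) ∷ as)} (ks : ∀ {c} (p : ((as ⊸ b) ∷ as) ∋ c) → Hom (Λs p) c)
    (Rh : Reindex (concatF Γ (λ q → Δs (inj₁ q))) (Λs here)) →
    ks here ≈ act (comp h (λ q → Δs (inj₁ q)) (λ q → hs (inj₁ q))) Rh →
    (κ : ∀ {c} (p : as ∋ c) → Reindex (Δs (inj₂ p)) (Λs (there p))) →
    (∀ {c} (p : as ∋ c) → ks (there p) ≈ act (hs (inj₂ p)) (κ p)) →
    (R' : Reindex (concatF ((as ⊸ b) ∷ as) Λs) Ω) →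
    (∀ {c} (q : Γ ∋ c) {y} (r : Δs (inj₁ q) ∋ y) →
      from R' (inj {Γs = Λs} here (from Rh (inj {Γs = λ q → Δs (inj₁ q)} q r))) ≡ ι (inj₁ q) r) →
    (∀ {c} (p : as ∋ c) {y} (r : Δs (inj₂ p) ∋ y) → from R' (inj {Γs = Λs} (there p) (from (κ p) r)) ≡ ι (inj₂ p) r) →
    act (comp (uncurry h) (λ p → Δs (split Γ p)) (λ p → hs (split Γ p))) R ≈ act (comp ev Λs ks) R'
  uncurry-comp {Γ} {as} {b} h Δs hs R ι R-ι {Λs} ks Rh kh κ kt R' coh-here coh-there =
    assoc ev {evCtx Γ} (evHom {Γ} h) (evR Γ {as ⊸ b} as) {λ p → Δs (split Γ p)} (λ p → hs (split Γ p)) R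
      {Δs'} hs' κ' κ'-eq {Λs} ks Rs ks-eq R' coh
    where
    ev-pos : ∀ {c} (p : ((as ⊸ b) ∷ as) ∋ c) {x} → evCtx Γ p ∋ x → (Γ ++ as) ∋ x
    ev-pos p q = from (evR Γ {as ⊸ b} as) (inj {Γs = evCtx Γ} p q)
    ix : ∀ {c} (p : ((as ⊸ b) ∷ as) ∋ c) {x} (q : evCtx Γ p ∋ x) → Γ ∋ x ⊎ as ∋ x
    ix here q = inj₁ q
    ix (there p) here = inj₂ p
    ix (there p) (there ())
    ix-eq : ∀ {c} (p : ((as ⊸ b) ∷ as) ∋ c) {x} (q : evCtx Γ p ∋ x) → split Γ (ev-pos p q) ≡ ix p q
    ix-eq here q = trans (cong (split Γ) (evR-here Γ {as ⊸ b} as q)) (split-wkˡ q)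
    ix-eq (there p) here = trans (cong (split Γ) (evR-there Γ {as ⊸ b} as p)) (split-wkʳ Γ p)
    ix-eq (there p) (there ())
    Δs' : ∀ {c} (p : ((as ⊸ b) ∷ as) ∋ c) → Fam (evCtx Γ p)
    Δs' p q = Δs (ix p q)
    hs' : ∀ {c} (p : ((as ⊸ b) ∷ as) ∋ c) {x} (q : evCtx Γ p ∋ x) → Hom (Δs' p q) x
    hs' p q = hs (ix p q)
    κ' : ∀ {c} (p : ((as ⊸ b) ∷ as) ∋ c) {x} (q : evCtx Γ p ∋ x) → Reindex (Δs (split Γ (ev-pos p q))) (Δs' p q)
    κ' p q = famCast Δs (ix-eq p q)
    κ'-eq : ∀ {c} (p : ((as ⊸ b) ∷ as) ∋ c) {x} (q : evCtx Γ p ∋ x) → hs' p q ≈ act (hs (split Γ (ev-pos p q))) (κ' p q)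
    κ'-eq p q = go (ix-eq p q)
      where
      go : ∀ {x} {i j : Γ ∋ x ⊎ as ∋ x} (eq : i ≡ j) → hs j ≈ act (hs i) (famCast Δs eq)
      go refl = ≈-sym (act-id _)
    Rs : ∀ {c} (p : ((as ⊸ b) ∷ as) ∋ c) → Reindex (concatF (evCtx Γ p) (Δs' p)) (Λs p)
    -- The head collects all arguments for the free variables; each bound variable comes from an
    -- identity of the uncurrying and collects a single argument, whence the left unit law in
    -- `ks-eq`.
    Rs here = Rh
    Rs (there p) = castR (++-identityʳ _) ⨾R κ p
    ks-eq : ∀ {c} (p : ((as ⊸ b) ∷ as) ∋ c) → ks p ≈ act (comp (evHom h p) (Δs' p) (hs' p)) (Rs p)
    ks-eq here = kh
    ks-eq (there p) = ≈-trans (kt p) (≈-sym (unit-single {Γs = Δs' (there p)} (hs' (there p)) (κ p)))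
    at-ix : ∀ {c} (p : ((as ⊸ b) ∷ as) ∋ c) {x} (q : evCtx Γ p ∋ x) {y} (r : Δs (ix p q) ∋ y) →
            from R' (inj {Γs = Λs} p (from (Rs p) (inj {Γs = Δs' p} q r))) ≡ ι (ix p q) r
    at-ix here q r = coh-here q r
    at-ix (there p) here r = trans (cong (λ t → from R' (inj {Γs = Λs} (there p) (from (κ p) t))) (++-identityʳ-wkˡ _ r)) (coh-there p r)
    at-ix (there p) (there ()) r
    ι-cast : ∀ {x} {i j : Γ ∋ x ⊎ as ∋ x} (eq : i ≡ j) {y} (r : Δs i ∋ y) → ι j (from (famCast Δs eq) r) ≡ ι i r
    ι-cast refl r = refl
    coh : ∀ {c} (p : ((as ⊸ b) ∷ as) ∋ c) {x} (q : evCtx Γ p ∋ x) {y} (r : Δs (split Γ (ev-pos p q)) ∋ y) →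
          from R' (inj {Γs = Λs} p (from (Rs p) (inj {Γs = Δs' p} q (from (κ' p q) r))))
          ≡ from R (inj {Γs = λ p → Δs (split Γ p)} (ev-pos p q) r)
    coh p q r = trans (at-ix p q (from (κ' p q) r)) (trans (ι-cast (ix-eq p q) r) (sym (R-ι (ev-pos p q) r)))

-- Denotations of terms

lookupAll-tabAll : ∀ {a p} {A : Set a} {P : A → Set p} {xs : List A} (f : ∀ {x} → xs ∋ x → P x) {x} (q : xs ∋ x) →
                   lookupAll (tabAll f) q ≡ f q
lookupAll-tabAll f here = refl
lookupAll-tabAll f (there q) = lookupAll-tabAll (λ r → f (there r)) q

module TermLists {ℓ : Level} (L : ClosedSignature ℓ) where
  open Syntax L

  lookupAll-renames : ∀ {Γ Δ as} (ρ : Ren Γ Δ) (ts : All (Tm Γ) as) {a} (p : as ∋ a) →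
                      lookupAll (renames ρ ts) p ≡ rename ρ (lookupAll ts p)
  lookupAll-renames ρ (t ∷ ts) here = refl
  lookupAll-renames ρ (t ∷ ts) (there p) = lookupAll-renames ρ ts p

  lookupAll-subs : ∀ {Γ Δ as} (σ : Sub Γ Δ) (ts : All (Tm Γ) as) {a} (p : as ∋ a) →
                   lookupAll (subs σ ts) p ≡ sub σ (lookupAll ts p)
  lookupAll-subs σ (t ∷ ts) here = refl
  lookupAll-subs σ (t ∷ ts) (there p) = lookupAll-subs σ ts p

module Denotation {ℓ m e : Level} (L : ClosedSignature ℓ) (M : ClosedModel L m e) where
  open ClosedSignature L
  open ClosedModel M
  open ModelLaws L M
  open Syntax L
  open TermLists L

  -- Den θ s h : the term s uses exactly the variables in the image of θ, linearly, and h is its denotation.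
  data Den {Θ Γ : List Type} (θ : Ren Θ Γ) : ∀ {a} → Tm Γ a → Hom Θ a → Set (ℓ ⊔ m ⊔ e)
  -- Application and multiarrows are one kind of node: an application is the multimorphism `ev` fed
  -- with the function followed by its arguments.
  record Node {Θ Γ as : List Type} {b : Type} (θ : Ren Θ Γ) (f : Hom as b) (ts : All (Tm Γ) as) (h : Hom Θ b) : Set (ℓ ⊔ m ⊔ e)

  data Den {Θ} {Γ} θ where
    den-var : ∀ {a} {p : Γ ∋ a} {h} (R : Reindex (a ∷ []) Θ) → θ (from R here) ≡ p → h ≈ act id R → Den θ (var p) h
    -- The morphism `h` is constrained through its uncurrying instead of being a chosen `curry`, so
    -- no law of `curry` is needed to permute or substitute.
    den-lam : ∀ {as b} {s : Tm (Γ ++ as) b} {h : Hom Θ (as ⊸ b)} →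
              Den (liftR as θ) s (uncurry {Θ} h) → Den θ (lam as s) h
    den-app : ∀ {as b} {s : Tm Γ (as ⊸ b)} {ts : All (Tm Γ) as} {h} → Node θ ev (s ∷ ts) h → Den θ (app s ts) h
    den-fun : ∀ {as b} {f : Arr as b} {ts : All (Tm Γ) as} {h} → Node θ (arr f) ts h → Den θ (fun f ts) h

  record Node {Θ} {Γ} {as} {b} θ f ts h where
    inductive
    constructor node
    field
      ctxs  : Fam as
      homs  : ∀ {c} (p : as ∋ c) → Hom (ctxs p) c
      cover : Reindex (concatF as ctxs) Θ
      dens  : ∀ {c} (p : as ∋ c) → Den (λ q → θ (from cover (inj {Γs = ctxs} p q))) (lookupAll ts p) (homs p)
      value : h ≈ act (comp f ctxs homs) cover

  den-act : ∀ {Θ Θ' Γ a} {θ : Ren Θ Γ} {θ' : Ren Θ' Γ} {s : Tm Γ a} {h h'} (ρ : Reindex Θ Θ') →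
            (∀ {x} (q : Θ ∋ x) → θ' (from ρ q) ≡ θ q) → h' ≈ act h ρ → Den θ s h → Den θ' s h'
  node-act : ∀ {Θ Θ' Γ as b} {θ : Ren Θ Γ} {θ' : Ren Θ' Γ} {f : Hom as b} {ts : All (Tm Γ) as} {h h'} (ρ : Reindex Θ Θ') →
             (∀ {x} (q : Θ ∋ x) → θ' (from ρ q) ≡ θ q) → h' ≈ act h ρ → Node θ f ts h → Node θ' f ts h'
  den-act ρ over eq (den-var R at v) =
    den-var (R ⨾R ρ) (trans (over _) at) (≈-trans eq (≈-trans (act-cong ρ v) (act-⨾ _ _ _)))
  den-act ρ over eq (den-lam {as} d) =
    den-lam (den-act (liftReindex as ρ) (liftP-cong as (from ρ) over) (uncurry-act ρ eq) d)
  den-act ρ over eq (den-app n) = den-app (node-act ρ over eq n)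
  den-act ρ over eq (den-fun n) = den-fun (node-act ρ over eq n)
  node-act ρ over eq (node Γs gs R ds v) =
    node Γs gs (R ⨾R ρ) (λ p → den-act idR (λ q → over _) (≈-sym (act-id _)) (ds p))
         (≈-trans eq (≈-trans (act-cong ρ v) (act-⨾ _ _ _)))

  den-≗ : ∀ {Θ Γ a} {θ θ' : Ren Θ Γ} {s : Tm Γ a} {h} → (∀ {x} (q : Θ ∋ x) → θ' q ≡ θ q) → Den θ s h → Den θ' s h
  den-≗ e = den-act idR e (≈-sym (act-id _))

  den-≈ : ∀ {Θ Γ a} {θ : Ren Θ Γ} {s : Tm Γ a} {h h'} → h' ≈ h → Den θ s h → Den θ s h'
  den-≈ e = den-act idR (λ _ → refl) (≈-trans e (≈-sym (act-id _)))

  -- The denotation lives over `Θ`, so renaming the ambient context changes only the way `Θ` is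
  -- mapped into it.
  den-rename : ∀ {Θ Γ Δ a} {θ : Ren Θ Γ} {θ' : Ren Θ Δ} {s : Tm Γ a} {h} (κ : Ren Γ Δ) →
               (∀ {x} (q : Θ ∋ x) → θ' q ≡ κ (θ q)) → Den θ s h → Den θ' (rename κ s) h
  node-rename : ∀ {Θ Γ Δ as b} {θ : Ren Θ Γ} {θ' : Ren Θ Δ} {f : Hom as b} {ts : All (Tm Γ) as} {h} (κ : Ren Γ Δ) →
                (∀ {x} (q : Θ ∋ x) → θ' q ≡ κ (θ q)) → Node θ f ts h → Node θ' f (renames κ ts) h
  den-rename κ over (den-var R at v) = den-var R (trans (over _) (cong κ at)) v
  den-rename {θ = θ} κ over (den-lam {as} d) =
    den-lam (den-rename (liftR as κ) (λ q → sym (liftP-cong as θ (λ q → sym (over q)) q)) d)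
  den-rename κ over (den-app n) = den-app (node-rename κ over n)
  den-rename κ over (den-fun n) = den-fun (node-rename κ over n)
  node-rename {ts = ts} κ over (node Γs gs R ds v) =
    node Γs gs R (λ p → subst (λ t → Den _ t (gs p)) (sym (lookupAll-renames κ ts p)) (den-rename κ (λ q → over _) (ds p))) v

  -- A term determines the contexts of its subterms only up to permutation, hence so are denotations compared.
  record Comparison {Θ Θ' Γ a} (θ : Ren Θ Γ) (θ' : Ren Θ' Γ) (h : Hom Θ a) (h' : Hom Θ' a) : Set (ℓ ⊔ m ⊔ e) where
    constructor comparison
    field
      reindex : Reindex Θ Θ'
      over    : ∀ {x} (q : Θ ∋ x) → θ' (from reindex q) ≡ θ q
      agree   : h' ≈ act h reindex
  open Comparison

  den-compare : ∀ {Θ Θ' Γ a} {θ : Ren Θ Γ} {θ' : Ren Θ' Γ} {s : Tm Γ a} {h h'} →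
                Den θ s h → Den θ' s h' → Comparison θ θ' h h'
  node-compare : ∀ {Θ Θ' Γ as b} {θ : Ren Θ Γ} {θ' : Ren Θ' Γ} {f : Hom as b} {ts : All (Tm Γ) as} {h h'} →
                 Node θ f ts h → Node θ' f ts h' → Comparison θ θ' h h'
  den-compare {θ = θ} {θ'} (den-var {a} R at v) (den-var R' at' v') = comparison (symR R ⨾R R')
    (λ q → trans (go (to R q)) (cong θ (from-to R q)))
    (≈-trans v' (≈-sym (≈-trans (act-cong _ v) (≈-trans (act-⨾ _ _ _) (act-≐ id (λ q → cong (from R') (to-from R q)))))))
    where
    go : ∀ {x} (p : (a ∷ []) ∋ x) → θ' (from R' p) ≡ θ (from R p)
    go here = trans at' (sym at)
  den-compare {θ = θ} {θ'} {h = h} {h'} (den-lam {as} d) (den-lam d') with den-compare d d'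
  ... | comparison ρ⁺ over⁺ agree⁺ with unliftR as θ θ' ρ⁺ over⁺
  ...   | ρ , over , ρ⁺≐ = comparison ρ over
          (uncurry-injective (≈-trans agree⁺ (≈-trans (act-≐ _ ρ⁺≐) (≈-sym (uncurry-act ρ ≈-refl)))))
  den-compare (den-app n) (den-app n') = node-compare n n'
  den-compare (den-fun n) (den-fun n') = node-compare n n'
  node-compare {as = as} {θ = θ} {θ'} {f} {h = h} {h'} (node Γs gs R ds v) (node Γs' gs' R' ds' v') =
    comparison (symR R ⨾R (⊕ρ ⨾R R'))
      (λ q → trans (block-elim {bs = as} {Γs} (λ r → θ' (from R' (from ⊕ρ r)) ≡ θ (from R r))
                (λ p r → trans (cong (λ t → θ' (from R' t)) (⊕R-inj {bs = as} {Γs} {Γs'} (λ p → reindex (cs p)) p r))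
                           (over (cs p) r)) (to R q))
              (cong θ (from-to R q)))
      (≈-trans v' (≈-trans (act-cong R' (comp-act {Γs = Γs} {Γs'} (λ p → reindex (cs p)) ≈-refl (λ p → agree (cs p))))
        (≈-trans (act-⨾ _ _ _)
          (≈-sym (≈-trans (act-cong _ v) (≈-trans (act-⨾ _ _ _) (act-≐ _ (λ q → cong (λ t → from R' (from ⊕ρ t)) (to-from R q)))))))))
    where
    cs : ∀ {c} (p : as ∋ c) → Comparison (λ q → θ (from R (inj {Γs = Γs} p q))) (λ q → θ' (from R' (inj {Γs = Γs'} p q))) (gs p) (gs' p)
    cs p = den-compare (ds p) (ds' p)
    ⊕ρ : Reindex (concatF as Γs) (concatF as Γs')
    ⊕ρ = ⊕R {bs = as} {Γs} {Γs'} (λ p → reindex (cs p))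

  -- With both embeddings the identity, `over` states that the comparing permutation fixes every
  -- position.
  den-unique : ∀ {Γ a} {s : Tm Γ a} {h h'} → Den (λ q → q) s h → Den (λ q → q) s h' → h' ≈ h
  den-unique d d' with den-compare d d'
  ... | comparison ρ over agree = ≈-trans agree (≈-trans (act-≐ _ over) (act-id _))

  -- Substitution into denotations

  module _ {as Γ Ω : List Type} (Δs : Fam {X = Type} Γ) (R : Reindex (concatF Γ Δs) Ω) where

    -- The contexts of a substitution lifted under a binder: a free variable keeps the context
    -- substituted for it, a bound one is replaced by itself.
    extCtx : ∀ {c} → Γ ∋ c ⊎ as ∋ c → List Type
    extCtx (inj₁ q)     = Δs q
    extCtx {c} (inj₂ q) = c ∷ []

    extPos : ∀ {c} (i : Γ ∋ c ⊎ as ∋ c) {y} → extCtx i ∋ y → (Ω ++ as) ∋ y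
    extPos (inj₁ q) r    = wkˡ (from R (inj {Γs = Δs} q r))
    extPos (inj₂ q) here = wkʳ Ω q

    private
      locateBlock : ∀ {y} → Block Γ Δs y → Σ Type (λ c → Σ (Γ ∋ c ⊎ as ∋ c) (λ i → extCtx i ∋ y))
      locateBlock (block q t) = _ , inj₁ q , t

      locate : ∀ {y} → Ω ∋ y ⊎ as ∋ y → Σ Type (λ c → Σ (Γ ∋ c ⊎ as ∋ c) (λ i → extCtx i ∋ y))
      locate (inj₁ r) = locateBlock (prj (to R r))
      locate (inj₂ q) = _ , inj₂ q , here

      extPos-block : ∀ {y} (β : Block Γ Δs y) →
                     extPos (proj₁ (proj₂ (locateBlock β))) (proj₂ (proj₂ (locateBlock β))) ≡ wkˡ (from R (unblock β))
      extPos-block (block q t) = refl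

      extPos-locate : ∀ {y} (s : Ω ∋ y ⊎ as ∋ y) →
                      extPos (proj₁ (proj₂ (locate s))) (proj₂ (proj₂ (locate s))) ≡ unsplit Ω s
      extPos-locate (inj₁ r) = trans (extPos-block (prj (to R r)))
        (cong wkˡ (trans (cong (from R) (inj-prj {bs = Γ} {Δs} (to R r))) (from-to R r)))
      extPos-locate (inj₂ q) = refl

      locate-extPos : ∀ {c} (i : Γ ∋ c ⊎ as ∋ c) {y} (r : extCtx i ∋ y) → locate (split Ω (extPos i r)) ≡ (c , i , r)
      locate-extPos (inj₁ q) r = trans (cong locate (split-wkˡ (from R (inj {Γs = Δs} q r))))
        (cong locateBlock (trans (cong prj (to-from R (inj {Γs = Δs} q r))) (prj-inj {bs = Γ} {Δs} q r)))
      locate-extPos (inj₂ q) here = cong locate (split-wkʳ Ω q)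

    extR : Reindex (concatF (Γ ++ as) (λ p → extCtx (split Γ p))) (Ω ++ as)
    extR = namedR (split Γ) (unsplit Γ) (split-unsplit Γ) (unsplit-split Γ) extCtx extPos
      (λ r → locate (split Ω r)) (λ r → trans (extPos-locate (split Ω r)) (unsplit-split Ω r)) locate-extPos

    extR-inj : ∀ {c} (p : (Γ ++ as) ∋ c) {y} (r : extCtx (split Γ p) ∋ y) →
               from extR (inj {Γs = λ p → extCtx (split Γ p)} p r) ≡ extPos (split Γ p) r
    extR-inj p r = namedR-inj (split Γ) (unsplit Γ) (split-unsplit Γ) (unsplit-split Γ) extCtx extPos
      (λ r → locate (split Ω r)) (λ r → trans (extPos-locate (split Ω r)) (unsplit-split Ω r)) locate-extPos p r

    extHom : (∀ {c} (q : Γ ∋ c) → Hom (Δs q) c) → ∀ {c} (i : Γ ∋ c ⊎ as ∋ c) → Hom (extCtx i) c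
    extHom hs (inj₁ q) = hs q
    extHom hs (inj₂ q) = id

  -- Denotations are asked of `σ` only at the variables that `s` uses, which is what makes the
  -- statement inductive for linear subterms. Each case is one law: `unitˡ` for a variable,
  -- `uncurry-comp` for an abstraction, `assoc` for a node.
  den-sub : ∀ {Θ Γ Δ Ω a} {θ : Ren Θ Γ} {s : Tm Γ a} {h : Hom Θ a} (σ : Sub Γ Δ)
            {Δs : Fam {X = Type} Θ} {hs : ∀ {c} (p : Θ ∋ c) → Hom (Δs p) c} {κ : ∀ {c} (p : Θ ∋ c) → Ren (Δs p) Δ}
            (es : ∀ {c} (p : Θ ∋ c) → Den (κ p) (σ (θ p)) (hs p))
            (R : Reindex (concatF Θ Δs) Ω) {K : Ren Ω Δ} →
            (∀ {c} (p : Θ ∋ c) {y} (r : Δs p ∋ y) → K (from R (inj {Γs = Δs} p r)) ≡ κ p r) →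
            {k : Hom Ω a} → k ≈ act (comp h Δs hs) R → Den θ s h → Den K (sub σ s) k
  node-sub : ∀ {Θ Γ Δ Ω as b} {θ : Ren Θ Γ} {f : Hom as b} {ts : All (Tm Γ) as} {h : Hom Θ b} (σ : Sub Γ Δ)
            {Δs : Fam {X = Type} Θ} {hs : ∀ {c} (p : Θ ∋ c) → Hom (Δs p) c} {κ : ∀ {c} (p : Θ ∋ c) → Ren (Δs p) Δ}
            (es : ∀ {c} (p : Θ ∋ c) → Den (κ p) (σ (θ p)) (hs p))
            (R : Reindex (concatF Θ Δs) Ω) {K : Ren Ω Δ} →
            (∀ {c} (p : Θ ∋ c) {y} (r : Δs p ∋ y) → K (from R (inj {Γs = Δs} p r)) ≡ κ p r) →
            {k : Hom Ω b} → k ≈ act (comp h Δs hs) R → Node θ f ts h → Node K f (subs σ ts) k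
  den-sub σ {Δs} {hs} es R {K} over eq (den-var R₀ refl v) =
    den-act (headR R₀ Δs ⨾R R) (λ r → trans (cong (λ t → K (from R t)) (headR-from R₀ Δs r)) (over (from R₀ here) r))
      (≈-trans eq (≈-trans (act-cong R (comp-cong {Γs = Δs} v (λ _ → ≈-refl)))
        (unitˡ R₀ {Δs} hs R (headR R₀ Δs ⨾R R) (λ r → cong (from R) (headR-from R₀ Δs r)))))
      (es (from R₀ here))
  den-sub {Θ} {Γ} {Δ} {Ω} {θ = θ} {h = h} σ {Δs} {hs} {κ} es R {K} over {k} eq (den-lam {as} {b} d) = den-lam
    (den-sub (liftS as σ) {λ p → Δs⁺ (split Θ p)} {λ p → hs⁺ (split Θ p)} {λ p → κ⁺ (split Θ p)} (λ p → es⁺ (split Θ p))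
      (extR {as} Δs R) {liftR as K}
      (λ p r → trans (cong (liftR as K) (extR-inj {as} Δs R p r)) (over⁺ (split Θ p) r))
      (≈-trans (uncurry-cong {h = k} eq) (≈-sym (uncurry-comp h Δs⁺ hs⁺ (extR {as} Δs R) (extPos {as} Δs R) (extR-inj {as} Δs R)
        {evCtx Ω} (evHom {Ω} (act (comp h Δs hs) R)) R ≈-refl (λ _ → idR) (λ _ → ≈-sym (act-id id))
        (evR Ω {as ⊸ b} as) (λ q r → evR-here Ω {as ⊸ b} as _) (λ { p here → evR-there Ω {as ⊸ b} as p ; p (there ()) }))))
      d)
    where
    Δs⁺ : ∀ {c} → Θ ∋ c ⊎ as ∋ c → List Type
    Δs⁺ = extCtx {as} Δs R
    hs⁺ : ∀ {c} (i : Θ ∋ c ⊎ as ∋ c) → Hom (Δs⁺ i) c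
    hs⁺ = extHom {as} Δs R hs
    κ⁺ : ∀ {c} (i : Θ ∋ c ⊎ as ∋ c) → Ren (Δs⁺ i) (Δ ++ as)
    κ⁺ (inj₁ q) r = wkˡ (κ q r)
    κ⁺ (inj₂ q) here = wkʳ Δ q
    es⁺ : ∀ {c} (i : Θ ∋ c ⊎ as ∋ c) → Den (κ⁺ i) (liftS as σ ([ (λ q → wkˡ (θ q)) , wkʳ Γ ]′ i)) (hs⁺ i)
    es⁺ (inj₁ q) = subst (λ t → Den (κ⁺ (inj₁ q)) t (hs q))
      (cong [ (λ q → rename wkˡ (σ q)) , (λ q → var (wkʳ Δ q)) ]′ (sym (split-wkˡ (θ q))))
      (den-rename wkˡ (λ _ → refl) (es q))
    es⁺ (inj₂ q) = subst (λ t → Den (κ⁺ (inj₂ q)) t id)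
      (cong [ (λ q → rename wkˡ (σ q)) , (λ q → var (wkʳ Δ q)) ]′ (sym (split-wkʳ Γ q)))
      (den-var idR refl (≈-sym (act-id id)))
    over⁺ : ∀ {c} (i : Θ ∋ c ⊎ as ∋ c) {y} (r : Δs⁺ i ∋ y) → liftR as K (extPos {as} Δs R i r) ≡ κ⁺ i r
    over⁺ (inj₁ q) r = trans (liftP-wkˡ as K _) (cong wkˡ (over q r))
    over⁺ (inj₂ q) here = liftP-wkʳ as K q
  den-sub σ es R over eq (den-app n) = den-app (node-sub σ es R over eq n)
  den-sub σ es R over eq (den-fun n) = den-fun (node-sub σ es R over eq n)
  node-sub {f = f} {ts} σ {Δs} {hs} es R {K} over eq (node Γs gs R₀ ds v) =
    -- The new context of an argument gathers the contexts substituted for those variables which the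
    -- old cover `R₀` assigns to that argument.
    node (λ p → concatF (Γs p) (λ q → Δs (from R₀ (inj {Γs = Γs} p q))))
      (λ p → comp (gs p) (λ q → Δs (from R₀ (inj {Γs = Γs} p q))) (λ q → hs (from R₀ (inj {Γs = Γs} p q))))
      (assocR {Γs = Γs} {Δs} R₀ R)
      (λ p → subst (λ t → Den _ t _) (sym (lookupAll-subs σ ts p))
        (den-sub σ {λ q → Δs (from R₀ (inj {Γs = Γs} p q))} (λ q → es _) idR
          (λ q r → trans (cong K (assocR-inj {Γs = Γs} {Δs} R₀ R p q r)) (over _ r)) (≈-sym (act-id _)) (ds p)))
      (≈-trans eq (≈-trans (act-cong R (comp-cong {Γs = Δs} v (λ _ → ≈-refl)))
        (assoc f {Γs} gs R₀ {Δs} hs R {λ p q → Δs (from R₀ (inj {Γs = Γs} p q))} (λ p q → hs (from R₀ (inj {Γs = Γs} p q)))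
          (λ _ _ → idR) (λ _ _ → ≈-sym (act-id _)) _ (λ _ → idR) (λ p → ≈-sym (act-id _))
          (assocR {Γs = Γs} {Δs} R₀ R) (λ p q r → assocR-inj {Γs = Γs} {Δs} R₀ R p q r))))

-- Preservation of denotations by β and η

module Soundness {ℓ m e : Level} (L : ClosedSignature ℓ) (M : ClosedModel L m e) where
  open ClosedModel M
  open ModelLaws L M
  open Syntax L
  open Denotation L M

  -- By definition `uncurry h` is `ev` composed with `h` and identities, which is exactly the value
  -- of the node under the new abstraction; hence the closing `≈-refl`.
  den-η : ∀ {Θ Γ as b} {θ : Ren Θ Γ} {s : Tm Γ (as ⊸ b)} {h} → Den θ s h → Den θ (ηexp s) h
  den-η {Θ} {Γ} {as} {b} {θ} {s} {h} d =
    den-lam (den-app (node (evCtx Θ) (evHom {Θ} h) (evR Θ {as ⊸ b} as)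
      (λ { here → den-rename wkˡ (λ q → trans (cong (liftP as θ) (evR-here Θ {as ⊸ b} as q)) (liftP-wkˡ as θ q)) d
         ; (there p) → subst (λ t → Den (λ q → liftR as θ (from (evR Θ {as ⊸ b} as) (inj {Γs = evCtx Θ {as ⊸ b} {as}} (there p) q))) t id)
             (sym (lookupAll-tabAll (λ q → var (wkʳ Γ q)) p))
             (den-var idR (trans (cong (liftP as θ) (evR-there Θ {as ⊸ b} as p)) (liftP-wkʳ as θ p)) (≈-sym (act-id id))) })
      ≈-refl))

  module _ {as Ω : List Type} {c₀ : Type} (Γs : Fam {X = Type} (c₀ ∷ as)) (R : Reindex (concatF (c₀ ∷ as) Γs) Ω) where

    -- The contexts of the substitution performed by β: a free variable of the abstraction stands
    -- for itself, a bound one for its argument. Through `argR` the cover of the redex becomes a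
    -- cover for the contractum.
    argCtx : ∀ {c} → Γs here ∋ c ⊎ as ∋ c → List Type
    argCtx {c} (inj₁ q) = c ∷ []
    argCtx (inj₂ p)     = Γs (there p)

    argPos : ∀ {c} (i : Γs here ∋ c ⊎ as ∋ c) {y} → argCtx i ∋ y → Ω ∋ y
    argPos (inj₁ q) here = from R (inj {Γs = Γs} here q)
    argPos (inj₂ p) r    = from R (inj {Γs = Γs} (there p) r)

    private
      locate : ∀ {y} → Block (c₀ ∷ as) Γs y → Σ Type (λ c → Σ (Γs here ∋ c ⊎ as ∋ c) (λ i → argCtx i ∋ y))
      locate (block here q)      = _ , inj₁ q , here
      locate (block (there p) r) = _ , inj₂ p , r

      argPos-locate : ∀ {y} (β : Block (c₀ ∷ as) Γs y) →
                      argPos (proj₁ (proj₂ (locate β))) (proj₂ (proj₂ (locate β))) ≡ from R (unblock β)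
      argPos-locate (block here q)      = refl
      argPos-locate (block (there p) r) = refl

      locate-argPos : ∀ {c} (i : Γs here ∋ c ⊎ as ∋ c) {y} (r : argCtx i ∋ y) →
                      locate (prj (to R (argPos i r))) ≡ (c , i , r)
      locate-argPos (inj₁ q) here =
        cong locate (trans (cong prj (to-from R (inj {Γs = Γs} here q))) (prj-inj {bs = c₀ ∷ as} {Γs} here q))
      locate-argPos (inj₂ p) r  =
        cong locate (trans (cong prj (to-from R (inj {Γs = Γs} (there p) r))) (prj-inj {bs = c₀ ∷ as} {Γs} (there p) r))

      argPos-locate-to : ∀ {y} (r : Ω ∋ y) → argPos (proj₁ (proj₂ (locate (prj (to R r))))) (proj₂ (proj₂ (locate (prj (to R r))))) ≡ r
      argPos-locate-to r = trans (argPos-locate (prj (to R r)))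
        (trans (cong (from R) (inj-prj {bs = c₀ ∷ as} {Γs} (to R r))) (from-to R r))

    argR : Reindex (concatF (Γs here ++ as) (λ p → argCtx (split (Γs here) p))) Ω
    argR = namedR (split (Γs here)) (unsplit (Γs here)) (split-unsplit (Γs here)) (unsplit-split (Γs here)) argCtx argPos
      (λ r → locate (prj (to R r))) argPos-locate-to locate-argPos

    argR-inj : ∀ {c} (p : (Γs here ++ as) ∋ c) {y} (r : argCtx (split (Γs here) p) ∋ y) →
               from argR (inj {Γs = λ p → argCtx (split (Γs here) p)} p r) ≡ argPos (split (Γs here) p) r
    argR-inj p r = namedR-inj (split (Γs here)) (unsplit (Γs here)) (split-unsplit (Γs here)) (unsplit-split (Γs here)) argCtx argPos
      (λ r → locate (prj (to R r))) argPos-locate-to locate-argPos p r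

  den-β : ∀ {Θ Γ as b} {θ : Ren Θ Γ} {s : Tm (Γ ++ as) b} {ts : All (Tm Γ) as} {h} →
          Den θ (app (lam as s) ts) h → Den θ (sub (βsub ts) s) h
  den-β {Θ} {Γ} {as} {b} {θ} {s} {ts} {h} (den-app (node Γs gs R ds v)) with ds here
  ... | den-lam d = den-sub (βsub ts) {λ p → Δs (split Γ₀ p)} {λ p → hs (split Γ₀ p)} {λ p → κ (split Γ₀ p)} (λ p → es (split Γ₀ p))
      (argR Γs R) (λ p r → trans (cong θ (argR-inj Γs R p r)) (over (split Γ₀ p) r))
      -- Read from right to left: the function `gs here` first has to be presented as its composite
      -- with identities for its free variables, which the right unit law provides.
      (≈-trans v (≈-sym (uncurry-comp (gs here) Δs hs (argR Γs R) (argPos Γs R) (argR-inj Γs R) {Γs} gs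
        (castR (concatF-single Γ₀))
        (≈-sym (≈-trans (unitʳ (gs here) (λ _ → idR) (λ _ → ≈-sym (act-id id)) (castR (concatF-single Γ₀)) idR
          (λ q → sym (single-inj Γ₀ q))) (act-id _)))
        (λ _ → idR) (λ _ → ≈-sym (act-id _)) R
        (λ { q here → cong (λ t → from R (inj {Γs = Γs} here t)) (single-inj Γ₀ q) ; q (there ()) })
        (λ _ _ → refl))))
      d
    where
    Γ₀ : List Type
    Γ₀ = Γs here
    Δs : ∀ {c} → Γ₀ ∋ c ⊎ as ∋ c → List Type
    Δs = argCtx Γs R
    hs : ∀ {c} (i : Γ₀ ∋ c ⊎ as ∋ c) → Hom (Δs i) c
    hs (inj₁ q) = id
    hs (inj₂ p) = gs (there p)
    κ : ∀ {c} (i : Γ₀ ∋ c ⊎ as ∋ c) → Ren (Δs i) Γ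
    κ i r = θ (argPos Γs R i r)
    over : ∀ {c} (i : Γ₀ ∋ c ⊎ as ∋ c) {y} (r : Δs i ∋ y) → θ (argPos Γs R i r) ≡ κ i r
    over i r = refl
    es : ∀ {c} (i : Γ₀ ∋ c ⊎ as ∋ c) →
         Den (κ i) (βsub ts ([ (λ q → wkˡ (θ (from R (inj {Γs = Γs} here q)))) , wkʳ Γ ]′ i)) (hs i)
    es (inj₁ q) = subst (λ t → Den (κ (inj₁ q)) t id) (cong [ var , lookupAll ts ]′ (sym (split-wkˡ {xs = Γ} {as} _)))
      (den-var idR refl (≈-sym (act-id id)))
    es (inj₂ p) = subst (λ t → Den (κ (inj₂ p)) t (gs (there p))) (cong [ var , lookupAll ts ]′ (sym (split-wkʳ Γ p))) (ds (there p))

  -- One direction is enough for the generated equivalence: both ends of a step between linear terms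
  -- have denotations of their own, and these agree by `den-unique`.
  den-step  : ∀ {Θ Γ a flag} {θ : Ren Θ Γ} {s t : Tm Γ a} {h} → Step flag s t → Den θ s h → Den θ t h
  den-steps : ∀ {Γ as} {ts us : All (Tm Γ) as} → Steps ts us → ∀ {c} (p : as ∋ c) {Θ} {θ : Ren Θ Γ} {h} →
              Den θ (lookupAll ts p) h → Den θ (lookupAll us p) h
  den-step (β s ts) d = den-β d
  den-step (η s nl) d = den-η d
  den-step (ξlam st) (den-lam d) = den-lam (den-step st d)
  den-step (ξhead st) (den-app (node Γs gs R ds v)) =
    den-app (node Γs gs R (λ { here → den-step st (ds here) ; (there p) → ds (there p) }) v)
  den-step (ξarg sts) (den-app (node Γs gs R ds v)) =
    den-app (node Γs gs R (λ { here → ds here ; (there p) → den-steps sts p (ds (there p)) }) v)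
  den-step (ξfun sts) (den-fun (node Γs gs R ds v)) =
    den-fun (node Γs gs R (λ p → den-steps sts p (ds p)) v)
  den-steps (here st) here d = den-step st d
  den-steps (here st) (there p) d = d
  den-steps (there sts) here d = d
  den-steps (there sts) (there p) d = den-steps sts p d

-- Intrinsically linear terms

module _ {a : Level} {A : Set a} where

  leftPos : ∀ {l r d : List A} → Interleave l r d → ∀ {x} → l ∋ x → d ∋ x
  leftPos (left i)  here      = here
  leftPos (left i)  (there p) = there (leftPos i p)
  leftPos (right i) p         = there (leftPos i p)

  rightPos : ∀ {l r d : List A} → Interleave l r d → ∀ {x} → r ∋ x → d ∋ x
  rightPos (left i)  p         = there (rightPos i p)
  rightPos (right i) here      = here
  rightPos (right i) (there p) = there (rightPos i p)

  side : ∀ {l r d : List A} → Interleave l r d → ∀ {x} → d ∋ x → l ∋ x ⊎ r ∋ x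
  side (left i)  here      = inj₁ here
  side (left i)  (there p) = [ (λ q → inj₁ (there q)) , inj₂ ]′ (side i p)
  side (right i) here      = inj₂ here
  side (right i) (there p) = [ inj₁ , (λ q → inj₂ (there q)) ]′ (side i p)

  side-leftPos : ∀ {l r d : List A} (i : Interleave l r d) {x} (p : l ∋ x) → side i (leftPos i p) ≡ inj₁ p
  side-leftPos (left i)  here      = refl
  side-leftPos (left i)  (there p) rewrite side-leftPos i p = refl
  side-leftPos (right i) p         rewrite side-leftPos i p = refl

  side-rightPos : ∀ {l r d : List A} (i : Interleave l r d) {x} (p : r ∋ x) → side i (rightPos i p) ≡ inj₂ p
  side-rightPos (left i)  p         rewrite side-rightPos i p = refl
  side-rightPos (right i) here      = refl
  side-rightPos (right i) (there p) rewrite side-rightPos i p = refl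

  pos-side : ∀ {l r d : List A} (i : Interleave l r d) {x} (p : d ∋ x) → [ leftPos i , rightPos i ]′ (side i p) ≡ p
  pos-side (left i)  here      = refl
  pos-side (left i)  (there p) with side i p | pos-side i p
  ... | inj₁ q | e = cong there e
  ... | inj₂ q | e = cong there e
  pos-side (right i) here      = refl
  pos-side (right i) (there p) with side i p | pos-side i p
  ... | inj₁ q | e = cong there e
  ... | inj₂ q | e = cong there e

  -- The right-hand list is reindexed on the way, so a shuffle of several lists can be turned into a
  -- permutation of their concatenation one list at a time.
  interleaveR : ∀ {l r r' d : List A} → Interleave l r d → Reindex r' r → Reindex (l ++ r') d
  interleaveR {l} {r} {r'} {d} i ρ = record
    { to      = λ p → bwd (side i p)
    ; from    = λ p → fwd (split l p)
    ; to-from = λ p → trans (bwd-fwd (split l p)) (unsplit-split l p)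
    ; from-to = λ p → trans (fwd-bwd (side i p)) (pos-side i p)
    }
    where
    bwd : ∀ {x} → l ∋ x ⊎ r ∋ x → (l ++ r') ∋ x
    bwd = [ wkˡ , (λ q → wkʳ l (to ρ q)) ]′
    fwd : ∀ {x} → l ∋ x ⊎ r' ∋ x → d ∋ x
    fwd = [ leftPos i , (λ q → rightPos i (from ρ q)) ]′
    bwd-fwd : ∀ {x} (s : l ∋ x ⊎ r' ∋ x) → bwd (side i (fwd s)) ≡ unsplit l s
    bwd-fwd (inj₁ q) = cong bwd (side-leftPos i q)
    bwd-fwd (inj₂ q) = trans (cong bwd (side-rightPos i (from ρ q))) (cong (wkʳ l) (to-from ρ q))
    fwd-bwd : ∀ {x} (s : l ∋ x ⊎ r ∋ x) → fwd (split l (bwd s)) ≡ [ leftPos i , rightPos i ]′ s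
    fwd-bwd (inj₁ q) = cong fwd (split-wkˡ q)
    fwd-bwd (inj₂ q) = trans (cong fwd (split-wkʳ l (to ρ q))) (cong (rightPos i) (from-to ρ q))

  interleaveR-wkˡ : ∀ {l r r' d : List A} (i : Interleave l r d) (ρ : Reindex r' r) {x} (p : l ∋ x) →
                    from (interleaveR i ρ) (wkˡ p) ≡ leftPos i p
  interleaveR-wkˡ {l} {r' = r'} i ρ p = cong [ leftPos i , (λ q → rightPos i (from ρ q)) ]′ (split-wkˡ {xs = l} {r'} p)

  interleaveR-wkʳ : ∀ {l r r' d : List A} (i : Interleave l r d) (ρ : Reindex r' r) {x} (p : r' ∋ x) →
                    from (interleaveR i ρ) (wkʳ l p) ≡ rightPos i (from ρ p)
  interleaveR-wkʳ {l} i ρ p = cong [ leftPos i , (λ q → rightPos i (from ρ q)) ]′ (split-wkʳ l p)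

  appendI : ∀ (l r : List A) → Interleave l r (l ++ r)
  appendI []      r = allRight r
  appendI (x ∷ l) r = left (appendI l r)

  leftPos-append : ∀ (l r : List A) {x} (p : l ∋ x) → leftPos (appendI l r) p ≡ wkˡ p
  leftPos-append (x ∷ l) r here      = refl
  leftPos-append (x ∷ l) r (there p) = cong there (leftPos-append l r p)

  rightPos-allRight : ∀ (r : List A) {x} (p : r ∋ x) → rightPos (allRight r) p ≡ p
  rightPos-allRight (x ∷ r) here      = refl
  rightPos-allRight (x ∷ r) (there p) = cong there (rightPos-allRight r p)

  rightPos-append : ∀ (l r : List A) {x} (p : r ∋ x) → rightPos (appendI l r) p ≡ wkʳ l p
  rightPos-append []      r p = rightPos-allRight r p
  rightPos-append (x ∷ l) r p = cong there (rightPos-append l r p)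

  -- Exhaustive search over the splittings of `d`: each element is pushed into the predicate, once
  -- on either side, so the recursion is on the tail alone.
  anyInterleave? : ∀ {p} {P : List A → List A → Set p} → (∀ l r → Dec (P l r)) →
                   ∀ d → Dec (Σ (List A) (λ l → Σ (List A) (λ r → Interleave l r d × P l r)))
  anyInterleave? P? [] = map′ (λ q → [] , [] , [] , q) (λ { (_ , _ , [] , q) → q }) (P? [] [])
  anyInterleave? P? (x ∷ d) with anyInterleave? (λ l r → P? (x ∷ l) r) d | anyInterleave? (λ l r → P? l (x ∷ r)) d
  ... | yes (l , r , i , q) | _ = yes (_ , _ , left i , q)
  ... | no  _               | yes (l , r , i , q) = yes (_ , _ , right i , q)
  ... | no ¬l               | no ¬r = no λ { (_ , _ , left i , q) → ¬l (_ , _ , i , q) ; (_ , _ , right i , q) → ¬r (_ , _ , i , q) }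

  mapInterleave : ∀ {b} {B : Set b} (f : A → B) {l r d : List A} → Interleave l r d → Interleave (map f l) (map f r) (map f d)
  mapInterleave f []        = []
  mapInterleave f (left i)  = left (mapInterleave f i)
  mapInterleave f (right i) = right (mapInterleave f i)

  mapShuffle : ∀ {b} {B : Set b} (f : A → B) {γs d} → Shuffle γs d → Shuffle (map (map f) γs) (map f d)
  mapShuffle f []      = []
  mapShuffle f (i ∷ s) = mapInterleave f i ∷ mapShuffle f s

module _ {a p : Level} {A : Set a} {P : A → Set p} where

  All-ext : ∀ {xs : List A} {us vs : All P xs} → (∀ {x} (q : xs ∋ x) → lookupAll us q ≡ lookupAll vs q) → us ≡ vs
  All-ext {us = []}     {[]}     e = refl
  All-ext {us = u ∷ us} {v ∷ vs} e = cong₂ _∷_ (e here) (All-ext (λ q → e (there q)))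

module LinearTerms {ℓ : Level} (L : ClosedSignature ℓ) where
  open ClosedSignature L
  open Syntax L

  -- The composite is any `τ` that agrees pointwise, because a composite of lifted renamings is a
  -- lifted composite only pointwise.
  rename-∘ : ∀ {Γ Δ Ω a} {ρ : Ren Γ Δ} {ρ' : Ren Δ Ω} {τ : Ren Γ Ω} → (∀ {x} (p : Γ ∋ x) → ρ' (ρ p) ≡ τ p) →
             (s : Tm Γ a) → rename ρ' (rename ρ s) ≡ rename τ s
  renames-∘ : ∀ {Γ Δ Ω as} {ρ : Ren Γ Δ} {ρ' : Ren Δ Ω} {τ : Ren Γ Ω} → (∀ {x} (p : Γ ∋ x) → ρ' (ρ p) ≡ τ p) →
              (ts : All (Tm Γ) as) → renames ρ' (renames ρ ts) ≡ renames τ ts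
  rename-∘ e (var p)    = cong var (e p)
  rename-∘ {ρ = ρ} e (lam as s) = cong (lam as) (rename-∘ (liftP-cong as ρ e) s)
  rename-∘ e (app s ts) = cong₂ app (rename-∘ e s) (renames-∘ e ts)
  rename-∘ e (fun f ts) = cong (fun f) (renames-∘ e ts)
  renames-∘ e []       = refl
  renames-∘ e (t ∷ ts) = cong₂ _∷_ (rename-∘ e t) (renames-∘ e ts)

  rename-id : ∀ {Γ a} {ρ : Ren Γ Γ} → (∀ {x} (p : Γ ∋ x) → ρ p ≡ p) → (s : Tm Γ a) → rename ρ s ≡ s
  renames-id : ∀ {Γ as} {ρ : Ren Γ Γ} → (∀ {x} (p : Γ ∋ x) → ρ p ≡ p) → (ts : All (Tm Γ) as) → renames ρ ts ≡ ts
  rename-id e (var p)    = cong var (e p)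
  rename-id {Γ} {ρ = ρ} e (lam as s) = cong (lam as) (rename-id (split-elim Γ _
    (λ q → trans (liftP-wkˡ as ρ q) (cong wkˡ (e q))) (liftP-wkʳ as ρ)) s)
  rename-id e (app s ts) = cong₂ app (rename-id e s) (renames-id e ts)
  rename-id e (fun f ts) = cong (fun f) (renames-id e ts)
  renames-id e []       = refl
  renames-id e (t ∷ ts) = cong₂ _∷_ (rename-id e t) (renames-id e ts)

  liftS-wkˡ : ∀ {Γ Δ} as (σ : Sub Γ Δ) {x} (p : Γ ∋ x) → liftS as σ (wkˡ p) ≡ rename wkˡ (σ p)
  liftS-wkˡ {Γ} {Δ} as σ p = cong [ (λ q → rename wkˡ (σ q)) , (λ q → var (wkʳ Δ q)) ]′ (split-wkˡ {xs = Γ} {as} p)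

  liftS-wkʳ : ∀ {Γ Δ} as (σ : Sub Γ Δ) {x} (p : as ∋ x) → liftS as σ (wkʳ Γ p) ≡ var (wkʳ Δ p)
  liftS-wkʳ {Γ} {Δ} as σ p = cong [ (λ q → rename wkˡ (σ q)) , (λ q → var (wkʳ Δ q)) ]′ (split-wkʳ Γ p)

  sub-rename : ∀ {Γ Δ Ω a} {ρ : Ren Γ Δ} {σ : Sub Δ Ω} {τ : Sub Γ Ω} → (∀ {x} (p : Γ ∋ x) → σ (ρ p) ≡ τ p) →
               (s : Tm Γ a) → sub σ (rename ρ s) ≡ sub τ s
  subs-renames : ∀ {Γ Δ Ω as} {ρ : Ren Γ Δ} {σ : Sub Δ Ω} {τ : Sub Γ Ω} → (∀ {x} (p : Γ ∋ x) → σ (ρ p) ≡ τ p) →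
                 (ts : All (Tm Γ) as) → subs σ (renames ρ ts) ≡ subs τ ts
  sub-rename e (var p)    = e p
  sub-rename {Γ} {ρ = ρ} {σ} {τ} e (lam as s) = cong (lam as) (sub-rename (split-elim Γ _
    (λ q → trans (cong (liftS as σ) (liftP-wkˡ as ρ q)) (trans (liftS-wkˡ as σ (ρ q))
             (trans (cong (rename wkˡ) (e q)) (sym (liftS-wkˡ as τ q)))))
    (λ q → trans (cong (liftS as σ) (liftP-wkʳ as ρ q)) (trans (liftS-wkʳ as σ q) (sym (liftS-wkʳ as τ q))))) s)
  sub-rename e (app s ts) = cong₂ app (sub-rename e s) (subs-renames e ts)
  sub-rename e (fun f ts) = cong (fun f) (subs-renames e ts)
  subs-renames e []       = refl
  subs-renames e (t ∷ ts) = cong₂ _∷_ (sub-rename e t) (subs-renames e ts)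

  sub-id : ∀ {Γ a} {σ : Sub Γ Γ} → (∀ {x} (p : Γ ∋ x) → σ p ≡ var p) → (s : Tm Γ a) → sub σ s ≡ s
  subs-id : ∀ {Γ as} {σ : Sub Γ Γ} → (∀ {x} (p : Γ ∋ x) → σ p ≡ var p) → (ts : All (Tm Γ) as) → subs σ ts ≡ ts
  sub-id e (var p)    = e p
  sub-id {Γ} {σ = σ} e (lam as s) = cong (lam as) (sub-id (split-elim Γ _
    (λ q → trans (liftS-wkˡ as σ q) (cong (rename wkˡ) (e q))) (liftS-wkʳ as σ)) s)
  sub-id e (app s ts) = cong₂ app (sub-id e s) (subs-id e ts)
  sub-id e (fun f ts) = cong (fun f) (subs-id e ts)
  subs-id e []       = refl
  subs-id e (t ∷ ts) = cong₂ _∷_ (sub-id e t) (subs-id e ts)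

  renVar : ∀ {Γ Δ} → Ren Γ Δ → Var Γ → Var Δ
  renVar ρ (a , p) = a , ρ p

  ρVars-cong : ∀ {Γ} (as : List Type) {f g : Ren as Γ} → (∀ {a} (q : as ∋ a) → f q ≡ g q) → ρVars as f ≡ ρVars as g
  ρVars-cong []       e = refl
  ρVars-cong (a ∷ as) e = cong₂ _∷_ (cong (a ,_) (e here)) (ρVars-cong as (λ q → e (there q)))

  map-renVar : ∀ {Γ Δ} (ρ : Ren Γ Δ) (as : List Type) (f : Ren as Γ) → map (renVar ρ) (ρVars as f) ≡ ρVars as (λ q → ρ (f q))
  map-renVar ρ []       f = refl
  map-renVar ρ (a ∷ as) f = cong (_ ∷_) (map-renVar ρ as (λ q → f (there q)))

  ρVars-++ : ∀ {Γ} (as bs : List Type) (f : Ren (as ++ bs) Γ) →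
             ρVars (as ++ bs) f ≡ ρVars as (λ q → f (wkˡ q)) ++ ρVars bs (λ q → f (wkʳ as q))
  ρVars-++ []       bs f = refl
  ρVars-++ (a ∷ as) bs f = cong (_ ∷_) (ρVars-++ as bs (λ q → f (there q)))

  ⊢rename : ∀ {Γ Δ a} (ρ : Ren Γ Δ) {γ} {s : Tm Γ a} → γ ⊢ s → map (renVar ρ) γ ⊢ rename ρ s
  ⊢renames : ∀ {Γ Δ as} (ρ : Ren Γ Δ) {γs} {ts : All (Tm Γ) as} → γs ⊢* ts → map (map (renVar ρ)) γs ⊢* renames ρ ts
  ⊢rename ρ (⊢var p) = ⊢var (ρ p)
  ⊢rename {Γ} {Δ} ρ {γ} {lam as s} (⊢lam d) = ⊢lam (subst (_⊢ rename (liftR as ρ) s) eq (⊢rename (liftR as ρ) d))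
    where
    eq : map (renVar (liftR as ρ)) (map (wkVar as) γ ++ ρVars as (wkʳ Γ))
         ≡ map (wkVar as) (map (renVar ρ) γ) ++ ρVars as (wkʳ Δ)
    eq = trans (map-++ (renVar (liftR as ρ)) (map (wkVar as) γ) (ρVars as (wkʳ Γ)))
      (cong₂ _++_
        (trans (sym (map-∘ γ)) (trans (map-cong (λ (a , p) → cong (a ,_) (liftP-wkˡ as ρ p)) γ) (map-∘ γ)))
        (trans (map-renVar (liftR as ρ) as (wkʳ Γ)) (ρVars-cong as (liftP-wkʳ as ρ))))
  ⊢rename ρ (⊢app d ds sh) = ⊢app (⊢rename ρ d) (⊢renames ρ ds) (mapShuffle (renVar ρ) sh)
  ⊢rename ρ (⊢fun ds sh) = ⊢fun (⊢renames ρ ds) (mapShuffle (renVar ρ) sh)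
  ⊢renames ρ []       = []
  ⊢renames ρ (d ∷ ds) = ⊢rename ρ d ∷ ⊢renames ρ ds

  -- Unlike in Tm, a subterm lives over its own variables only, so that a functor defined on Lin can be evaluated
  -- on every subterm; linearize shows that nothing is lost.
  data LTm  : List Type → Type → Set ℓ
  data LTms : List Type → List Type → Set ℓ
  data LTm where
    lvar : ∀ {a} → LTm (a ∷ []) a
    llam : ∀ {Θ as b} → LTm (Θ ++ as) b → LTm Θ (as ⊸ b)
    lapp : ∀ {Θ as b} → LTms ((as ⊸ b) ∷ as) Θ → LTm Θ b
    lfun : ∀ {Θ as b} → Arr as b → LTms as Θ → LTm Θ b
  data LTms where
    []   : LTms [] []
    cons : ∀ {a as Γ Θ' Θ} → Interleave Γ Θ' Θ → LTm Γ a → LTms as Θ' → LTms (a ∷ as) Θ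

  -- Function and arguments are kept in a single list that matches the inputs of `ev`, so
  -- applications and multiarrow nodes are handled alike.
  appAll : ∀ {Γ as b} → All (Tm Γ) ((as ⊸ b) ∷ as) → Tm Γ b
  appAll (s ∷ ts) = app s ts

  rename-appAll : ∀ {Γ Δ as b} (ρ : Ren Γ Δ) (ts : All (Tm Γ) ((as ⊸ b) ∷ as)) → rename ρ (appAll ts) ≡ appAll (renames ρ ts)
  rename-appAll ρ (s ∷ ts) = refl

  erase  : ∀ {Θ a} → LTm Θ a → Tm Θ a
  erases : ∀ {as Θ} → LTms as Θ → All (Tm Θ) as
  erase lvar                = var here
  erase (llam {as = as} t)  = lam as (erase t)
  erase (lapp ts)           = appAll (erases ts)
  erase (lfun f ts)         = fun f (erases ts)
  erases []                 = []
  erases (cons i t ts)      = rename (leftPos i) (erase t) ∷ renames (rightPos i) (erases ts)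

  interleaveVars : ∀ {X l r d} (i : Interleave l r d) (f : Ren d X) →
                   Interleave (ρVars l (λ q → f (leftPos i q))) (ρVars r (λ q → f (rightPos i q))) (ρVars d f)
  interleaveVars []        f = []
  interleaveVars (left i)  f = left (interleaveVars i (λ q → f (there q)))
  interleaveVars (right i) f = right (interleaveVars i (λ q → f (there q)))

  typed-erase  : ∀ {Θ a} (t : LTm Θ a) → allVars Θ ⊢ erase t
  typed-erases : ∀ {as Θ} (ts : LTms as Θ) → Σ (List (List (Var Θ))) (λ γs → γs ⊢* erases ts × Shuffle γs (allVars Θ))
  typed-erase lvar = ⊢var here
  typed-erase (llam {Θ} {as} t) = ⊢lam (subst (_⊢ erase t)
    (trans (ρVars-++ Θ as (λ q → q)) (cong (_++ ρVars as (wkʳ Θ)) (sym (map-renVar wkˡ Θ (λ q → q))))) (typed-erase t))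
  typed-erase (lapp ts) with erases ts | typed-erases ts
  ... | s ∷ us | γ ∷ γs , d ∷ ds , sh = ⊢app d ds sh
  typed-erase (lfun f ts) with typed-erases ts
  ... | γs , ds , sh = ⊢fun ds sh
  typed-erases [] = [] , [] , []
  typed-erases {Θ = Θ} (cons {Γ = Γ} {Θ'} i t ts) with typed-erases ts
  ... | γs , ds , sh = _ , ⊢rename (leftPos i) (typed-erase t) ∷ ⊢renames (rightPos i) ds
      , subst₂ (λ l r → Interleave l r (allVars Θ)) (sym (map-renVar (leftPos i) Γ (λ q → q)))
          (sym (map-renVar (rightPos i) Θ' (λ q → q))) (interleaveVars i (λ q → q))
      ∷ mapShuffle (renVar (rightPos i)) sh

  -- The typing rules interleave variables of the ambient context, `LTms` interleaves types; listing
  -- the variables along `θ` carries the former to the latter.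
  splitVars : ∀ {X} (Θ : List Type) (θ : Ren Θ X) {γ δ} → Interleave γ δ (ρVars Θ θ) →
              Σ (List Type) (λ l → Σ (List Type) (λ r → Σ (Interleave l r Θ) (λ i →
                γ ≡ ρVars l (λ q → θ (leftPos i q)) × δ ≡ ρVars r (λ q → θ (rightPos i q)))))
  splitVars []      θ [] = [] , [] , [] , refl , refl
  splitVars (a ∷ Θ) θ (left i) with splitVars Θ (λ q → θ (there q)) i
  ... | l , r , j , e , e' = a ∷ l , r , left j , cong (_ ∷_) e , e'
  splitVars (a ∷ Θ) θ (right i) with splitVars Θ (λ q → θ (there q)) i
  ... | l , r , j , e , e' = l , a ∷ r , right j , e , cong (_ ∷_) e'

  -- A subterm uses only some variables of `Γ`, in the order of its own context `γ`. The induction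
  -- therefore runs over all `Θ` and `θ` that enumerate `γ`.
  linearize  : ∀ {Γ a γ} {s : Tm Γ a} → γ ⊢ s → ∀ Θ (θ : Ren Θ Γ) → γ ≡ ρVars Θ θ →
               Σ (LTm Θ a) (λ t → rename θ (erase t) ≡ s)
  linearizes : ∀ {Γ as γs δ} {ss : All (Tm Γ) as} → γs ⊢* ss → Shuffle γs δ → ∀ Θ (θ : Ren Θ Γ) → δ ≡ ρVars Θ θ →
               Σ (LTms as Θ) (λ ts → renames θ (erases ts) ≡ ss)
  linearize (⊢var p) (a ∷ []) θ refl = lvar , refl
  linearize (⊢var p) [] θ ()
  linearize (⊢var p) (a ∷ b ∷ Θ) θ ()
  linearize {Γ} (⊢lam {as = as} {γ = γ} d) Θ θ e with linearize d (Θ ++ as) (liftR as θ)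
    (sym (trans (ρVars-++ Θ as (liftR as θ)) (cong₂ _++_
      (trans (ρVars-cong Θ (liftP-wkˡ as θ)) (trans (sym (map-renVar wkˡ Θ θ)) (cong (map (wkVar as)) (sym e))))
      (ρVars-cong as (liftP-wkʳ as θ)))))
  ... | t , eq = llam t , cong (lam as) eq
  linearize (⊢app d ds (i ∷ sh)) Θ θ refl with splitVars Θ θ i
  ... | l , r , j , e , e' with linearize d l (λ q → θ (leftPos j q)) e | linearizes ds sh r (λ q → θ (rightPos j q)) e'
  ...   | t , eq | ts , eqs = lapp (cons j t ts)
        , cong₂ app (trans (rename-∘ (λ _ → refl) (erase t)) eq) (trans (renames-∘ (λ _ → refl) (erases ts)) eqs)
  linearize (⊢fun {f = f} ds sh) Θ θ e with linearizes ds sh Θ θ e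
  ... | ts , eq = lfun f ts , cong (fun f) eq
  linearizes [] [] [] θ e = [] , refl
  linearizes [] [] (a ∷ Θ) θ ()
  linearizes (d ∷ ds) (i ∷ sh) Θ θ refl with splitVars Θ θ i
  ... | l , r , j , e , e' with linearize d l (λ q → θ (leftPos j q)) e | linearizes ds sh r (λ q → θ (rightPos j q)) e'
  ...   | t , eq | ts , eqs = cons j t ts
        , cong₂ _∷_ (trans (rename-∘ (λ _ → refl) (erase t)) eq) (trans (renames-∘ (λ _ → refl) (erases ts)) eqs)

  -- Equality of atoms is not assumed decidable; the position alone decides, and it determines the
  -- type.
  _≟Var_ : ∀ {Γ} (v w : Var Γ) → Dec (v ≡ w)
  (_ , here)    ≟Var (_ , here)    = yes refl
  (_ , here)    ≟Var (_ , there q) = no λ ()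
  (_ , there p) ≟Var (_ , here)    = no λ ()
  (a , there p) ≟Var (b , there q) = map′ (λ { refl → refl }) (λ { refl → refl }) ((a , p) ≟Var (b , q))

  -- The derivation stored in a Lin is irrelevant, so it has to be recomputed by a (brute force) decision procedure.
  ⊢?  : ∀ {Γ a} (γ : List (Var Γ)) (s : Tm Γ a) → Dec (γ ⊢ s)
  ⊢*? : ∀ {Γ as} (δ : List (Var Γ)) (ss : All (Tm Γ) as) → Dec (Σ (List (List (Var Γ))) (λ γs → γs ⊢* ss × Shuffle γs δ))
  ⊢? []          (var p) = no λ ()
  ⊢? (v ∷ [])    (var p) = map′ (λ { refl → ⊢var p }) (λ { (⊢var _) → refl }) (v ≟Var (_ , p))
  ⊢? (v ∷ w ∷ γ) (var p) = no λ ()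
  ⊢? γ (lam as s) = map′ ⊢lam (λ { (⊢lam d) → d }) (⊢? _ s)
  ⊢? γ (app s ss) = map′
    (λ { (_ , _ , i , d , (_ , ds , sh)) → ⊢app d ds (i ∷ sh) })
    (λ { (⊢app d ds (i ∷ sh)) → _ , _ , i , d , (_ , ds , sh) })
    (anyInterleave? {P = λ l r → l ⊢ s × Σ (List (List (Var _))) (λ γs → γs ⊢* ss × Shuffle γs r)}
      (λ l r → ⊢? l s ×-dec ⊢*? r ss) γ)
  ⊢? γ (fun f ss) = map′ (λ { (_ , ds , sh) → ⊢fun ds sh }) (λ { (⊢fun ds sh) → _ , ds , sh }) (⊢*? γ ss)
  ⊢*? []      [] = yes ([] , [] , [])
  ⊢*? (v ∷ δ) [] = no λ { (_ , [] , ()) }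
  ⊢*? δ (s ∷ ss) = map′
    (λ { (_ , _ , i , d , (_ , ds , sh)) → _ , d ∷ ds , i ∷ sh })
    (λ { (_ , d ∷ ds , i ∷ sh) → _ , _ , i , d , (_ , ds , sh) })
    (anyInterleave? {P = λ l r → l ⊢ s × Σ (List (List (Var _))) (λ γs → γs ⊢* ss × Shuffle γs r)}
      (λ l r → ⊢? l s ×-dec ⊢*? r ss) δ)

-- Existence and uniqueness

module LinearNodes {ℓ : Level} (L : ClosedSignature ℓ) where
  open Syntax L
  open TermLists L
  open LinearTerms L

  argCtxs : ∀ {as Θ} → LTms as Θ → Fam {X = Type} as
  argCtxs (cons {Γ = Γ} i t ts) here      = Γ
  argCtxs (cons i t ts)         (there p) = argCtxs ts p

  arg : ∀ {as Θ} (ts : LTms as Θ) {c} (p : as ∋ c) → LTm (argCtxs ts p) c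
  arg (cons i t ts) here      = t
  arg (cons i t ts) (there p) = arg ts p

  argCover : ∀ {as Θ} (ts : LTms as Θ) → Reindex (concatF as (argCtxs ts)) Θ
  argCover []            = idR
  argCover (cons i t ts) = interleaveR i (argCover ts)

  argPosition : ∀ {as Θ} (ts : LTms as Θ) {c} (p : as ∋ c) → Ren (argCtxs ts p) Θ
  argPosition ts p q = from (argCover ts) (inj {Γs = argCtxs ts} p q)

  lookup-erases : ∀ {as Θ} (ts : LTms as Θ) {c} (p : as ∋ c) →
                  lookupAll (erases ts) p ≡ rename (argPosition ts p) (erase (arg ts p))
  lookup-erases (cons i t ts) here = trans (sym (rename-id (λ _ → refl) _))
    (rename-∘ (λ q → sym (interleaveR-wkˡ i (argCover ts) q)) (erase t))
  lookup-erases (cons i t ts) (there p) = trans (lookupAll-renames (rightPos i) (erases ts) p)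
    (trans (cong (rename (rightPos i)) (lookup-erases ts p))
      (rename-∘ (λ q → sym (interleaveR-wkʳ i (argCover ts) (inj {Γs = argCtxs ts} p q))) (erase (arg ts p))))

  -- The trivial shuffle. It shows that composing a generic node with linear terms is again linear,
  -- as the statement of preservation of composition presupposes.
  concatTms : ∀ as (Γs : Fam {X = Type} as) → (∀ {c} (p : as ∋ c) → LTm (Γs p) c) → LTms as (concatF as Γs)
  concatTms []       Γs us = []
  concatTms (a ∷ as) Γs us = cons (appendI (Γs here) _) (us here) (concatTms as (λ p → Γs (there p)) (λ p → us (there p)))

  lookup-concatTms : ∀ as (Γs : Fam {X = Type} as) (us : ∀ {c} (p : as ∋ c) → LTm (Γs p) c) {c} (p : as ∋ c) →
                     lookupAll (erases (concatTms as Γs us)) p ≡ rename (inj {Γs = Γs} p) (erase (us p))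
  lookup-concatTms (a ∷ as) Γs us here = trans (sym (rename-id (λ _ → refl) _))
    (rename-∘ (λ q → leftPos-append (Γs here) _ q) (erase (us here)))
  lookup-concatTms (a ∷ as) Γs us (there p) = trans (lookupAll-renames (rightPos (appendI (Γs here) _)) (erases us') p)
    (trans (cong (rename (rightPos (appendI (Γs here) _))) (lookup-concatTms as (λ p → Γs (there p)) (λ p → us (there p)) p))
      (rename-∘ (λ q → rightPos-append (Γs here) _ (inj {Γs = λ p → Γs (there p)} p q)) (erase (us (there p)))))
    where
    us' : LTms as (concatF as (λ p → Γs (there p)))
    us' = concatTms as (λ p → Γs (there p)) (λ p → us (there p))

  canonical : ∀ {Γ a} (s : Lin Γ a) → Σ (LTm Γ a) (λ t → erase t ≡ term s)
  canonical {Γ} (lin s d) with linearize (recompute (⊢? (allVars Γ) s) d) Γ (λ q → q) refl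
  ... | t , e = t , trans (sym (rename-id (λ _ → refl) (erase t))) e

-- The interpretation as a closed functor

module Evaluation {ℓ m e : Level} (L : ClosedSignature ℓ) (M : ClosedModel L m e) where
  open ClosedSignature L
  open ClosedModel M
  open Syntax L
  open LinearTerms L
  open LinearNodes L
  open Denotation L M
  open Soundness L M

  eval  : ∀ {Θ a} → LTm Θ a → Hom Θ a
  evals : ∀ {as Θ} (ts : LTms as Θ) {c} (p : as ∋ c) → Hom (argCtxs ts p) c
  eval lvar                  = id
  eval (llam {Θ} t)          = curry {Θ} (eval t)
  eval (lapp ts)             = act (comp ev (argCtxs ts) (evals ts)) (argCover ts)
  eval (lfun f ts)           = act (comp (arr f) (argCtxs ts) (evals ts)) (argCover ts)
  evals (cons i t ts) here      = eval t
  evals (cons i t ts) (there p) = evals ts p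

  den-eval  : ∀ {Θ a} (t : LTm Θ a) → Den (λ q → q) (erase t) (eval t)
  den-evals : ∀ {as Θ} (ts : LTms as Θ) {c} (p : as ∋ c) → Den (λ q → q) (erase (arg ts p)) (evals ts p)
  den-args  : ∀ {as Θ} (ts : LTms as Θ) {c} (p : as ∋ c) → Den (argPosition ts p) (lookupAll (erases ts) p) (evals ts p)
  den-eval lvar = den-var idR refl (≈-sym (act-id id))
  den-eval (llam {Θ} {as} t) = den-lam (den-≈ (uncurry-curry (eval t)) (den-≗ lift-id (den-eval t)))
    where
    lift-id : ∀ {x} (q : (Θ ++ as) ∋ x) → liftR {Θ} as (λ q → q) q ≡ q
    lift-id = split-elim Θ _ (liftP-wkˡ as (λ q → q)) (liftP-wkʳ as (λ q → q))
  -- Abstracting `erases ts` exposes its head, without which `appAll` does not reduce to an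
  -- application.
  den-eval (lapp ts) with erases ts | den-args ts
  ... | s ∷ us | ds = den-app (node (argCtxs ts) (evals ts) (argCover ts) ds ≈-refl)
  den-eval (lfun f ts) = den-fun (node (argCtxs ts) (evals ts) (argCover ts) (den-args ts) ≈-refl)
  den-evals (cons i t ts) here      = den-eval t
  den-evals (cons i t ts) (there p) = den-evals ts p
  den-args ts p = subst (λ t → Den (argPosition ts p) t (evals ts p)) (sym (lookup-erases ts p))
    (den-rename (argPosition ts p) (λ _ → refl) (den-evals ts p))

  -- A symmetric closed functor into the model that is the identity on objects and has the
  -- prescribed values on multiarrows; over the pulled-back model its laws involve no transport.
  record Functor : Set (ℓ ⊔ m ⊔ e) where
    field
      apply      : ∀ {Γ a} → Lin Γ a → Hom Γ a
      apply-cong : ∀ {Γ a} {s t : Lin Γ a} → s ≈sc t → apply s ≈ apply t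
      apply-id   : ∀ {a} → apply (idLin {a}) ≈ id
      apply-comp : ∀ {bs c} (s : Lin bs c) (Γs : Fam bs) (ts : ∀ {b} (p : bs ∋ b) → Lin (Γs p) b)
               .(d : allVars (concatF bs Γs) ⊢ compTm (term s) Γs (λ p → term (ts p))) →
               apply (lin (compTm (term s) Γs (λ p → term (ts p))) d) ≈ comp (apply s) Γs (λ p → apply (ts p))
      apply-act  : ∀ {Γ Δ a} (s : Lin Γ a) (ρ : Reindex Γ Δ) .(d : allVars Δ ⊢ actTm (term s) ρ) →
               apply (lin (actTm (term s) ρ) d) ≈ act (apply s) ρ
      apply-ev   : ∀ (as : List Type) (b : Type) → apply (evLin as b) ≈ ev
      apply-arr  : ∀ {as b} (f : Arr as b) → apply (funLin f) ≈ arr f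

  interpret : ∀ {Γ a} → Lin Γ a → Hom Γ a
  interpret s = eval (proj₁ (canonical s))

  den-interpret : ∀ {Γ a} (s : Lin Γ a) → Den (λ q → q) (term s) (interpret s)
  den-interpret s = subst (λ t → Den (λ q → q) t (interpret s)) (proj₂ (canonical s)) (den-eval (proj₁ (canonical s)))

  -- By the right unit law `f` is its own composite with identities, one for each variable; this
  -- settles evaluation and all multiarrows together.
  den-generator : ∀ {as b} (f : Hom as b) → Node (λ q → q) f (tabAll var) f
  den-generator {as} f = node (λ {c} _ → c ∷ []) (λ _ → id) (castR (concatF-single as))
    (λ p → subst (λ t → Den (λ q → from (castR (concatF-single as)) (inj {Γs = λ {c} _ → c ∷ []} p q)) t id) (sym (lookupAll-tabAll var p))
      (den-var idR (single-inj as p) (≈-sym (act-id id))))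
    (≈-sym (≈-trans (unitʳ f (λ _ → idR) (λ _ → ≈-sym (act-id id)) (castR (concatF-single as)) idR
      (λ p → sym (single-inj as p))) (act-id f)))

  interpretation : Functor
  interpretation = record
    { apply = interpret
    ; apply-cong = gfold ≈-equiv interpret (λ {s} {t} st → ≈-sym (den-unique (den-step st (den-interpret s)) (den-interpret t)))
    ; apply-id = λ {a} → den-unique (den-var idR refl (≈-sym (act-id id))) (den-interpret idLin)
    ; apply-comp = λ s Γs ts d → den-unique
        (den-sub (λ p → rename (inj {Γs = Γs} p) (term (ts p))) {Γs} {λ p → interpret (ts p)} {λ p → inj {Γs = Γs} p}
          (λ p → den-rename (inj {Γs = Γs} p) (λ _ → refl) (den-interpret (ts p))) idR (λ _ _ → refl) (≈-sym (act-id _)) (den-interpret s))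
        (den-interpret (lin (compTm (term s) Γs (λ p → term (ts p))) d))
    ; apply-act = λ s ρ d → den-unique
        (den-act ρ (λ _ → refl) ≈-refl (den-rename {θ' = from ρ} (from ρ) (λ _ → refl) (den-interpret s)))
        (den-interpret (lin (actTm (term s) ρ) d))
    ; apply-ev = λ as b → den-unique (den-app (den-generator ev)) (den-interpret (evLin as b))
    ; apply-arr = λ f → den-unique (den-fun (den-generator (arr f))) (den-interpret (funLin f))
    }

-- Any such functor is the interpretation

module Uniqueness {ℓ m e : Level} (L : ClosedSignature ℓ) (M : ClosedModel L m e) (G : Evaluation.Functor L M) where
  open ClosedModel M
  open Syntax L
  open TermLists L
  open LinearTerms L
  open LinearNodes L
  open Evaluation L M
  open Functor G

  apply-≡ : ∀ {Γ a} {s t : Tm Γ a} → s ≡ t → .(d : allVars Γ ⊢ s) .(d' : allVars Γ ⊢ t) → apply (lin s d) ≈ apply (lin t d')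
  apply-≡ refl d d' = ≈-refl

  linTm : ∀ {Θ a} → LTm Θ a → Lin Θ a
  linTm t = lin (erase t) (typed-erase t)

  -- Abstracts from the two node shapes: `wrap` forms the node from its list of subterms, and `head`
  -- is the generic node on variables, that is, `evLin` or `funLin f`.
  module _ {as b} (head : Lin as b) (wrap : ∀ {Γ} → All (Tm Γ) as → Tm Γ b)
           (sub-wrap : ∀ {Γ Δ} (σ : Sub Γ Δ) (ts : All (Tm Γ) as) → sub σ (wrap ts) ≡ wrap (subs σ ts))
           (rename-wrap : ∀ {Γ Δ} (ρ : Ren Γ Δ) (ts : All (Tm Γ) as) → rename ρ (wrap ts) ≡ wrap (renames ρ ts))
           (head-wrap : term head ≡ wrap (tabAll var))
           (lnode : ∀ {Θ} → LTms as Θ → LTm Θ b) (erase-lnode : ∀ {Θ} (ts : LTms as Θ) → erase (lnode ts) ≡ wrap (erases ts)) where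

    comp-wrap : (Γs : Fam {X = Type} as) (us : ∀ {c} (p : as ∋ c) → Tm (Γs p) c) →
                compTm (term head) Γs us ≡ wrap (tabAll (λ p → rename (inj {Γs = Γs} p) (us p)))
    comp-wrap Γs us = trans (cong (sub σ) head-wrap) (trans (sub-wrap σ (tabAll var)) (cong wrap
      (All-ext (λ p → trans (lookupAll-subs σ (tabAll var) p)
        (trans (cong (sub σ) (lookupAll-tabAll var p)) (sym (lookupAll-tabAll σ p)))))))
      where
      σ : Sub as (concatF as Γs)
      σ p = rename (inj {Γs = Γs} p) (us p)

    -- Typability is read off instead of being derived from a substitution lemma for `⊢`: the
    -- composite is the erasure of an intrinsically linear node.
    typed-comp : (Γs : Fam {X = Type} as) (us : ∀ {c} (p : as ∋ c) → LTm (Γs p) c) →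
                 allVars (concatF as Γs) ⊢ compTm (term head) Γs (λ p → erase (us p))
    typed-comp Γs us = subst (allVars (concatF as Γs) ⊢_)
      (trans (erase-lnode (concatTms as Γs us)) (trans (cong wrap (All-ext (λ p →
        trans (lookup-concatTms as Γs us p) (sym (lookupAll-tabAll (λ p → rename (inj {Γs = Γs} p) (erase (us p))) p)))))
        (sym (comp-wrap Γs (λ p → erase (us p))))))
      (typed-erase (lnode (concatTms as Γs us)))

    -- A node is the generic node composed with its subterms over the concatenated contexts and then
    -- permuted by `argCover`; the functor preserves both operations.
    apply-node : ∀ {Θ} (ts : LTms as Θ) → (∀ {c} (p : as ∋ c) → apply (linTm (arg ts p)) ≈ evals ts p) →
             apply (linTm (lnode ts)) ≈ act (comp (apply head) (argCtxs ts) (evals ts)) (argCover ts)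
    apply-node {Θ} ts ih = ≈-trans (apply-≡ eq (typed-erase (lnode ts)) typed-result)
      (≈-trans (apply-act composite (argCover ts) typed-result) (act-cong (argCover ts)
        (≈-trans (apply-comp head (argCtxs ts) (λ p → linTm (arg ts p)) (typed-comp (argCtxs ts) (arg ts)))
          (comp-cong {Γs = argCtxs ts} ≈-refl ih))))
      where
      composite : Lin (concatF as (argCtxs ts)) b
      composite = lin (compTm (term head) (argCtxs ts) (λ p → erase (arg ts p))) (typed-comp (argCtxs ts) (arg ts))
      blocks : All (Tm (concatF as (argCtxs ts))) as
      blocks = tabAll (λ p → rename (inj {Γs = argCtxs ts} p) (erase (arg ts p)))
      eq : erase (lnode ts) ≡ actTm (term composite) (argCover ts)
      eq = trans (erase-lnode ts) (sym (trans (cong (rename (from (argCover ts))) (comp-wrap (argCtxs ts) (λ p → erase (arg ts p))))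
        (trans (rename-wrap (from (argCover ts)) blocks) (cong wrap (All-ext (λ p →
          trans (lookupAll-renames (from (argCover ts)) blocks p)
            (trans (cong (rename (from (argCover ts))) (lookupAll-tabAll (λ p → rename (inj {Γs = argCtxs ts} p) (erase (arg ts p))) p))
              (trans (rename-∘ (λ _ → refl) (erase (arg ts p))) (sym (lookup-erases ts p))))))))))
      typed-result : allVars Θ ⊢ actTm (term composite) (argCover ts)
      typed-result = subst (allVars Θ ⊢_) eq (typed-erase (lnode ts))

  sub-appAll : ∀ {Γ Δ as b} (σ : Sub Γ Δ) (ts : All (Tm Γ) ((as ⊸ b) ∷ as)) → sub σ (appAll ts) ≡ appAll (subs σ ts)
  sub-appAll σ (s ∷ ts) = refl

  typed-castR : ∀ {Γ Δ a} (eq : Γ ≡ Δ) {s : Tm Γ a} → allVars Γ ⊢ s → allVars Δ ⊢ actTm s (castR eq)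
  typed-castR refl {s} d = subst (allVars _ ⊢_) (sym (rename-id (λ _ → refl) s)) d

  -- Both sides are images of β-equal terms: uncurrying applies the abstraction to its own variables.
  apply-uncurry : ∀ {Θ as b} (t : LTm (Θ ++ as) b) → uncurry {Θ} (apply (linTm (llam {Θ} t))) ≈ apply (linTm t)
  apply-uncurry {Θ} {as} {b} t =
    ≈-trans (act-cong (evR Θ {as ⊸ b} as) (≈-trans (comp-cong {Γs = evCtx Θ} (≈-sym (apply-ev as b)) homs)
                (≈-sym (apply-comp (evLin as b) (evCtx Θ) (λ p → linTm (us p)) typed-applied))))
      (≈-trans (≈-sym (apply-act applied (evR Θ {as ⊸ b} as) typed-result)) (apply-cong (forward step ◅ ε)))
    where
    us : ∀ {c} (p : ((as ⊸ b) ∷ as) ∋ c) → LTm (evCtx Θ p) c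
    us here      = llam t
    us (there p) = lvar
    homs : ∀ {c} (p : ((as ⊸ b) ∷ as) ∋ c) → evHom {Θ} (apply (linTm (llam {Θ} t))) p ≈ apply (linTm (us p))
    homs here      = ≈-refl
    homs (there p) = ≈-sym apply-id
    typed-applied : allVars (concatF ((as ⊸ b) ∷ as) (evCtx Θ)) ⊢ compTm (term (evLin as b)) (evCtx Θ) (λ p → erase (us p))
    typed-applied = typed-comp (evLin as b) appAll sub-appAll rename-appAll refl lapp (λ _ → refl) (evCtx Θ) us
    applied : Lin (concatF ((as ⊸ b) ∷ as) (evCtx Θ)) b
    applied = lin (compTm (term (evLin as b)) (evCtx Θ) (λ p → erase (us p))) typed-applied
    typed-result : allVars (Θ ++ as) ⊢ actTm (term applied) (evR Θ {as ⊸ b} as)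
    typed-result = typed-castR (cong (Θ ++_) (concatF-single as)) {term applied} typed-applied
    r₁ : Ren Θ (concatF ((as ⊸ b) ∷ as) (evCtx Θ))
    r₁ = inj {Γs = evCtx Θ {as ⊸ b} {as}} here
    r₂ : Ren (concatF ((as ⊸ b) ∷ as) (evCtx Θ)) (Θ ++ as)
    r₂ = from (evR Θ {as ⊸ b} as)
    ws : All (Tm (Θ ++ as)) as
    ws = tabAll (λ p → var (wkʳ Θ p))
    blocks : All (Tm (concatF ((as ⊸ b) ∷ as) (evCtx Θ))) as
    blocks = tabAll (λ p → var (inj {Γs = evCtx Θ {as ⊸ b} {as}} (there p) here))
    shape : actTm (term applied) (evR Θ {as ⊸ b} as) ≡ app (lam as (rename (liftR as r₂) (rename (liftR as r₁) (erase t)))) ws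
    shape = trans
      (cong (rename r₂) (comp-wrap (evLin as b) appAll sub-appAll rename-appAll refl lapp (λ _ → refl) (evCtx Θ) (λ p → erase (us p))))
      (cong (app _) (All-ext (λ p → trans (lookupAll-renames r₂ blocks p)
        (trans (cong (rename r₂) (lookupAll-tabAll (λ p → var (inj {Γs = evCtx Θ {as ⊸ b} {as}} (there p) here)) p))
          (trans (cong var (evR-there Θ {as ⊸ b} as p)) (sym (lookupAll-tabAll (λ p → var (wkʳ Θ p)) p)))))))
    -- The renamed body lives over `(Θ ++ as) ++ as`. It uses only the inner copy of `as`, which β
    -- replaces by the outer one; on what is left, renaming and substitution cancel.
    collapse : sub (βsub ws) (rename (liftR as r₂) (rename (liftR as r₁) (erase t))) ≡ erase t
    collapse = trans (cong (sub (βsub ws)) (rename-∘ {τ = liftR as (λ q → r₂ (r₁ q))} (liftP-cong as {θ' = r₂} r₁ (λ _ → refl)) (erase t)))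
      (trans (sub-rename (λ _ → refl) (erase t)) (sub-id (split-elim Θ _
        (λ q → trans (cong (βsub ws) (trans (liftP-wkˡ as (λ q → r₂ (r₁ q)) q) (cong wkˡ (evR-here Θ {as ⊸ b} as q))))
                 (cong [ var , lookupAll ws ]′ (split-wkˡ {xs = Θ ++ as} {as} (wkˡ q))))
        (λ q → trans (cong (βsub ws) (liftP-wkʳ as (λ q → r₂ (r₁ q)) q))
                 (trans (cong [ var , lookupAll ws ]′ (split-wkʳ (Θ ++ as) q)) (lookupAll-tabAll (λ p → var (wkʳ Θ p)) q)))) (erase t)))
    step : Step true (actTm (term applied) (evR Θ {as ⊸ b} as)) (erase t)
    step = subst₂ (Step true) (sym shape) collapse (β _ ws)

  apply-eval  : ∀ {Θ a} (t : LTm Θ a) → apply (linTm t) ≈ eval t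
  apply-evals : ∀ {as Θ} (ts : LTms as Θ) {c} (p : as ∋ c) → apply (linTm (arg ts p)) ≈ evals ts p
  apply-eval lvar = apply-id
  -- Preservation of `curry` is not among the functor laws; since uncurrying is injective, it
  -- follows from preservation of `ev` together with β.
  apply-eval (llam {Θ} t) = uncurry-injective (≈-trans (apply-uncurry {Θ} t) (≈-trans (apply-eval t) (≈-sym (uncurry-curry (eval t)))))
  apply-eval (lapp ts) = ≈-trans (apply-node (evLin _ _) appAll sub-appAll rename-appAll refl lapp (λ _ → refl) ts (apply-evals ts))
    (act-cong (argCover ts) (comp-cong {Γs = argCtxs ts} (apply-ev _ _) (λ _ → ≈-refl)))
  apply-eval (lfun f ts) = ≈-trans (apply-node (funLin f) (fun f) (λ _ _ → refl) (λ _ _ → refl) refl (lfun f) (λ _ → refl)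
                                  ts (apply-evals ts))
    (act-cong (argCover ts) (comp-cong {Γs = argCtxs ts} (apply-arr f) (λ _ → ≈-refl)))
  apply-evals (cons i t ts) here      = apply-eval t
  apply-evals (cons i t ts) (there p) = apply-evals ts p

  interpret-unique : ∀ {Γ a} (s : Lin Γ a) → interpret s ≈ apply s
  interpret-unique (lin s d) = ≈-sym (≈-trans (apply-≡ (sym (proj₂ (canonical (lin s d)))) d (typed-erase t)) (apply-eval t))
    where
    t : LTm _ _
    t = proj₁ (canonical (lin s d))

-- Transfer between functors into the pulled-back model and functors into `S`

module _ {ℓ o m e : Level} (L : ClosedSignature ℓ) (S : SymClosedMulticat o m e) (i : SigMap L S) where
  open SigMap i
  open SymClosedMulticat S using (Hom; _≈_)
  open ReindexedMulticat (Reindexed.reindexed S) using (subst-flip; subst-unflip)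
  open Evaluation L (closedModel L S i)

  private
    substDom-flip : ∀ {x y Γ a} (eq : x ≡ y) {f : Hom (x ∷ Γ) a} {g : Hom (y ∷ Γ) a} →
                    subst (λ X → Hom (X ∷ Γ) a) eq f ≈ g → f ≈ subst (λ X → Hom (X ∷ Γ) a) (sym eq) g
    substDom-flip refl e = e

    substDom-unflip : ∀ {x y Γ a} (eq : x ≡ y) {f : Hom (x ∷ Γ) a} {g : Hom (y ∷ Γ) a} →
                      f ≈ subst (λ X → Hom (X ∷ Γ) a) (sym eq) g → subst (λ X → Hom (X ∷ Γ) a) eq f ≈ g
    substDom-unflip refl e = e

  toSCFunctor : Functor → SCFunctor L S i
  toSCFunctor G = record
    { F₁ = apply ; F-cong = apply-cong ; F-id = apply-id
    ; F-comp = λ {bs} s Γs ts d → subst-unflip (map-concatF obj bs Γs) (apply-comp s Γs ts d)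
    ; F-act = apply-act
    ; F-ev = λ as a → substDom-unflip (obj-⊸ as a) (apply-ev as a)
    }
    where open Functor G

  fromSCFunctor : (Ψ : SCFunctor L S i) → ExtendsArr L S i Ψ → Functor
  fromSCFunctor Ψ Ψ-arr = record
    { apply = Φ.F₁ ; apply-cong = Φ.F-cong ; apply-id = Φ.F-id
    ; apply-comp = λ {bs} s Γs ts d → subst-flip (map-concatF obj bs Γs) (Φ.F-comp s Γs ts d)
    ; apply-act = Φ.F-act
    ; apply-ev = λ as a → substDom-flip (obj-⊸ as a) (Φ.F-ev as a)
    ; apply-arr = Ψ-arr
    }
    where module Φ = SCFunctor Ψ

theorem5p4 : ∀ {ℓ o m e : Level} (L : ClosedSignature ℓ) (S : SymClosedMulticat o m e) (i : SigMap L S) →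
    Σ (SCFunctor L S i) (λ Φ →
    ExtendsArr L S i Φ × (∀ (Ψ : SCFunctor L S i) → ExtendsArr L S i Ψ → SameFunctor L S i Φ Ψ))
theorem5p4 L S i =
    toSCFunctor L S i interpretation
  , (λ f → Functor.apply-arr interpretation f)
  , (λ Ψ Ψ-arr s → Uniqueness.interpret-unique L (closedModel L S i) (fromSCFunctor L S i Ψ Ψ-arr) s)
  where open Evaluation L (closedModel L S i)
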